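{- For every $\delta>0$ there exists $N_1=N_1(\delta)$ such that the following holds for every $n\ge N_1$. Let $t$ be an integer in the interval $\left[\delta n,\ \frac{2n-6}{9}-2\right]$, and let $H$ be a $(t+2)K_3$-free graph on $n$ vertices with exactly $N:=\mathrm{ex}(n,(t+1)K_3)+2$ edges. Suppose that $(\mathcal T,\mathcal M,\mathcal I)$ is a maximal tiling triple of $H$ and $(\mathcal T_1,\mathcal T_2,\mathcal T_3,\mathcal T_4)$ is an ideal partition of $\mathcal T$. Write $t_1=|\mathcal T_1|$, $m=|\mathcal M|$, $i=|\mathcal I|$. Then (i) $t_1\in[t-1,\,t+1]$; (ii) $m\in\left(\frac{n-3(t+1)}{2}-\frac{\sqrt{2n}}{2},\ \frac{n-3(t+1)}{2}\right]$; (iii) $i<\sqrt{2n}$.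
   Context: For a graph $F$ and integer $s\ge1$, $sF$ is the disjoint union of $s$ copies of $F$; $\mathrm{ex}(n,\mathcal F)$ is the maximum number of edges of an $n$-vertex graph containing no copy of $\mathcal F$. A tiling triple of a graph $H$ is a triple $(\mathcal T,\mathcal M,\mathcal I)$ where $\mathcal T$ is a set of vertex-disjoint triangles of $H$, $\mathcal M$ is a matching in $H$, $\mathcal I$ is a set of single vertices, and $V(\mathcal T),V(\mathcal M),V(\mathcal I)$ partition $V(H)$. It is maximal if $(|\mathcal T|,|\mathcal M|,|\mathcal I|)$ is lexicographically maximal among all tiling triples of $H$ (so in particular $\mathcal I$ is an independent set). For a triangle $xyz$, an edge $uv$ and a vertex $w$ of $H$: $uv$ sees $xyz$ if some $v_1\in\{x,y,z\}$ satisfies $uv_1,vv_1\in E(H)$; $w$ sees $xyz$ if $w$ is adjacent to at least two of $x,y,z$. An ideal partition $(\mathcal T_1,\mathcal T_2,\mathcal T_3,\mathcal T_4)$ of $\mathcal T$ is obtained as follows: $\mathcal T_1$ consists of the triangles of $\mathcal T$ seen by at least two edges of $\mathcal M$; $\mathcal T_2$ consists of the triangles of $\mathcal T\setminus\mathcal T_1$ seen by at least two vertices of $\mathcal I$, or by one edge of $\mathcal M$ and at least one vertex of $\mathcal I$; for $\mathcal T_3,\mathcal T_4$, start with $D=\mathcal T\setminus(\mathcal T_1\cup\mathcal T_2)$ and $S=\emptyset$, and while some triangle of $D$ sends at most $8(|D|-1)$ edges of $H$ to the other triangles of $D$, move such a triangle from $D$ to $S$; when no such triangle remains, set $\mathcal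 T_3=S$, $\mathcal T_4=D$. -}

module Defs where

open import Data.Bool using (Bool; true; false; _∧_; _∨_; if_then_else_)
open import Data.Nat using (ℕ; zero; suc; _+_; _*_; _∸_; _≤_; _<_; _<ᵇ_)
open import Data.Fin using (Fin; toℕ)
open import Data.Integer as ℤ using (ℤ; +_)
open import Data.List using (List; []; _∷_; _++_; length; filterᵇ; allFin; cartesianProduct; concatMap)
open import Data.Bool.ListAction using (any)
open import Data.List.Membership.Propositional using (_∈_)
open import Data.List.Relation.Binary.Permutation.Propositional using (_↭_)
open import Data.Product using (_×_; _,_; Σ; ∃)
open import Data.Sum using (_⊎_)
open import Data.Empty using (⊥)
open import Relation.Nullary using (¬_)
open import Relation.Binary.PropositionalEquality using (_≡_)
open import Function.Definitions using (Injective)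

record Graph (n : ℕ) : Set where
  field
    adj   : Fin n → Fin n → Bool
    sym   : ∀ u v → adj u v ≡ adj v u
    irrefl : ∀ u → adj u u ≡ false
open Graph public

countᵇ : {A : Set} → (A → Bool) → List A → ℕ
countᵇ p xs = length (filterᵇ p xs)

edgeCount : {n : ℕ} → Graph n → ℕ
edgeCount {n} G =
  countᵇ (λ { (u , v) → (toℕ u <ᵇ toℕ v) ∧ adj G u v })
         (cartesianProduct (allFin n) (allFin n))

ContainsSK3 : {n : ℕ} → ℕ → Graph n → Set
ContainsSK3 {n} s G =
  Σ (Fin s × Fin 3 → Fin n) λ f →
    Injective _≡_ _≡_ f ×
    (∀ a → (adj G (f (a , Fin.zero)) (f (a , Fin.suc Fin.zero)) ≡ true)
         × (adj G (f (a , Fin.zero)) (f (a , Fin.suc (Fin.suc Fin.zero))) ≡ true)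
         × (adj G (f (a , Fin.suc Fin.zero)) (f (a , Fin.suc (Fin.suc Fin.zero))) ≡ true))
  where import Data.Fin as Fin

SK3Free : {n : ℕ} → ℕ → Graph n → Set
SK3Free s G = ¬ ContainsSK3 s G

IsEx : ℕ → ℕ → ℕ → Set
IsEx n s e =
  (Σ (Graph n) λ G → SK3Free s G × edgeCount G ≡ e) ×
  (∀ (G : Graph n) → SK3Free s G → edgeCount G ≤ e)

Tri : ℕ → Set
Tri n = Fin n × Fin n × Fin n

Edge : ℕ → Set
Edge n = Fin n × Fin n

triVerts : {n : ℕ} → Tri n → List (Fin n)
triVerts (x , y , z) = x ∷ y ∷ z ∷ []

edgeVerts : {n : ℕ} → Edge n → List (Fin n)
edgeVerts (u , v) = u ∷ v ∷ []

IsTriangle : {n : ℕ} → Graph n → Tri n → Set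
IsTriangle G (x , y , z) =
  (adj G x y ≡ true) × (adj G x z ≡ true) × (adj G y z ≡ true)

IsEdge : {n : ℕ} → Graph n → Edge n → Set
IsEdge G (u , v) = adj G u v ≡ true

record TilingData (n : ℕ) : Set where
  constructor tiling
  field
    𝒯 : List (Tri n)
    ℳ : List (Edge n)
    ℐ : List (Fin n)
open TilingData public

IsTilingTriple : {n : ℕ} → Graph n → TilingData n → Set
IsTilingTriple {n} G τ =
  (∀ Δ → Δ ∈ 𝒯 τ → IsTriangle G Δ) ×
  (∀ e → e ∈ ℳ τ → IsEdge G e) ×
  ((concatMap triVerts (𝒯 τ) ++ concatMap edgeVerts (ℳ τ) ++ ℐ τ) ↭ allFin n)

_≤lex_ : ℕ × ℕ × ℕ → ℕ × ℕ × ℕ → Set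
(a , b , c) ≤lex (a' , b' , c') =
  a < a' ⊎ (a ≡ a' × (b < b' ⊎ (b ≡ b' × c ≤ c')))

sizes : {n : ℕ} → TilingData n → ℕ × ℕ × ℕ
sizes τ = length (𝒯 τ) , length (ℳ τ) , length (ℐ τ)

IsMaximalTilingTriple : {n : ℕ} → Graph n → TilingData n → Set
IsMaximalTilingTriple G τ =
  IsTilingTriple G τ × (∀ τ' → IsTilingTriple G τ' → sizes τ' ≤lex sizes τ)

edgeSees : {n : ℕ} → Graph n → Edge n → Tri n → Bool
edgeSees G (u , v) Δ = any (λ w → adj G u w ∧ adj G v w) (triVerts Δ)

b2n : Bool → ℕ
b2n true = 1
b2n false = 0

vertexSees : {n : ℕ} → Graph n → Fin n → Tri n → Bool
vertexSees G w (x , y , z) = 1 <ᵇ (b2n (adj G w x) + b2n (adj G w y) + b2n (adj G w z))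

edgesSeeing : {n : ℕ} → Graph n → List (Edge n) → Tri n → ℕ
edgesSeeing G M Δ = countᵇ (λ e → edgeSees G e Δ) M

verticesSeeing : {n : ℕ} → Graph n → List (Fin n) → Tri n → ℕ
verticesSeeing G I Δ = countᵇ (λ w → vertexSees G w Δ) I

-- number of edges of G between the triangle Δ and the triangles in D
-- (all triangles are vertex-disjoint, so this counts each edge once)
sendCount : {n : ℕ} → Graph n → Tri n → List (Tri n) → ℕ
sendCount G Δ D =
  countᵇ (λ { (u , v) → adj G u v })
         (cartesianProduct (triVerts Δ) (concatMap triVerts D))

-- The peeling process: Peel G D S D* S* means that, starting from the
-- current pair (D, S), the process may end with (D*, S*).
data Peel {n : ℕ} (G : Graph n) : List (Tri n) → List (Tri n) →
          List (Tri n) → List (Tri n) → Set where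
  stop : ∀ {D S} →
         (∀ Δ D' → D ↭ (Δ ∷ D') → ¬ (sendCount G Δ D' ≤ 8 * length D')) →
         Peel G D S D S
  move : ∀ {D S D* S*} Δ D' → D ↭ (Δ ∷ D') →
         sendCount G Δ D' ≤ 8 * length D' →
         Peel G D' (Δ ∷ S) D* S* →
         Peel G D S D* S*

InT1 : {n : ℕ} → Graph n → TilingData n → Tri n → Set
InT1 G τ Δ = 2 ≤ edgesSeeing G (ℳ τ) Δ

InT2 : {n : ℕ} → Graph n → TilingData n → Tri n → Set
InT2 G τ Δ = ¬ InT1 G τ Δ ×
  (2 ≤ verticesSeeing G (ℐ τ) Δ ⊎
   (edgesSeeing G (ℳ τ) Δ ≡ 1 × 1 ≤ verticesSeeing G (ℐ τ) Δ))

IsIdealPartition : {n : ℕ} → Graph n → TilingData n →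
                   List (Tri n) → List (Tri n) → List (Tri n) → List (Tri n) → Set
IsIdealPartition G τ T1 T2 T3 T4 =
  Σ (List _) λ R →
    ((T1 ++ T2 ++ R) ↭ 𝒯 τ) ×
    (∀ Δ → Δ ∈ 𝒯 τ → (Δ ∈ T1 → InT1 G τ Δ) × (InT1 G τ Δ → Δ ∈ T1)) ×
    (∀ Δ → Δ ∈ 𝒯 τ → (Δ ∈ T2 → InT2 G τ Δ) × (InT2 G τ Δ → Δ ∈ T2)) ×
    Σ (List _) λ D* → Σ (List _) λ S* →
      Peel G R [] D* S* × (T3 ↭ S*) × (T4 ↭ D*)

_<√_ : ℤ → ℕ → Set
x <√ y = x ℤ.< + 0 ⊎ ℤ.∣ x ∣ * ℤ.∣ x ∣ < y

-- Since e(H) > ex(n,(t+1)K₃), the tiling has exactly k = t + 1 triangles, so n - 3k = 2m + i, and (ii) and (iii) both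
-- say i² < 2n.  Only 𝒯₁ of the ideal partition matters: the s = k - t₁ other triangles are split differently.
--   * hubs (𝒯₁): reordered as xyz with two edges of ℳ seeing x;
--   * twins: not hubs, reordered so that two vertices of ℐ are both joined to x and y;
--   * rich triangles: none of the above, with three vertices outside 𝒯 joined to x and y;
--   * poor triangles: the rest.
-- Maximality bounds the edges between any two parts.  Hubs send at most 7 edges to one another and at most 7 to any other
-- triangle with one exception, twins send at most 8 to one another and to other triangles with one exception.  Rich
-- triangles are greedily paired off into K₆'s; two such K₆'s send at most 28 edges to each other, and unpaired rich
-- triangles at most 8.  Outside 𝒯 a hub, twin, rich, poor triangle sends at most 4m + 2i, 3m + 2i + 2, 3m + i + 5,
-- 2m + i + 6 edges.  On the other hand e(H) is at least two more than the number of edges of the join of K_t with a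
-- balanced complete bipartite graph.  Comparing the two estimates gives a quadratic inequality which, as
-- 9t + 24 ≤ 2n and t is large, forces s ≤ 2 and then i² < 2n.
module Submission where

open import Defs hiding (sym; irrefl)
open import Data.Bool using (Bool; true; false; _∧_; _∨_; not; _xor_)
import Data.Bool.Properties as Boolₚ
open import Data.Empty using (⊥; ⊥-elim)
open import Data.Fin as Fin using (Fin; toℕ; #_)
import Data.Fin.Properties as Finₚ
open import Data.List using (List; []; _∷_; _++_; length; map; concatMap; allFin; lookup; cartesianProduct; tabulate)
import Data.List.Properties as Listₚ
open import Data.Product.Properties using (≡-dec)
open import Data.List.Membership.Propositional using (_∈_)
open import Data.List.Membership.Propositional.Properties using (∈-++⁺ˡ; ∈-++⁺ʳ; ∈-++⁻; ∈-allFin; ∈-∃++; ∈-lookup; ∈-map⁻)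
open import Data.List.Relation.Binary.Disjoint.Propositional using (Disjoint)
open import Data.List.Relation.Binary.Permutation.Propositional using (_↭_; ↭-refl; ↭-sym; ↭-trans; ↭-reflexive; prep; swap; module PermutationReasoning; ↭⇒↭ₛ)
open import Data.List.Relation.Binary.Permutation.Propositional.Properties using (∈-resp-↭; All-resp-↭; ↭-length; map⁺; ++⁺; ++⁺ˡ; ++⁺ʳ; shift; shifts; ++-comm)
import Data.List.Relation.Binary.Permutation.Setoid.Properties as PermSetoidₚ
open import Data.List.Relation.Unary.All as All using (All; []; _∷_)
import Data.List.Relation.Unary.All.Properties as Allₚ
open import Data.List.Relation.Unary.AllPairs using (AllPairs; []; _∷_)
open import Data.List.Relation.Unary.Any using (here; there)
open import Data.List.Relation.Unary.Unique.Propositional using (Unique)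
import Data.List.Relation.Unary.Unique.Propositional.Properties as Uniqueₚ
import Data.List.Relation.Unary.Unique.DecPropositional as UniqueDec
open import Data.Nat using (ℕ; zero; suc; _+_; _*_; _≤_; _<_; _≥_; _≤?_; _<ᵇ_; z≤n; s≤s)
open import Data.Nat.ListAction using (sum)
open import Data.Nat.ListAction.Properties using (sum-++; sum-↭)
import Data.Nat.Properties as ℕₚ
open import Data.Nat.Tactic.RingSolver using (solve-∀)
open import Data.Product using (Σ; ∃; ∃₂; _×_; _,_; proj₁; proj₂)
open import Data.Sum using (_⊎_; inj₁; inj₂; [_,_]′; fromInj₂)
open import Function using (_∘_; id)
open import Relation.Binary.PropositionalEquality using (_≡_; _≢_; refl; sym; trans; cong; cong₂; subst; subst₂; setoid; module ≡-Reasoning)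
open import Relation.Nullary using (¬_; Dec; yes; no; contradiction)
open import Relation.Nullary.Decidable using (True; toWitness; from-no)

-- Hubs are calibrated to the extremal graph: there, two disjoint triangles with one universal
-- vertex each have 7 edges between them, and such a triangle sends 4 edges to a matching edge and 2
-- to a single vertex outside. So the main terms of hubs cancel, and what decides is the s other
-- triangles. Relative to a hub, a twin, rich or poor triangle loses about m, m + i or 2m + i edges
-- to the outside, while a pair of the same kind gains up to 1, on average 4/3, or 2 edges. Moreover
-- the outside falls short of a balanced complete bipartite graph by about i²/4 edges; this term
-- finally bounds i. The hypothesis on n gives m ≥ 3k/4 - i/2. If all triangles were rich, the
-- trivial 9 edges per pair would allow a gain of about k² against a loss of 3k²/4 at i = 0; the K₆
-- pairing lowers 9 to an average of 25/3 and the gain to 2k²/3. Twins are the critical case: for t₂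
-- = i = k gain and loss are both k²/2 to second order, so linear terms decide, and the small
-- additive constants in the counts must be kept.

private variable
  A B : Set
  n : ℕ

-- Sums over lists

∑ : (A → ℕ) → List A → ℕ
∑ f xs = sum (map f xs)

∑-++ : (f : A → ℕ) (xs ys : List A) → ∑ f (xs ++ ys) ≡ ∑ f xs + ∑ f ys
∑-++ f xs ys = trans (cong sum (Listₚ.map-++ f xs ys)) (sum-++ (map f xs) (map f ys))

∑-↭ : (f : A → ℕ) {xs ys : List A} → xs ↭ ys → ∑ f xs ≡ ∑ f ys
∑-↭ f p = sum-↭ (map⁺ f p)

∑-concatMap : (f : B → ℕ) (g : A → List B) (xs : List A) → ∑ f (concatMap g xs) ≡ ∑ (λ a → ∑ f (g a)) xs
∑-concatMap f g []       = refl
∑-concatMap f g (x ∷ xs) = trans (∑-++ f (g x) (concatMap g xs)) (cong (∑ f (g x) +_) (∑-concatMap f g xs))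

∑-cong : {f g : A → ℕ} → (∀ x → f x ≡ g x) → (xs : List A) → ∑ f xs ≡ ∑ g xs
∑-cong eq xs = cong sum (Listₚ.map-cong eq xs)

+-interchange : ∀ a b c d → (a + b) + (c + d) ≡ (a + c) + (b + d)
+-interchange = solve-∀

∑-+ : (f g : A → ℕ) (xs : List A) → ∑ (λ x → f x + g x) xs ≡ ∑ f xs + ∑ g xs
∑-+ f g []       = refl
∑-+ f g (x ∷ xs) = trans (cong (f x + g x +_) (∑-+ f g xs)) (+-interchange (f x) (g x) _ _)

∑-zero : (xs : List A) → ∑ (λ _ → 0) xs ≡ 0
∑-zero []       = refl
∑-zero (x ∷ xs) = ∑-zero xs

∑-swap : (f : A → B → ℕ) (xs : List A) (ys : List B) →
         ∑ (λ x → ∑ (f x) ys) xs ≡ ∑ (λ y → ∑ (λ x → f x y) xs) ys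
∑-swap f []       ys = sym (∑-zero ys)
∑-swap f (x ∷ xs) ys = trans (cong (∑ (f x) ys +_) (∑-swap f xs ys)) (sym (∑-+ (f x) _ ys))

∑-mono : {f g : A → ℕ} (xs : List A) → (∀ {x} → x ∈ xs → f x ≤ g x) → ∑ f xs ≤ ∑ g xs
∑-mono []       le = z≤n
∑-mono (x ∷ xs) le = ℕₚ.+-mono-≤ (le (here refl)) (∑-mono xs (le ∘ there))

∑-const : (c : ℕ) (xs : List A) → ∑ (λ _ → c) xs ≡ length xs * c
∑-const c []       = refl
∑-const c (x ∷ xs) = cong (c +_) (∑-const c xs)

∑-*ʳ : (f : A → ℕ) (c : ℕ) (xs : List A) → ∑ (λ x → f x * c) xs ≡ ∑ f xs * c
∑-*ʳ f c []       = refl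
∑-*ʳ f c (x ∷ xs) = trans (cong (f x * c +_) (∑-*ʳ f c xs)) (sym (ℕₚ.*-distribʳ-+ c (f x) _))

∑-bound : {f : A → ℕ} {c : ℕ} (xs : List A) → (∀ {x} → x ∈ xs → f x ≤ c) → ∑ f xs ≤ length xs * c
∑-bound {c = c} xs le = ℕₚ.≤-trans (∑-mono xs le) (ℕₚ.≤-reflexive (∑-const c xs))

-- A term above `c` forces every other term down to `c` by the pairwise hypothesis, so the surplus
-- `e` is paid only once. This turns exchange arguments, which exclude two bad triangles at a time,
-- into a bound for a sum.
∑-bound-one-exception : {f : A → ℕ} (c e : ℕ) (xs : List A) →
  AllPairs (λ a b → f a ≤ c ⊎ f b ≤ c) xs → (∀ {x} → x ∈ xs → f x ≤ c + e) → ∑ f xs ≤ length xs * c + e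
∑-bound-one-exception c e [] _ _ = z≤n
∑-bound-one-exception {f = f} c e (x ∷ xs) (px ∷ pxs) le with f x ≤? c
... | yes small = ℕₚ.≤-trans (ℕₚ.+-mono-≤ small (∑-bound-one-exception c e xs pxs (le ∘ there)))
                             (ℕₚ.≤-reflexive (sym (ℕₚ.+-assoc c _ e)))
... | no  large = begin
    f x + ∑ f xs                 ≤⟨ ℕₚ.+-mono-≤ (le (here refl)) (∑-bound xs others) ⟩
    c + e + length xs * c        ≡⟨ arith c e _ ⟩
    c + length xs * c + e        ∎
  where
  open ℕₚ.≤-Reasoning
  arith : ∀ c e l → c + e + l ≡ c + l + e
  arith = solve-∀
  others : ∀ {y} → y ∈ xs → f y ≤ c
  others y∈ = [ (λ small → contradiction small large) , id ]′ (All.lookup px y∈)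

countᵇ-∑ : (p : A → Bool) (xs : List A) → countᵇ p xs ≡ ∑ (λ x → b2n (p x)) xs
countᵇ-∑ p [] = refl
countᵇ-∑ p (x ∷ xs) with p x
... | true  = cong suc (countᵇ-∑ p xs)
... | false = countᵇ-∑ p xs

∑-cartesianProduct : (f : A × B → ℕ) (xs : List A) (ys : List B) →
  ∑ f (cartesianProduct xs ys) ≡ ∑ (λ x → ∑ (λ y → f (x , y)) ys) xs
∑-cartesianProduct f []       ys = refl
∑-cartesianProduct f (x ∷ xs) ys = trans (∑-++ f (map (x ,_) ys) _)
  (cong₂ _+_ (cong sum (sym (Listₚ.map-∘ ys))) (∑-cartesianProduct f xs ys))

countᵇ-pos : (p : A → Bool) (xs : List A) → 1 ≤ countᵇ p xs → ∃ λ x → x ∈ xs × p x ≡ true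
countᵇ-pos p (x ∷ xs) le with p x in eq
... | true  = x , here refl , eq
... | false = let y , y∈ , py = countᵇ-pos p xs le in y , there y∈ , py

countᵇ-two : (p : A → Bool) (xs : List A) → Unique xs → 2 ≤ countᵇ p xs →
  ∃₂ λ x y → x ≢ y × (x ∈ xs × p x ≡ true) × (y ∈ xs × p y ≡ true)
countᵇ-two p (x ∷ xs) (x∉ ∷ u) le with p x in eq
... | true  = let y , y∈ , py = countᵇ-pos p xs (ℕₚ.≤-pred le)
              in x , y , All.lookup x∉ y∈ , (here refl , eq) , (there y∈ , py)
... | false = let y , z , y≢z , (y∈ , py) , (z∈ , pz) = countᵇ-two p xs u le
              in y , z , y≢z , (there y∈ , py) , (there z∈ , pz)

-- Edge counts between vertex lists

module _ (G : Graph n) where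

  χ : Fin n → Fin n → ℕ
  χ u v = b2n (adj G u v)

  -- Ordered pairs are counted: an edge inside `xs` counts twice in `E xs xs`, an edge between
  -- disjoint lists once. This makes `E` symmetric and additive under `++`, so all later bounds are
  -- for twice the number of edges.
  E : List (Fin n) → List (Fin n) → ℕ
  E xs ys = ∑ (λ u → ∑ (λ v → χ u v) ys) xs

  A-sym : ∀ u v → χ u v ≡ χ v u
  A-sym u v = cong b2n (Graph.sym G u v)

  E-sym : ∀ xs ys → E xs ys ≡ E ys xs
  E-sym xs ys = trans (∑-swap χ xs ys) (∑-cong (λ v → ∑-cong (λ u → A-sym u v) xs) ys)

  E-++ˡ : ∀ xs xs′ ys → E (xs ++ xs′) ys ≡ E xs ys + E xs′ ys
  E-++ˡ xs xs′ ys = ∑-++ _ xs xs′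

  E-++ʳ : ∀ xs ys ys′ → E xs (ys ++ ys′) ≡ E xs ys + E xs ys′
  E-++ʳ xs ys ys′ = trans (∑-cong (λ u → ∑-++ _ ys ys′) xs) (∑-+ _ _ xs)

  E-↭ˡ : ∀ {xs xs′} ys → xs ↭ xs′ → E xs ys ≡ E xs′ ys
  E-↭ˡ ys p = ∑-↭ _ p

  E-↭ʳ : ∀ xs {ys ys′} → ys ↭ ys′ → E xs ys ≡ E xs ys′
  E-↭ʳ xs p = ∑-cong (λ u → ∑-↭ _ p) xs

  E-blocks : (f : A → List (Fin n)) (as : List A) (ys : List (Fin n)) →
             E (concatMap f as) ys ≡ ∑ (λ a → E (f a) ys) as
  E-blocks f as ys = ∑-concatMap _ f as

  E-++-self : ∀ xs ys → E (xs ++ ys) (xs ++ ys) ≡ E xs xs + 2 * E xs ys + E ys ys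
  E-++-self xs ys = begin
      E (xs ++ ys) (xs ++ ys)                          ≡⟨ E-++ˡ xs ys (xs ++ ys) ⟩
      E xs (xs ++ ys) + E ys (xs ++ ys)                ≡⟨ cong₂ _+_ (E-++ʳ xs xs ys) (E-++ʳ ys xs ys) ⟩
      (E xs xs + E xs ys) + (E ys xs + E ys ys)        ≡⟨ cong (λ e → (E xs xs + E xs ys) + (e + E ys ys)) (E-sym ys xs) ⟩
      (E xs xs + E xs ys) + (E xs ys + E ys ys)        ≡⟨ arith (E xs xs) (E xs ys) (E ys ys) ⟩
      E xs xs + 2 * E xs ys + E ys ys                  ∎
    where
    open ≡-Reasoning
    arith : ∀ a b c → (a + b) + (b + c) ≡ a + 2 * b + c
    arith = solve-∀

  E-bound : (f : A → List (Fin n)) (as : List A) (ys : List (Fin n)) {c : ℕ} →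
            (∀ {a} → a ∈ as → E (f a) ys ≤ c) → E (concatMap f as) ys ≤ length as * c
  E-bound f as ys le = ℕₚ.≤-trans (ℕₚ.≤-reflexive (E-blocks f as ys)) (∑-bound as le)

  E-bound₂ : (f : A → List (Fin n)) (g : B → List (Fin n)) (as : List A) (bs : List B) {c : ℕ} →
             (∀ {a b} → a ∈ as → b ∈ bs → E (f a) (g b) ≤ c) →
             E (concatMap f as) (concatMap g bs) ≤ length as * (length bs * c)
  E-bound₂ f g as bs le = E-bound f as (concatMap g bs) λ {a} a∈ →
    ℕₚ.≤-trans (ℕₚ.≤-reflexive (E-sym (f a) (concatMap g bs)))
      (E-bound g bs (f a) λ {b} b∈ → ℕₚ.≤-trans (ℕₚ.≤-reflexive (E-sym (g b) (f a))) (le a∈ b∈))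

  -- ... with the diagonal correction moved to the left, so that no subtraction occurs.
  E-self-bound : (f : A → List (Fin n)) (as : List A) {c d : ℕ} →
    (∀ {a} → a ∈ as → E (f a) (f a) ≤ d) → AllPairs (λ a b → E (f a) (f b) ≤ c) as →
    E (concatMap f as) (concatMap f as) + length as * c ≤ length as * d + length as * length as * c
  E-self-bound f [] _ _ = z≤n
  E-self-bound f (a ∷ as) {c} {d} diag (pa ∷ pas) = begin
      E (f a ++ R) (f a ++ R) + suc l * c             ≡⟨ cong (_+ suc l * c) (E-++-self (f a) R) ⟩
      E (f a) (f a) + 2 * E (f a) R + E R R + suc l * c ≡⟨ arith₁ (E (f a) (f a)) (E (f a) R) (E R R) l c ⟩
      E (f a) (f a) + 2 * E (f a) R + c + (E R R + l * c) ≤⟨ ℕₚ.+-mono-≤ (ℕₚ.+-monoˡ-≤ c (ℕₚ.+-mono-≤ (diag (here refl)) (ℕₚ.*-monoʳ-≤ 2 cross)))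
                                                          (E-self-bound f as (diag ∘ there) pas) ⟩
      d + 2 * (l * c) + c + (l * d + l * l * c)        ≡⟨ arith₂ l c d ⟩
      suc l * d + suc l * suc l * c                    ∎
    where
    open ℕₚ.≤-Reasoning
    R = concatMap f as
    l = length as
    cross : E (f a) R ≤ l * c
    cross = ℕₚ.≤-trans (ℕₚ.≤-reflexive (E-sym (f a) R))
      (E-bound f as (f a) λ {b} b∈ → ℕₚ.≤-trans (ℕₚ.≤-reflexive (E-sym (f b) (f a))) (All.lookup pa b∈))
    arith₁ : ∀ x y z l c → x + 2 * y + z + suc l * c ≡ x + 2 * y + c + (z + l * c)
    arith₁ = solve-∀
    arith₂ : ∀ l c d → d + 2 * (l * c) + c + (l * d + l * l * c) ≡ suc l * d + suc l * suc l * c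
    arith₂ = solve-∀

  -- The sum over pairs with `toℕ u < toℕ v` is added to its transpose. Off the diagonal exactly one
  -- of the two comparisons holds; on it both sides vanish by irreflexivity.
  2edgeCount : 2 * edgeCount G ≡ E (allFin n) (allFin n)
  2edgeCount = begin
      2 * edgeCount G                               ≡⟨ cong (λ e → e + (e + 0)) half ⟩
      up + (up + 0)                                 ≡⟨ cong (up +_) (trans (ℕₚ.+-identityʳ up) (∑-swap _ V V)) ⟩
      ∑ (λ u → ∑ (λ v → up[ u , v ]) V) V + ∑ (λ u → ∑ (λ v → up[ v , u ]) V) V
                                                    ≡⟨ ∑-+ _ _ V ⟨
      ∑ (λ u → ∑ (λ v → up[ u , v ]) V + ∑ (λ v → up[ v , u ]) V) V
                                                    ≡⟨ ∑-cong (λ u → trans (sym (∑-+ _ _ V)) (∑-cong (λ v → both u v) V)) V ⟩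
      E V V                                         ∎
    where
    open ≡-Reasoning
    V = allFin n
    up[_,_] : Fin n → Fin n → ℕ
    up[ u , v ] = b2n ((toℕ u <ᵇ toℕ v) ∧ adj G u v)
    up = ∑ (λ u → ∑ (λ v → up[ u , v ]) V) V
    half : edgeCount G ≡ up
    half = trans (countᵇ-∑ _ (cartesianProduct V V)) (∑-cartesianProduct _ V V)
    <ᵇ-asym : ∀ a b → b2n (a <ᵇ b) + b2n (b <ᵇ a) ≡ 1 ⊎ a ≡ b
    <ᵇ-asym zero    zero    = inj₂ refl
    <ᵇ-asym zero    (suc b) = inj₁ refl
    <ᵇ-asym (suc a) zero    = inj₁ refl
    <ᵇ-asym (suc a) (suc b) = [ inj₁ , inj₂ ∘ cong suc ]′ (<ᵇ-asym a b)
    and-split : ∀ p q a → b2n p + b2n q ≡ 1 → b2n (p ∧ a) + b2n (q ∧ a) ≡ b2n a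
    and-split true  false a _ = ℕₚ.+-identityʳ (b2n a)
    and-split false true  a _ = refl
    and-false : ∀ p → b2n (p ∧ false) ≡ 0
    and-false true  = refl
    and-false false = refl
    both : ∀ u v → up[ u , v ] + up[ v , u ] ≡ χ u v
    both u v with <ᵇ-asym (toℕ u) (toℕ v)
    ... | inj₁ one rewrite Graph.sym G v u = and-split (toℕ u <ᵇ toℕ v) (toℕ v <ᵇ toℕ u) (adj G u v) one
    ... | inj₂ eq with Finₚ.toℕ-injective eq
    ...   | refl rewrite Graph.irrefl G u = cong₂ _+_ (and-false (toℕ u <ᵇ toℕ u)) (and-false (toℕ u <ᵇ toℕ u))

-- Duplicate-free lists and rearrangements

Unique-resp-↭ : {xs ys : List A} → xs ↭ ys → Unique xs → Unique ys
Unique-resp-↭ {A} p = PermSetoidₚ.Unique-resp-↭ (setoid A) (↭⇒↭ₛ p)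

Unique-++ˡ : (xs : List A) {ys : List A} → Unique (xs ++ ys) → Unique xs
Unique-++ˡ []       _        = []
Unique-++ˡ (x ∷ xs) (x∉ ∷ u) = Allₚ.++⁻ˡ xs x∉ ∷ Unique-++ˡ xs u

Unique-++ʳ : (xs : List A) {ys : List A} → Unique (xs ++ ys) → Unique ys
Unique-++ʳ []       u       = u
Unique-++ʳ (x ∷ xs) (_ ∷ u) = Unique-++ʳ xs u

Unique-++-disjoint : (xs : List A) {ys : List A} → Unique (xs ++ ys) → ∀ {x y} → x ∈ xs → y ∈ ys → x ≢ y
Unique-++-disjoint (x ∷ xs) (x∉ ∷ u) (here refl) y∈ = All.lookup (Allₚ.++⁻ʳ xs x∉) y∈
Unique-++-disjoint (x ∷ xs) (x∉ ∷ u) (there x∈)  y∈ = Unique-++-disjoint xs u x∈ y∈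

-- Serves to remove the destroyed triangles from `C` and the used vertices from the outside, and to
-- extend a disjoint family to a partition of all vertices. Working up to permutation, it needs no
-- decidable equality on `A`.
complement : (xs zs : List A) → Unique xs → All (_∈ zs) xs → ∃ λ ys → zs ↭ xs ++ ys
complement []       zs _        _          = zs , ↭-refl
complement (x ∷ xs) zs (x∉ ∷ u) (x∈ ∷ xs⊆) with complement xs zs u xs⊆
... | ys , p with ∈-++⁻ xs (∈-resp-↭ p x∈)
...   | inj₁ x∈xs = contradiction refl (All.lookup x∉ x∈xs)
...   | inj₂ x∈ys with ∈-∃++ x∈ys
...     | as , bs , refl = as ++ bs , (begin
          zs                       ↭⟨ p ⟩
          xs ++ as ++ x ∷ bs       ↭⟨ ++⁺ˡ xs (shift x as bs) ⟩
          xs ++ x ∷ (as ++ bs)     ↭⟨ shift x xs (as ++ bs) ⟩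
          x ∷ xs ++ (as ++ bs)     ∎)
  where open PermutationReasoning

AllPairs-from-Unique : {R : A → A → Set} (xs : List A) → Unique xs →
  (∀ {x y} → x ∈ xs → y ∈ xs → x ≢ y → R x y) → AllPairs R xs
AllPairs-from-Unique []       _        _ = []
AllPairs-from-Unique (x ∷ xs) (x∉ ∷ u) r =
  All.tabulate (λ y∈ → r (here refl) (there y∈) (All.lookup x∉ y∈)) ∷
  AllPairs-from-Unique xs u (λ y∈ z∈ → r (there y∈) (there z∈))

concatMap-↭ : (f : A → List B) {xs ys : List A} → xs ↭ ys → concatMap f xs ↭ concatMap f ys
concatMap-↭ f _↭_.refl        = ↭-refl
concatMap-↭ f (prep x p)      = ++⁺ˡ (f x) (concatMap-↭ f p)
concatMap-↭ f (swap x y p)    = ↭-trans (shifts (f x) (f y)) (++⁺ˡ (f y) (++⁺ˡ (f x) (concatMap-↭ f p)))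
concatMap-↭ f (_↭_.trans p q) = ↭-trans (concatMap-↭ f p) (concatMap-↭ f q)

verts : List (Tri n) → List (Fin n)
verts = concatMap triVerts

everts : List (Edge n) → List (Fin n)
everts = concatMap edgeVerts

-- New triangles and edges are given by the positions of their vertices in a list V, so that their disjointness is
-- decided by computation; below V lists the vertices of the triangles destroyed, then the outside vertices used.
pickᵀ : (V : List (Fin n)) → Tri (length V) → Tri n
pickᵀ V (a , b , c) = lookup V a , lookup V b , lookup V c

pickᴱ : (V : List (Fin n)) → Edge (length V) → Edge n
pickᴱ V (a , b) = lookup V a , lookup V b

verts-pick : (V : List (Fin n)) (ts : List (Tri (length V))) → verts (map (pickᵀ V) ts) ≡ map (lookup V) (verts ts)
verts-pick V []       = refl
verts-pick V (t ∷ ts) = cong (triVerts (pickᵀ V t) ++_) (verts-pick V ts)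

everts-pick : (V : List (Fin n)) (es : List (Edge (length V))) → everts (map (pickᴱ V) es) ≡ map (lookup V) (everts es)
everts-pick V []       = refl
everts-pick V (e ∷ es) = cong (edgeVerts (pickᴱ V e) ++_) (everts-pick V es)

lookup-injective : (xs : List A) → Unique xs → ∀ {i j} → lookup xs i ≡ lookup xs j → i ≡ j
lookup-injective (x ∷ xs) (x∉ ∷ u) {Fin.zero}  {Fin.zero}  eq = refl
lookup-injective (x ∷ xs) (x∉ ∷ u) {Fin.zero}  {Fin.suc j} eq = contradiction eq (All.lookup x∉ (∈-lookup j))
lookup-injective (x ∷ xs) (x∉ ∷ u) {Fin.suc i} {Fin.zero}  eq = contradiction (sym eq) (All.lookup x∉ (∈-lookup i))
lookup-injective (x ∷ xs) (x∉ ∷ u) {Fin.suc i} {Fin.suc j} eq = cong Fin.suc (lookup-injective xs u eq)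

-- Carries a distinctness check on positions, which is a computation on closed terms, over to the
-- vertices themselves. `R` holds the vertices that an exchange leaves untouched.
reindex-unique : (V R : List A) (is : List (Fin (length V))) → Unique (V ++ R) → Unique is → Unique (map (lookup V) is ++ R)
reindex-unique V R is uVR uis =
  Uniqueₚ.++⁺ (Uniqueₚ.map⁺ (lookup-injective V (Unique-++ˡ V uVR)) uis) (Unique-++ʳ V uVR) disjoint
  where
  disjoint : Disjoint (map (lookup V) is) R
  disjoint (x∈ , x∈R) with ∈-map⁻ (lookup V) x∈
  ... | i , _ , refl = Unique-++-disjoint V uVR (∈-lookup i) x∈R refl

∈-verts : {Ts : List (Tri n)} {t : Tri n} {v : Fin n} → t ∈ Ts → v ∈ triVerts t → v ∈ verts Ts
∈-verts (here refl) v∈ = ∈-++⁺ˡ v∈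
∈-verts {Ts = s ∷ _} (there t∈) v∈ = ∈-++⁺ʳ (triVerts s) (∈-verts t∈ v∈)

∈-everts : {Ms : List (Edge n)} {e : Edge n} {v : Fin n} → e ∈ Ms → v ∈ edgeVerts e → v ∈ everts Ms
∈-everts (here refl) v∈ = ∈-++⁺ˡ v∈
∈-everts {Ms = s ∷ _} (there e∈) v∈ = ∈-++⁺ʳ (edgeVerts s) (∈-everts e∈ v∈)

Unique-verts⇒Unique : (Ts : List (Tri n)) → Unique (verts Ts) → Unique Ts
Unique-verts⇒Unique []       _ = []
Unique-verts⇒Unique (t ∷ ts) u@(_ ∷ _) =
  All.tabulate (λ {s} s∈ t≡s → Unique-++-disjoint (triVerts t) u (here refl)
    (subst (λ r → proj₁ t ∈ verts ts) t≡s (∈-verts s∈ (subst (λ r → proj₁ t ∈ triVerts r) t≡s (here refl)))) refl)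
  ∷ Unique-verts⇒Unique ts (Unique-++ʳ (triVerts t) u)

Unique-everts⇒Unique : (Ms : List (Edge n)) → Unique (everts Ms) → Unique Ms
Unique-everts⇒Unique []       _ = []
Unique-everts⇒Unique (t ∷ ts) u@(_ ∷ _) =
  All.tabulate (λ {s} s∈ t≡s → Unique-++-disjoint (edgeVerts t) u (here refl)
    (∈-everts s∈ (subst (λ r → proj₁ t ∈ edgeVerts r) t≡s (here refl))) refl)
  ∷ Unique-everts⇒Unique ts (Unique-++ʳ (edgeVerts t) u)

module _ {A : Set} where
  open PermutationReasoning

  regroup₄ : (a b c d : List A) → (a ++ b) ++ (c ++ d) ↭ ((a ++ c) ++ b) ++ d
  regroup₄ a b c d = begin
    (a ++ b) ++ (c ++ d)    ≡⟨ Listₚ.++-assoc a b _ ⟩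
    a ++ (b ++ (c ++ d))    ↭⟨ ++⁺ˡ a (shifts b c) ⟩
    a ++ (c ++ (b ++ d))    ≡⟨ Listₚ.++-assoc a c _ ⟨
    (a ++ c) ++ (b ++ d)    ≡⟨ Listₚ.++-assoc (a ++ c) b _ ⟨
    ((a ++ c) ++ b) ++ d    ∎

  regroup₅ : (a b c d e : List A) → (a ++ b) ++ (c ++ (d ++ e)) ↭ ((a ++ d) ++ (b ++ c)) ++ e
  regroup₅ a b c d e = begin
    (a ++ b) ++ (c ++ (d ++ e))    ≡⟨ Listₚ.++-assoc (a ++ b) c _ ⟨
    ((a ++ b) ++ c) ++ (d ++ e)    ≡⟨ cong (_++ (d ++ e)) (Listₚ.++-assoc a b c) ⟩
    (a ++ (b ++ c)) ++ (d ++ e)    ↭⟨ regroup₄ a (b ++ c) d e ⟩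
    ((a ++ d) ++ (b ++ c)) ++ e    ∎

  regroup-middle : (a b c d : List A) → (a ++ b) ++ (c ++ d) ↭ (a ++ c) ++ (b ++ d)
  regroup-middle a b c d = ↭-trans (regroup₄ a b c d) (↭-reflexive (Listₚ.++-assoc (a ++ c) b d))

-- Exchange arguments

-- The form in which maximality is used: the competing families are arbitrary disjoint ones and need
-- not cover the graph. The triangles enter the two maximality clauses only through their number, so
-- their vertices may be reordered freely.
record Optimal (H : Graph n) (C : List (Tri n)) (M : List (Edge n)) (I : List (Fin n)) : Set where
  field
    triangles : All (IsTriangle H) C
    edges     : All (IsEdge H) M
    cover     : verts C ++ everts M ++ I ↭ allFin n
    maxT      : ∀ Ts → All (IsTriangle H) Ts → Unique (verts Ts) → length Ts ≤ length C
    maxM      : ∀ Ts Ms → All (IsTriangle H) Ts → All (IsEdge H) Ms → Unique (verts Ts ++ everts Ms) →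
                length C ≤ length Ts → length Ms ≤ length M

module Exchange {H : Graph n} {C : List (Tri n)} {M : List (Edge n)} {I : List (Fin n)} (opt : Optimal H C M I) where

  open Optimal opt public

  O : List (Fin n)
  O = everts M ++ I

  _∼_ : Fin n → Fin n → Set
  u ∼ v = adj H u v ≡ true

  ∼-sym : ∀ {u v} → u ∼ v → v ∼ u
  ∼-sym {u} {v} = trans (Graph.sym H v u)

  ∼⇒≢ : ∀ {u v} → u ∼ v → u ≢ v
  ∼⇒≢ {u} uv refl with () ← trans (sym uv) (Graph.irrefl H u)

  all-unique : Unique (verts C ++ everts M ++ I)
  all-unique = Unique-resp-↭ (↭-sym cover) (Uniqueₚ.allFin⁺ n)

  C-unique : Unique C
  C-unique = Unique-verts⇒Unique C (Unique-++ˡ (verts C) all-unique)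

  O-unique : Unique O
  O-unique = Unique-++ʳ (verts C) all-unique

  M-unique : Unique M
  M-unique = Unique-everts⇒Unique M (Unique-++ˡ (everts M) O-unique)

  I-unique : Unique I
  I-unique = Unique-++ʳ (everts M) O-unique

  module _ (Os : List (Tri n)) (Os! : Unique Os) (Os⊆ : All (_∈ C) Os) (es : List (Fin n)) (es! : Unique es) where

    private
      V = verts Os ++ es
      rest = proj₁ (complement Os C Os! Os⊆)
      C↭ = proj₂ (complement Os C Os! Os⊆)

      length-C : length C ≡ length Os + length rest
      length-C = trans (↭-length C↭) (Listₚ.length-++ Os)

      rest-triangles : All (IsTriangle H) rest
      rest-triangles = Allₚ.++⁻ʳ Os (All-resp-↭ C↭ triangles)

      verts-C : verts C ↭ verts Os ++ verts rest
      verts-C = ↭-trans (concatMap-↭ triVerts C↭) (↭-reflexive (Listₚ.concatMap-++ triVerts Os rest))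

      length-new : (ts : List (Tri (length V))) → length (map (pickᵀ V) ts ++ rest) ≡ length ts + length rest
      length-new ts = trans (Listₚ.length-++ (map (pickᵀ V) ts)) (cong (_+ length rest) (Listₚ.length-map (pickᵀ V) ts))

      verts-new : (ts : List (Tri (length V))) → verts (map (pickᵀ V) ts ++ rest) ≡ map (lookup V) (verts ts) ++ verts rest
      verts-new ts = trans (Listₚ.concatMap-++ triVerts (map (pickᵀ V) ts) rest) (cong (_++ verts rest) (verts-pick V ts))

    -- The number of triangles has priority over the matching, so edges of `M` may be broken up at
    -- will and `es` ranges over all outside vertices. For concrete positions the `True` argument is
    -- found by evaluation.
    exchangeᵀ : All (_∈ O) es → (ts : List (Tri (length V))) → {True (UniqueDec.unique? Finₚ._≟_ (verts ts))} →
                All (IsTriangle H) (map (pickᵀ V) ts) → length ts ≤ length Os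
    exchangeᵀ es⊆ ts {ts!} tris = ℕₚ.+-cancelʳ-≤ (length rest) (length ts) (length Os) (begin
        length ts + length rest             ≡⟨ length-new ts ⟨
        length (map (pickᵀ V) ts ++ rest)   ≤⟨ maxT _ (Allₚ.++⁺ tris rest-triangles) (subst Unique (sym (verts-new ts)) new!) ⟩
        length C                            ≡⟨ length-C ⟩
        length Os + length rest             ∎)
      where
      open ℕₚ.≤-Reasoning
      compl = complement es O es! es⊆
      perm : verts C ++ O ↭ (V ++ verts rest) ++ proj₁ compl
      perm = ↭-trans (++⁺ verts-C (proj₂ compl)) (regroup₄ (verts Os) (verts rest) es (proj₁ compl))
      new! : Unique (map (lookup V) (verts ts) ++ verts rest)
      new! = reindex-unique V (verts rest) (verts ts)
               (Unique-++ˡ (V ++ verts rest) (Unique-resp-↭ perm all-unique)) (toWitness ts!)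

    -- Here the edges of M survive, so one additional edge is already too many.
    exchangeᴹ : All (_∈ I) es → (ts : List (Tri (length V))) (fs : List (Edge (length V))) →
                {True (UniqueDec.unique? Finₚ._≟_ (verts ts ++ everts fs))} →
                All (IsTriangle H) (map (pickᵀ V) ts) → All (IsEdge H) (map (pickᴱ V) fs) →
                length Os ≤ length ts → length fs ≤ 0
    exchangeᴹ es⊆ ts fs {tsfs!} tris edgs le = ℕₚ.+-cancelʳ-≤ (length M) (length fs) 0 (begin
        length fs + length M                ≡⟨ cong (_+ length M) (Listₚ.length-map (pickᴱ V) fs) ⟨
        length (map (pickᴱ V) fs) + length M ≡⟨ Listₚ.length-++ (map (pickᴱ V) fs) ⟨
        length (map (pickᴱ V) fs ++ M)      ≤⟨ maxM _ _ (Allₚ.++⁺ tris rest-triangles) (Allₚ.++⁺ edgs edges) new! enough ⟩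
        length M                            ∎)
      where
      open ℕₚ.≤-Reasoning
      compl = complement es I es! es⊆
      R = verts rest ++ everts M
      fs′ = map (pickᴱ V) fs
      enough : length C ≤ length (map (pickᵀ V) ts ++ rest)
      enough = begin
        length C                           ≡⟨ length-C ⟩
        length Os + length rest            ≤⟨ ℕₚ.+-monoˡ-≤ (length rest) le ⟩
        length ts + length rest            ≡⟨ length-new ts ⟨
        length (map (pickᵀ V) ts ++ rest)  ∎
      perm : verts C ++ everts M ++ I ↭ (V ++ R) ++ proj₁ compl
      perm = ↭-trans (++⁺ verts-C (++⁺ˡ (everts M) (proj₂ compl))) (regroup₅ (verts Os) (verts rest) (everts M) es (proj₁ compl))
      reindexed : Unique (map (lookup V) (verts ts ++ everts fs) ++ R)
      reindexed = reindex-unique V R (verts ts ++ everts fs)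
                    (Unique-++ˡ (V ++ R) (Unique-resp-↭ perm all-unique)) (toWitness tsfs!)
      rearrange : map (lookup V) (verts ts ++ everts fs) ++ R ↭ verts (map (pickᵀ V) ts ++ rest) ++ everts (fs′ ++ M)
      rearrange = ↭-trans
        (↭-reflexive (cong (_++ R) (Listₚ.map-++ (lookup V) (verts ts) (everts fs))))
        (↭-trans (regroup-middle (map (lookup V) (verts ts)) (map (lookup V) (everts fs)) (verts rest) (everts M))
        (↭-reflexive (cong₂ _++_ (sym (verts-new ts))
          (trans (cong (_++ everts M) (sym (everts-pick V fs))) (sym (Listₚ.concatMap-++ edgeVerts fs′ M))))))
      new! : Unique (verts (map (pickᵀ V) ts ++ rest) ++ everts (fs′ ++ M))
      new! = Unique-resp-↭ rearrange reindexed

  -- The exchanges only know that two edges of `M` differ as pairs. Since edges and single vertices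
  -- are blocks of one duplicate-free list, this already makes all their vertices distinct.
  outside-unique : (Ms : List (Edge n)) (Is : List (Fin n)) → Unique Ms → All (_∈ M) Ms → Unique Is → All (_∈ I) Is →
                   Unique (everts Ms ++ Is) × All (_∈ O) (everts Ms ++ Is)
  outside-unique Ms Is Ms! Ms⊆ Is! Is⊆ =
    Unique-++ˡ (everts Ms ++ Is) (Unique-resp-↭ perm O-unique) ,
    Allₚ.++⁻ˡ (everts Ms ++ Is) (All-resp-↭ perm (All.tabulate id))
    where
    cM = complement Ms M Ms! Ms⊆
    cI = complement Is I Is! Is⊆
    perm : O ↭ (everts Ms ++ Is) ++ (everts (proj₁ cM) ++ proj₁ cI)
    perm = ↭-trans
      (++⁺ (↭-trans (concatMap-↭ edgeVerts (proj₂ cM)) (↭-reflexive (Listₚ.concatMap-++ edgeVerts Ms (proj₁ cM)))) (proj₂ cI))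
      (regroup-middle (everts Ms) (everts (proj₁ cM)) Is (proj₁ cI))

-- Hubs, twins and rich triangles

Sees : Graph n → Edge n → Fin n → Set
Sees H (u , v) x = adj H u x ≡ true × adj H v x ≡ true

_≟ᴱ_ : (e f : Edge n) → Dec (e ≡ f)
_≟ᴱ_ = ≡-dec Finₚ._≟_ Finₚ._≟_

record Hub (H : Graph n) (M : List (Edge n)) (Δ : Tri n) : Set where
  constructor hub
  field
    {e₁ e₂} : Edge n
    e₁≢e₂   : e₁ ≢ e₂
    e₁∈     : e₁ ∈ M
    e₂∈     : e₂ ∈ M
    sees₁   : Sees H e₁ (proj₁ Δ)
    sees₂   : Sees H e₂ (proj₁ Δ)

-- Exchanging `xyz` for `xyw` keeps a triangle and frees `z`. This single move drives all arguments
-- on twins and rich triangles.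
JoinsXY : Graph n → Tri n → Fin n → Set
JoinsXY H (x , y , z) w = adj H x w ≡ true × adj H y w ≡ true

record Twin (H : Graph n) (I : List (Fin n)) (Δ : Tri n) : Set where
  constructor twin
  field
    {w₁ w₂} : Fin n
    w₁≢w₂   : w₁ ≢ w₂
    w₁∈     : w₁ ∈ I
    w₂∈     : w₂ ∈ I
    joins₁  : JoinsXY H Δ w₁
    joins₂  : JoinsXY H Δ w₂

-- Up to three rich triangles are exchanged at the same time, and with three candidates each they
-- can be given distinct partners. Hubs and twins are combined two at a time, so two candidates
-- suffice there.
record Rich (H : Graph n) (O : List (Fin n)) (Δ : Tri n) : Set where
  constructor rich
  field
    {w₁ w₂ w₃} : Fin n
    w!     : Unique (w₁ ∷ w₂ ∷ w₃ ∷ [])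
    w∈     : All (_∈ O) (w₁ ∷ w₂ ∷ w₃ ∷ [])
    joins  : All (JoinsXY H Δ) (w₁ ∷ w₂ ∷ w₃ ∷ [])

Complete : Graph n → List (Fin n) → List (Fin n) → Set
Complete H xs ys = All (λ u → All (λ v → adj H u v ≡ true) ys) xs

hub-edge-≢ : {H : Graph n} {M : List (Edge n)} {Δ : Tri n} → Hub H M Δ → (e : Edge n) →
             ∃ λ e′ → e′ ≢ e × e′ ∈ M × Sees H e′ (proj₁ Δ)
hub-edge-≢ (hub {e₁} {e₂} e₁≢e₂ e₁∈ e₂∈ s₁ s₂) e with e₁ ≟ᴱ e
... | no  e₁≢e = e₁ , e₁≢e , e₁∈ , s₁
... | yes refl = e₂ , e₁≢e₂ ∘ sym , e₂∈ , s₂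

twin-vertex-≢ : {H : Graph n} {I : List (Fin n)} {Δ : Tri n} → Twin H I Δ → (w : Fin n) →
                ∃ λ w′ → w′ ≢ w × w′ ∈ I × JoinsXY H Δ w′
twin-vertex-≢ (twin {w₁} {w₂} w₁≢w₂ w₁∈ w₂∈ j₁ j₂) w with w₁ Finₚ.≟ w
... | no  w₁≢w = w₁ , w₁≢w , w₁∈ , j₁
... | yes refl = w₂ , w₁≢w₂ ∘ sym , w₂∈ , j₂

unique₁ : {x : A} → Unique (x ∷ [])
unique₁ = [] ∷ []

unique₂ : {x y : A} → x ≢ y → Unique (x ∷ y ∷ [])
unique₂ x≢y = (x≢y ∷ []) ∷ unique₁

unique₃ : {x y z : A} → x ≢ y → x ≢ z → y ≢ z → Unique (x ∷ y ∷ z ∷ [])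
unique₃ x≢y x≢z y≢z = (x≢y ∷ x≢z ∷ []) ∷ unique₂ y≢z

b2n≤1 : ∀ p → b2n p ≤ 1
b2n≤1 true  = ℕₚ.≤-refl
b2n≤1 false = z≤n

not-both : ∀ p q → ¬ (p ≡ true × q ≡ true) → b2n p + b2n q ≤ 1
not-both true  true  ¬pq = contradiction (refl , refl) ¬pq
not-both true  false ¬pq = ℕₚ.≤-refl
not-both false q     ¬pq = b2n≤1 q

both-or : ∀ p q → (p ≡ true × q ≡ true) ⊎ b2n p + b2n q ≤ 1
both-or true  true  = inj₁ (refl , refl)
both-or true  false = inj₂ ℕₚ.≤-refl
both-or false q     = inj₂ (b2n≤1 q)

not-true : ∀ p → ¬ (p ≡ true) → b2n p ≤ 0
not-true true  ¬p = contradiction refl ¬p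
not-true false ¬p = z≤n

-- The six numbers count edges from the pairs `y`, `z` of two hubs to the three vertices of a third
-- triangle; full columns (value 2) at different vertices exclude each other. If the first hub has
-- at most one full column, its sum is at most 2 + 1 + 1. If it has two, every column of the second
-- hub conflicts with one of them, so that sum is at most 3.
two-columns : ∀ {a b c a′ b′ c′} → a ≤ 2 → b ≤ 2 → c ≤ 2 →
  (a ≤ 1 ⊎ b′ ≤ 1) → (a ≤ 1 ⊎ c′ ≤ 1) → (b ≤ 1 ⊎ a′ ≤ 1) → (b ≤ 1 ⊎ c′ ≤ 1) → (c ≤ 1 ⊎ a′ ≤ 1) → (c ≤ 1 ⊎ b′ ≤ 1) →
  a + b + c ≤ 4 ⊎ a′ + b′ + c′ ≤ 4
two-columns {a} {b} {c} {a′} {b′} {c′} a≤2 b≤2 c≤2 ab ac ba bc ca cb with a ≤? 1 | b ≤? 1 | c ≤? 1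
... | yes a≤1 | yes b≤1 | _       = inj₁ (ℕₚ.+-mono-≤ (ℕₚ.+-mono-≤ a≤1 b≤1) c≤2)
... | yes a≤1 | _       | yes c≤1 = inj₁ (ℕₚ.+-mono-≤ (ℕₚ.+-mono-≤ a≤1 b≤2) c≤1)
... | _       | yes b≤1 | yes c≤1 = inj₁ (ℕₚ.+-mono-≤ (ℕₚ.+-mono-≤ a≤2 b≤1) c≤1)
... | no a≰1  | no b≰1  | _       = inj₂ (ℕₚ.m≤n⇒m≤1+n (ℕₚ.+-mono-≤ (ℕₚ.+-mono-≤ (fromInj₂ (⊥-elim ∘ b≰1) ba) (fromInj₂ (⊥-elim ∘ a≰1) ab)) (fromInj₂ (⊥-elim ∘ a≰1) ac)))
... | no a≰1  | _       | no c≰1  = inj₂ (ℕₚ.m≤n⇒m≤1+n (ℕₚ.+-mono-≤ (ℕₚ.+-mono-≤ (fromInj₂ (⊥-elim ∘ c≰1) ca) (fromInj₂ (⊥-elim ∘ a≰1) ab)) (fromInj₂ (⊥-elim ∘ a≰1) ac)))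
... | _       | no b≰1  | no c≰1  = inj₂ (ℕₚ.m≤n⇒m≤1+n (ℕₚ.+-mono-≤ (ℕₚ.+-mono-≤ (fromInj₂ (⊥-elim ∘ b≰1) ba) (fromInj₂ (⊥-elim ∘ c≰1) cb)) (fromInj₂ (⊥-elim ∘ b≰1) bc)))

module _ (H : Graph n) where

  E≤size : ∀ xs ys → E H xs ys ≤ length xs * length ys
  E≤size xs ys = ∑-bound xs λ {u} _ →
    ℕₚ.≤-trans (∑-bound ys λ {v} _ → b2n≤1 (adj H u v)) (ℕₚ.≤-reflexive (ℕₚ.*-identityʳ (length ys)))

  row<-or-complete : ∀ u ys → ∑ (λ v → χ H u v) ys < length ys ⊎ All (λ v → adj H u v ≡ true) ys
  row<-or-complete u [] = inj₂ []
  row<-or-complete u (v ∷ ys) with adj H u v in eq | row<-or-complete u ys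
  ... | true  | inj₁ lt  = inj₁ (s≤s lt)
  ... | true  | inj₂ all = inj₂ (eq ∷ all)
  ... | false | _        = inj₁ (s≤s (ℕₚ.≤-trans (∑-bound ys λ {v} _ → b2n≤1 (adj H u v)) (ℕₚ.≤-reflexive (ℕₚ.*-identityʳ (length ys)))))

  E<-or-complete : ∀ xs ys → E H xs ys < length xs * length ys ⊎ Complete H xs ys
  E<-or-complete [] ys = inj₂ []
  E<-or-complete (u ∷ xs) ys with row<-or-complete u ys | E<-or-complete xs ys
  ... | inj₁ lt  | _        = inj₁ (ℕₚ.+-mono-<-≤ lt (E≤size xs ys))
  ... | inj₂ all | inj₁ lt  = inj₁ (ℕₚ.+-mono-≤-< (ℕₚ.≤-trans (∑-bound ys λ {v} _ → b2n≤1 (adj H u v)) (ℕₚ.≤-reflexive (ℕₚ.*-identityʳ (length ys)))) lt)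
  ... | inj₂ all | inj₂ c   = inj₂ (all ∷ c)

  -- The vertex `x` of a hub is expected to see everything, so its row is given the full 3. Any
  -- saving must come from the pair `y`, `z` as seen from each vertex of the other triangle: a full
  -- column there is a triangle on `yz`.
  E-by-columns : ∀ x y z x′ y′ z′ → E H (x ∷ y ∷ z ∷ []) (x′ ∷ y′ ∷ z′ ∷ []) ≤
    3 + ((χ H y x′ + χ H z x′) + (χ H y y′ + χ H z y′) + (χ H y z′ + χ H z z′))
  E-by-columns x y z x′ y′ z′ = begin
      E H (x ∷ y ∷ z ∷ []) (x′ ∷ y′ ∷ z′ ∷ [])
        ≡⟨ arith (χ H x x′) (χ H x y′) (χ H x z′) (χ H y x′) (χ H y y′) (χ H y z′) (χ H z x′) (χ H z y′) (χ H z z′) ⟩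
      (χ H x x′ + χ H x y′ + χ H x z′) + _
        ≤⟨ ℕₚ.+-monoˡ-≤ _ (ℕₚ.+-mono-≤ (ℕₚ.+-mono-≤ (b2n≤1 (adj H x x′)) (b2n≤1 (adj H x y′))) (b2n≤1 (adj H x z′))) ⟩
      3 + ((χ H y x′ + χ H z x′) + (χ H y y′ + χ H z y′) + (χ H y z′ + χ H z z′)) ∎
    where
    open ℕₚ.≤-Reasoning
    arith : ∀ a b c d e f g h i → (a + (b + (c + 0))) + ((d + (e + (f + 0))) + ((g + (h + (i + 0))) + 0)) ≡
            (a + b + c) + ((d + g) + (e + h) + (f + i))
    arith = solve-∀

  two≤2 : ∀ u v u′ v′ → χ H u v + χ H u′ v′ ≤ 2
  two≤2 u v u′ v′ = ℕₚ.+-mono-≤ (b2n≤1 (adj H u v)) (b2n≤1 (adj H u′ v′))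

-- Configurations excluded by maximality

module Structure {H : Graph n} {C : List (Tri n)} {M : List (Edge n)} {I : List (Fin n)} (opt : Optimal H C M I) where

  open Exchange opt public

  tri-of : ∀ {Δ} → Δ ∈ C → IsTriangle H Δ
  tri-of = All.lookup triangles

  edge-of : ∀ {e} → e ∈ M → IsEdge H e
  edge-of = All.lookup edges

  O-triangle-free : ∀ {u v w} → u ∈ O → v ∈ O → w ∈ O → u ∼ v → u ∼ w → v ∼ w → ⊥
  O-triangle-free u∈ v∈ w∈ uv uw vw =
    ℕₚ.1+n≰n (exchangeᵀ [] [] [] (_ ∷ _ ∷ _ ∷ []) (unique₃ (∼⇒≢ uv) (∼⇒≢ uw) (∼⇒≢ vw)) (u∈ ∷ v∈ ∷ w∈ ∷ [])
                ((# 0 , # 1 , # 2) ∷ []) ((uv , uw , vw) ∷ []))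

  I-independent : ∀ {v w} → v ∈ I → w ∈ I → ¬ v ∼ w
  I-independent v∈ w∈ vw =
    ℕₚ.1+n≰n (exchangeᴹ [] [] [] (_ ∷ _ ∷ []) (unique₂ (∼⇒≢ vw)) (v∈ ∷ w∈ ∷ []) [] ((# 0 , # 1) ∷ []) [] (vw ∷ []) z≤n)

  -- Otherwise `xyz` could be exchanged for two triangles, `e` with `x` and `f` with `y`.
  two-edges-see-y : ∀ {x y z e f} → (x , y , z) ∈ C → e ∈ M → f ∈ M → e ≢ f → Sees H e x → Sees H f y → ⊥
  two-edges-see-y Δ∈ e∈ f∈ e≢f (ux , vx) (u′y , v′y) =
    let es! , es⊆ = outside-unique (_ ∷ _ ∷ []) [] (unique₂ e≢f) (e∈ ∷ f∈ ∷ []) [] []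
    in ℕₚ.1+n≰n (exchangeᵀ (_ ∷ []) unique₁ (Δ∈ ∷ []) _ es! es⊆
                    ((# 3 , # 4 , # 0) ∷ (# 5 , # 6 , # 1) ∷ [])
                    ((edge-of e∈ , ux , vx) ∷ (edge-of f∈ , u′y , v′y) ∷ []))

  two-edges-see-z : ∀ {x y z e f} → (x , y , z) ∈ C → e ∈ M → f ∈ M → e ≢ f → Sees H e x → Sees H f z → ⊥
  two-edges-see-z Δ∈ e∈ f∈ e≢f (ux , vx) (u′z , v′z) =
    let es! , es⊆ = outside-unique (_ ∷ _ ∷ []) [] (unique₂ e≢f) (e∈ ∷ f∈ ∷ []) [] []
    in ℕₚ.1+n≰n (exchangeᵀ (_ ∷ []) unique₁ (Δ∈ ∷ []) _ es! es⊆
                    ((# 3 , # 4 , # 0) ∷ (# 5 , # 6 , # 2) ∷ [])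
                    ((edge-of e∈ , ux , vx) ∷ (edge-of f∈ , u′z , v′z) ∷ []))

  -- Otherwise `xyz` could be exchanged for `e` with `x` and `yzw`: once an edge takes over `x`, the
  -- pair `yz` is free.
  hub-vertex : ∀ {x y z e w} → (x , y , z) ∈ C → e ∈ M → Sees H e x → w ∈ I → y ∼ w → z ∼ w → ⊥
  hub-vertex Δ∈ e∈ (ux , vx) w∈ yw zw =
    let es! , es⊆ = outside-unique (_ ∷ []) (_ ∷ []) unique₁ (e∈ ∷ []) unique₁ (w∈ ∷ [])
        _ , _ , yz = tri-of Δ∈
    in ℕₚ.1+n≰n (exchangeᵀ (_ ∷ []) unique₁ (Δ∈ ∷ []) _ es! es⊆
                    ((# 3 , # 4 , # 0) ∷ (# 1 , # 2 , # 5) ∷ [])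
                    ((edge-of e∈ , ux , vx) ∷ (yz , yw , zw) ∷ []))

  -- Two edges take over `x` and `x′`, and the freed pair `yz` closes a third triangle with the
  -- freed vertex `y′`.
  hub-hub-y : ∀ {x y z x′ y′ z′ e f} → (x , y , z) ∈ C → (x′ , y′ , z′) ∈ C → (x , y , z) ≢ (x′ , y′ , z′) →
              e ∈ M → f ∈ M → e ≢ f → Sees H e x → Sees H f x′ → y ∼ y′ → z ∼ y′ → ⊥
  hub-hub-y Δ∈ Δ′∈ Δ≢Δ′ e∈ f∈ e≢f (ux , vx) (u′x′ , v′x′) yy′ zy′ =
    let es! , es⊆ = outside-unique (_ ∷ _ ∷ []) [] (unique₂ e≢f) (e∈ ∷ f∈ ∷ []) [] []
        _ , _ , yz = tri-of Δ∈
    in ℕₚ.1+n≰n (exchangeᵀ (_ ∷ _ ∷ []) (unique₂ Δ≢Δ′) (Δ∈ ∷ Δ′∈ ∷ []) _ es! es⊆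
                    ((# 6 , # 7 , # 0) ∷ (# 8 , # 9 , # 3) ∷ (# 1 , # 2 , # 4) ∷ [])
                    ((edge-of e∈ , ux , vx) ∷ (edge-of f∈ , u′x′ , v′x′) ∷ (yz , yy′ , zy′) ∷ []))

  hub-hub-z : ∀ {x y z x′ y′ z′ e f} → (x , y , z) ∈ C → (x′ , y′ , z′) ∈ C → (x , y , z) ≢ (x′ , y′ , z′) →
              e ∈ M → f ∈ M → e ≢ f → Sees H e x → Sees H f x′ → y ∼ z′ → z ∼ z′ → ⊥
  hub-hub-z Δ∈ Δ′∈ Δ≢Δ′ e∈ f∈ e≢f (ux , vx) (u′x′ , v′x′) yz′ zz′ =
    let es! , es⊆ = outside-unique (_ ∷ _ ∷ []) [] (unique₂ e≢f) (e∈ ∷ f∈ ∷ []) [] []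
        _ , _ , yz = tri-of Δ∈
    in ℕₚ.1+n≰n (exchangeᵀ (_ ∷ _ ∷ []) (unique₂ Δ≢Δ′) (Δ∈ ∷ Δ′∈ ∷ []) _ es! es⊆
                    ((# 6 , # 7 , # 0) ∷ (# 8 , # 9 , # 3) ∷ (# 1 , # 2 , # 5) ∷ [])
                    ((edge-of e∈ , ux , vx) ∷ (edge-of f∈ , u′x′ , v′x′) ∷ (yz , yz′ , zz′) ∷ []))

  -- Two edges take over `x₁` and `x₂`; the freed pairs close triangles with two vertices of the
  -- third triangle, giving four triangles in place of three. The positions `i` and `j` stay
  -- variable so that one proof serves all six choices of two different vertices of `xyz`.
  two-hubs : ∀ {x₁ y₁ z₁ x₂ y₂ z₂ x y z u₁ v₁ u₂ v₂} →
    (x₁ , y₁ , z₁) ∈ C → (x₂ , y₂ , z₂) ∈ C → (x , y , z) ∈ C →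
    Unique ((x₁ , y₁ , z₁) ∷ (x₂ , y₂ , z₂) ∷ (x , y , z) ∷ []) →
    (u₁ , v₁) ∈ M → (u₂ , v₂) ∈ M → (u₁ , v₁) ≢ (u₂ , v₂) → Sees H (u₁ , v₁) x₁ → Sees H (u₂ , v₂) x₂ →
    (i j : Fin 13) →
    {True (UniqueDec.unique? Finₚ._≟_ (verts ((# 9 , # 10 , # 0) ∷ (# 11 , # 12 , # 3) ∷ (# 1 , # 2 , i) ∷ (# 4 , # 5 , j) ∷ [])))} →
    let V = x₁ ∷ y₁ ∷ z₁ ∷ x₂ ∷ y₂ ∷ z₂ ∷ x ∷ y ∷ z ∷ u₁ ∷ v₁ ∷ u₂ ∷ v₂ ∷ [] in
    ¬ ((y₁ ∼ lookup V i × z₁ ∼ lookup V i) × (y₂ ∼ lookup V j × z₂ ∼ lookup V j))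
  two-hubs Δ₁∈ Δ₂∈ Δ∈ Δ! e∈ f∈ e≢f (u₁x₁ , v₁x₁) (u₂x₂ , v₂x₂) i j {ts!} ((yi , zi) , (yj , zj)) =
    let es! , es⊆ = outside-unique (_ ∷ _ ∷ []) [] (unique₂ e≢f) (e∈ ∷ f∈ ∷ []) [] []
        _ , _ , yz₁ = tri-of Δ₁∈
        _ , _ , yz₂ = tri-of Δ₂∈
    in ℕₚ.1+n≰n (exchangeᵀ (_ ∷ _ ∷ _ ∷ []) Δ! (Δ₁∈ ∷ Δ₂∈ ∷ Δ∈ ∷ []) _ es! es⊆
                    ((# 9 , # 10 , # 0) ∷ (# 11 , # 12 , # 3) ∷ (# 1 , # 2 , i) ∷ (# 4 , # 5 , j) ∷ []) {ts!}
                    ((edge-of e∈ , u₁x₁ , v₁x₁) ∷ (edge-of f∈ , u₂x₂ , v₂x₂) ∷ (yz₁ , yi , zi) ∷ (yz₂ , yj , zj) ∷ []))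

  -- Here the edge takes over `x` and the vertex `w` takes over `z′`, so that the freed pair `yz`
  -- may use `z′`.
  hub-twin : ∀ {x y z x′ y′ z′ e w} → (x , y , z) ∈ C → (x′ , y′ , z′) ∈ C → (x , y , z) ≢ (x′ , y′ , z′) →
             e ∈ M → Sees H e x → w ∈ I → x′ ∼ w → y′ ∼ w → ¬ (y ∼ z′ × z ∼ z′)
  hub-twin Δ∈ Δ′∈ Δ≢Δ′ e∈ (ux , vx) w∈ x′w y′w (yz′ , zz′) =
    let es! , es⊆ = outside-unique (_ ∷ []) (_ ∷ []) unique₁ (e∈ ∷ []) unique₁ (w∈ ∷ [])
        _ , _ , yz = tri-of Δ∈
        x′y′ , _ , _ = tri-of Δ′∈
    in ℕₚ.1+n≰n (exchangeᵀ (_ ∷ _ ∷ []) (unique₂ Δ≢Δ′) (Δ∈ ∷ Δ′∈ ∷ []) _ es! es⊆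
                    ((# 6 , # 7 , # 0) ∷ (# 1 , # 2 , # 5) ∷ (# 3 , # 4 , # 8) ∷ [])
                    ((edge-of e∈ , ux , vx) ∷ (yz , yz′ , zz′) ∷ (x′y′ , x′w , y′w) ∷ []))

  twin-edge : ∀ {x y z e w} → (x , y , z) ∈ C → w ∈ I → x ∼ w → y ∼ w → e ∈ M → ¬ Sees H e z
  twin-edge Δ∈ w∈ xw yw e∈ (uz , vz) =
    let es! , es⊆ = outside-unique (_ ∷ []) (_ ∷ []) unique₁ (e∈ ∷ []) unique₁ (w∈ ∷ [])
        xy , _ , _ = tri-of Δ∈
    in ℕₚ.1+n≰n (exchangeᵀ (_ ∷ []) unique₁ (Δ∈ ∷ []) _ es! es⊆
                    ((# 3 , # 4 , # 2) ∷ (# 0 , # 1 , # 5) ∷ [])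
                    ((edge-of e∈ , uz , vz) ∷ (xy , xw , yw) ∷ []))

  -- The number of triangles stays the same and the gain is the matching edge `zw′`. No edge of `M`
  -- may be sacrificed for that, so both vertices must come from `I`.
  twin-vertex : ∀ {x y z w w′} → (x , y , z) ∈ C → w ∈ I → w′ ∈ I → w ≢ w′ → x ∼ w → y ∼ w → ¬ z ∼ w′
  twin-vertex Δ∈ w∈ w′∈ w≢w′ xw yw zw′ =
    let xy , _ , _ = tri-of Δ∈
    in ℕₚ.1+n≰n (exchangeᴹ (_ ∷ []) unique₁ (Δ∈ ∷ []) (_ ∷ _ ∷ []) (unique₂ w≢w′) (w∈ ∷ w′∈ ∷ [])
                ((# 0 , # 1 , # 3) ∷ []) ((# 2 , # 4) ∷ []) ((xy , xw , yw) ∷ []) (zw′ ∷ []) ℕₚ.≤-refl)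

  twin-twin : ∀ {x y z x′ y′ z′ w w′} → (x , y , z) ∈ C → (x′ , y′ , z′) ∈ C → (x , y , z) ≢ (x′ , y′ , z′) →
              w ∈ I → w′ ∈ I → w ≢ w′ → JoinsXY H (x , y , z) w → JoinsXY H (x′ , y′ , z′) w′ → ¬ z ∼ z′
  twin-twin Δ∈ Δ′∈ Δ≢Δ′ w∈ w′∈ w≢w′ (xw , yw) (x′w′ , y′w′) zz′ =
    let xy , _ , _ = tri-of Δ∈
        x′y′ , _ , _ = tri-of Δ′∈
    in ℕₚ.1+n≰n (exchangeᴹ (_ ∷ _ ∷ []) (unique₂ Δ≢Δ′) (Δ∈ ∷ Δ′∈ ∷ []) (_ ∷ _ ∷ []) (unique₂ w≢w′) (w∈ ∷ w′∈ ∷ [])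
                ((# 0 , # 1 , # 6) ∷ (# 3 , # 4 , # 7) ∷ []) ((# 2 , # 5) ∷ [])
                ((xy , xw , yw) ∷ (x′y′ , x′w′ , y′w′) ∷ []) (zz′ ∷ []) ℕₚ.≤-refl)

  -- The twins free `z₁` and `z₂`; then `z₁xy` replaces the third triangle and `z₂z` is an
  -- additional matching edge.
  two-twins : ∀ {x₁ y₁ z₁ x₂ y₂ z₂ x y z w₁ w₂} →
    (x₁ , y₁ , z₁) ∈ C → (x₂ , y₂ , z₂) ∈ C → (x , y , z) ∈ C →
    Unique ((x₁ , y₁ , z₁) ∷ (x₂ , y₂ , z₂) ∷ (x , y , z) ∷ []) →
    w₁ ∈ I → w₂ ∈ I → w₁ ≢ w₂ → JoinsXY H (x₁ , y₁ , z₁) w₁ → JoinsXY H (x₂ , y₂ , z₂) w₂ →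
    ¬ ((z₁ ∼ x × z₁ ∼ y) × z₂ ∼ z)
  two-twins Δ₁∈ Δ₂∈ Δ∈ Δ! w₁∈ w₂∈ w₁≢w₂ (x₁w₁ , y₁w₁) (x₂w₂ , y₂w₂) ((z₁x , z₁y) , z₂z) =
    let x₁y₁ , _ , _ = tri-of Δ₁∈
        x₂y₂ , _ , _ = tri-of Δ₂∈
        xy , _ , _ = tri-of Δ∈
    in ℕₚ.1+n≰n (exchangeᴹ (_ ∷ _ ∷ _ ∷ []) Δ! (Δ₁∈ ∷ Δ₂∈ ∷ Δ∈ ∷ []) (_ ∷ _ ∷ []) (unique₂ w₁≢w₂) (w₁∈ ∷ w₂∈ ∷ [])
                ((# 0 , # 1 , # 9) ∷ (# 3 , # 4 , # 10) ∷ (# 2 , # 6 , # 7) ∷ []) ((# 5 , # 8) ∷ [])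
                ((x₁y₁ , x₁w₁ , y₁w₁) ∷ (x₂y₂ , x₂w₂ , y₂w₂) ∷ (z₁x , z₁y , xy) ∷ []) (z₂z ∷ []) ℕₚ.≤-refl)

  module _ {x₁ y₁ z₁ x₂ y₂ z₂ x₃ y₃ z₃ x₄ y₄ z₄ w₁ w₂ w₃}
    (Δ₁∈ : (x₁ , y₁ , z₁) ∈ C) (Δ₂∈ : (x₂ , y₂ , z₂) ∈ C) (Δ₃∈ : (x₃ , y₃ , z₃) ∈ C) (Δ₄∈ : (x₄ , y₄ , z₄) ∈ C)
    (Δ! : Unique ((x₁ , y₁ , z₁) ∷ (x₂ , y₂ , z₂) ∷ (x₃ , y₃ , z₃) ∷ (x₄ , y₄ , z₄) ∷ []))
    (w! : Unique (w₁ ∷ w₂ ∷ w₃ ∷ [])) (w⊆ : All (_∈ O) (w₁ ∷ w₂ ∷ w₃ ∷ []))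
    (j₁ : JoinsXY H (x₁ , y₁ , z₁) w₁) (j₂ : JoinsXY H (x₂ , y₂ , z₂) w₂) (j₃ : JoinsXY H (x₃ , y₃ , z₃) w₃)
    (z₁z₂ : z₁ ∼ z₂) (z₃z₄ : z₃ ∼ z₄) where

    -- With `w₁`, `w₂`, `w₃` standing in for `z₁`, `z₂`, `z₃`, the three freed vertices split the
    -- fourth triangle into `z₃y₄z₄` and `x₄z₁z₂`: five triangles in place of four.
    rich-rich-x : z₃ ∼ y₄ → ¬ (x₄ ∼ z₁ × x₄ ∼ z₂)
    rich-rich-x z₃y₄ (x₄z₁ , x₄z₂) =
      let x₁y₁ , _ , _ = tri-of Δ₁∈
          x₂y₂ , _ , _ = tri-of Δ₂∈
          x₃y₃ , _ , _ = tri-of Δ₃∈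
          _ , _ , y₄z₄ = tri-of Δ₄∈
      in ℕₚ.1+n≰n (exchangeᵀ (_ ∷ _ ∷ _ ∷ _ ∷ []) Δ! (Δ₁∈ ∷ Δ₂∈ ∷ Δ₃∈ ∷ Δ₄∈ ∷ []) _ w! w⊆
           ((# 0 , # 1 , # 12) ∷ (# 3 , # 4 , # 13) ∷ (# 6 , # 7 , # 14) ∷ (# 8 , # 10 , # 11) ∷ (# 9 , # 2 , # 5) ∷ [])
           ((x₁y₁ , j₁) ∷ (x₂y₂ , j₂) ∷ (x₃y₃ , j₃) ∷ (z₃y₄ , z₃z₄ , y₄z₄) ∷ (x₄z₁ , x₄z₂ , z₁z₂) ∷ []))

    rich-rich-y : z₃ ∼ x₄ → ¬ (y₄ ∼ z₁ × y₄ ∼ z₂)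
    rich-rich-y z₃x₄ (y₄z₁ , y₄z₂) =
      let x₁y₁ , _ , _ = tri-of Δ₁∈
          x₂y₂ , _ , _ = tri-of Δ₂∈
          x₃y₃ , _ , _ = tri-of Δ₃∈
          _ , x₄z₄ , _ = tri-of Δ₄∈
      in ℕₚ.1+n≰n (exchangeᵀ (_ ∷ _ ∷ _ ∷ _ ∷ []) Δ! (Δ₁∈ ∷ Δ₂∈ ∷ Δ₃∈ ∷ Δ₄∈ ∷ []) _ w! w⊆
           ((# 0 , # 1 , # 12) ∷ (# 3 , # 4 , # 13) ∷ (# 6 , # 7 , # 14) ∷ (# 8 , # 9 , # 11) ∷ (# 10 , # 2 , # 5) ∷ [])
           ((x₁y₁ , j₁) ∷ (x₂y₂ , j₂) ∷ (x₃y₃ , j₃) ∷ (z₃x₄ , z₃z₄ , x₄z₄) ∷ (y₄z₁ , y₄z₂ , z₁z₂) ∷ []))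

-- Edge counts between the parts

∑-affine-bound : {f g : A → ℕ} (c d : ℕ) (xs : List A) → (∀ {x} → x ∈ xs → f x ≤ c + g x * d) →
                 ∑ f xs ≤ length xs * c + ∑ g xs * d
∑-affine-bound {f = f} {g} c d xs le = begin
    ∑ f xs                              ≤⟨ ∑-mono xs le ⟩
    ∑ (λ x → c + g x * d) xs            ≡⟨ ∑-+ (λ _ → c) (λ x → g x * d) xs ⟩
    ∑ (λ _ → c) xs + ∑ (λ x → g x * d) xs ≡⟨ cong₂ _+_ (∑-const c xs) (∑-*ʳ g d xs) ⟩
    length xs * c + ∑ g xs * d          ∎
  where open ℕₚ.≤-Reasoning

both-∧ : ∀ p q → b2n p + b2n q ≤ 1 + b2n (p ∧ q)
both-∧ true  q = ℕₚ.≤-refl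
both-∧ false q = ℕₚ.≤-trans (b2n≤1 q) (ℕₚ.m≤m+n 1 0)

∨₃-bound : ∀ p q r → b2n p + b2n q + b2n r ≤ b2n (p ∨ (q ∨ (r ∨ false))) * 3
∨₃-bound true  q     r     = ℕₚ.+-mono-≤ (ℕₚ.+-mono-≤ (ℕₚ.≤-refl {1}) (b2n≤1 q)) (b2n≤1 r)
∨₃-bound false true  r     = ℕₚ.+-mono-≤ (ℕₚ.≤-refl {1}) (ℕₚ.≤-trans (b2n≤1 r) (s≤s z≤n))
∨₃-bound false false true  = s≤s z≤n
∨₃-bound false false false = z≤n

∨₂-bound : ∀ p q r → b2n p + b2n q ≤ b2n (p ∨ (q ∨ (r ∨ false))) * 2
∨₂-bound true  q     r = ℕₚ.+-mono-≤ (ℕₚ.≤-refl {1}) (b2n≤1 q)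
∨₂-bound false true  r = s≤s z≤n
∨₂-bound false false r = z≤n

majority-bound : ∀ p q r → b2n p + (b2n q + (b2n r + 0)) ≤ 1 + b2n (1 <ᵇ (b2n p + b2n q + b2n r)) * 2
majority-bound true  true  true  = ℕₚ.≤-refl
majority-bound true  true  false = ℕₚ.n≤1+n 2
majority-bound true  false true  = ℕₚ.n≤1+n 2
majority-bound true  false false = ℕₚ.≤-refl
majority-bound false true  true  = ℕₚ.n≤1+n 2
majority-bound false true  false = ℕₚ.≤-refl
majority-bound false false true  = ℕₚ.≤-refl
majority-bound false false false = z≤n

length-concatMap-const : (f : A → List B) (c : ℕ) → (∀ a → length (f a) ≡ c) → (as : List A) → length (concatMap f as) ≡ length as * c
length-concatMap-const f c eq []       = refl
length-concatMap-const f c eq (a ∷ as) = trans (Listₚ.length-++ (f a)) (cong₂ _+_ (eq a) (length-concatMap-const f c eq as))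

module _ (H : Graph n) where

  E-edge-columns : ∀ u v x y z → E H (u ∷ v ∷ []) (x ∷ y ∷ z ∷ []) ≡
    (χ H u x + χ H v x) + (χ H u y + χ H v y) + (χ H u z + χ H v z)
  E-edge-columns u v x y z = arith (χ H u x) (χ H u y) (χ H u z) (χ H v x) (χ H v y) (χ H v z)
    where
    arith : ∀ a b c d e f → (a + (b + (c + 0))) + ((d + (e + (f + 0))) + 0) ≡ (a + d) + (b + e) + (c + f)
    arith = solve-∀

  E-matching-bound : ∀ (M : List (Edge n)) (g : Edge n → ℕ) c d xs →
    (∀ {e} → e ∈ M → E H (edgeVerts e) xs ≤ c + g e * d) → E H xs (everts M) ≤ length M * c + ∑ g M * d
  E-matching-bound M g c d xs le = ℕₚ.≤-trans
    (ℕₚ.≤-reflexive (trans (E-sym H xs (everts M)) (E-blocks H edgeVerts M xs)))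
    (∑-affine-bound c d M le)

  E-vertices-bound : ∀ (I : List (Fin n)) (g : Fin n → ℕ) c d xs →
    (∀ {w} → w ∈ I → ∑ (λ v → χ H w v) xs ≤ c + g w * d) → E H xs I ≤ length I * c + ∑ g I * d
  E-vertices-bound I g c d xs le = ℕₚ.≤-trans (ℕₚ.≤-reflexive (E-sym H xs I)) (∑-affine-bound c d I le)

  E-vertices-sees : ∀ Δ I → E H (triVerts Δ) I ≤ length I * 1 + verticesSeeing H I Δ * 2
  E-vertices-sees Δ@(x , y , z) I = ℕₚ.≤-trans
    (E-vertices-bound I (λ w → b2n (vertexSees H w Δ)) 1 2 (triVerts Δ)
       (λ {w} _ → majority-bound (adj H w x) (adj H w y) (adj H w z)))
    (ℕₚ.≤-reflexive (cong (λ c → length I * 1 + c * 2) (sym (countᵇ-∑ (λ w → vertexSees H w Δ) I))))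

  -- An edge that does not see `Δ` has at most one end joined to each of its three vertices; one
  -- that sees it costs at most three more.
  E-edges-sees : ∀ Δ M → E H (triVerts Δ) (everts M) ≤ length M * 3 + edgesSeeing H M Δ * 3
  E-edges-sees Δ@(x , y , z) M = ℕₚ.≤-trans
    (E-matching-bound M (λ e → b2n (edgeSees H e Δ)) 3 3 (triVerts Δ) (λ {e} _ → one e))
    (ℕₚ.≤-reflexive (cong (λ c → length M * 3 + c * 3) (sym (countᵇ-∑ (λ e → edgeSees H e Δ) M))))
    where
    arith : ∀ a b c → (1 + a) + (1 + b) + (1 + c) ≡ 3 + (a + b + c)
    arith = solve-∀
    one : ∀ e → E H (edgeVerts e) (triVerts Δ) ≤ 3 + b2n (edgeSees H e Δ) * 3
    one (u , v) = begin
        E H (u ∷ v ∷ []) (x ∷ y ∷ z ∷ [])    ≡⟨ E-edge-columns u v x y z ⟩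
        _  ≤⟨ ℕₚ.+-mono-≤ (ℕₚ.+-mono-≤ (both-∧ (adj H u x) (adj H v x)) (both-∧ (adj H u y) (adj H v y))) (both-∧ (adj H u z) (adj H v z)) ⟩
        _  ≡⟨ arith (b2n (adj H u x ∧ adj H v x)) (b2n (adj H u y ∧ adj H v y)) (b2n (adj H u z ∧ adj H v z)) ⟩
        _  ≤⟨ ℕₚ.+-monoʳ-≤ 3 (∨₃-bound (adj H u x ∧ adj H v x) (adj H u y ∧ adj H v y) (adj H u z ∧ adj H v z)) ⟩
        3 + b2n (edgeSees H (u , v) Δ) * 3   ∎
      where open ℕₚ.≤-Reasoning

  -- The 5 is 3 + 2: the surplus of a single seeing edge over 3 and of a single seeing vertex over
  -- 1.
  E-barely-seen : ∀ Δ M I → edgesSeeing H M Δ ≤ 1 → verticesSeeing H I Δ ≤ 1 →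
                  E H (triVerts Δ) (everts M ++ I) ≤ 3 * length M + length I + 5
  E-barely-seen Δ M I eM eI = begin
      E H (triVerts Δ) (everts M ++ I)                           ≡⟨ E-++ʳ H (triVerts Δ) (everts M) I ⟩
      E H (triVerts Δ) (everts M) + E H (triVerts Δ) I           ≤⟨ ℕₚ.+-mono-≤ (E-edges-sees Δ M) (E-vertices-sees Δ I) ⟩
      (length M * 3 + edgesSeeing H M Δ * 3) + (length I * 1 + verticesSeeing H I Δ * 2)
        ≤⟨ ℕₚ.+-mono-≤ (ℕₚ.+-monoʳ-≤ (length M * 3) (ℕₚ.*-monoˡ-≤ 3 eM)) (ℕₚ.+-monoʳ-≤ (length I * 1) (ℕₚ.*-monoˡ-≤ 2 eI)) ⟩
      (length M * 3 + 3) + (length I * 1 + 2)                    ≡⟨ arith (length M) (length I) ⟩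
      3 * length M + length I + 5                                ∎
    where
    open ℕₚ.≤-Reasoning
    arith : ∀ m i → (m * 3 + 3) + (i * 1 + 2) ≡ 3 * m + i + 5
    arith = solve-∀

rich-vertex-≢ : {H : Graph n} {O : List (Fin n)} {Δ : Tri n} → Rich H O Δ → (p q : Fin n) →
                ∃ λ w → w ≢ p × w ≢ q × w ∈ O × JoinsXY H Δ w
rich-vertex-≢ (rich {a} {b} {c} ((a≢b ∷ a≢c ∷ []) ∷ (b≢c ∷ []) ∷ _) (a∈ ∷ b∈ ∷ c∈ ∷ []) (ja ∷ jb ∷ jc ∷ [])) p q
  with a Finₚ.≟ p | a Finₚ.≟ q
... | no a≢p   | no a≢q = a , a≢p , a≢q , a∈ , ja
... | yes refl | _ with b Finₚ.≟ q
...   | no b≢q   = b , a≢b ∘ sym , b≢q , b∈ , jb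
...   | yes refl = c , a≢c ∘ sym , b≢c ∘ sym , c∈ , jc
rich-vertex-≢ (rich {a} {b} {c} ((a≢b ∷ a≢c ∷ []) ∷ (b≢c ∷ []) ∷ _) (a∈ ∷ b∈ ∷ c∈ ∷ []) (ja ∷ jb ∷ jc ∷ [])) p q
    | no a≢p   | yes refl with b Finₚ.≟ p
...   | no b≢p   = b , b≢p , a≢b ∘ sym , b∈ , jb
...   | yes refl = c , b≢c ∘ sym , a≢c ∘ sym , c∈ , jc

hexVerts : Tri n × Tri n → List (Fin n)
hexVerts (Δ , Δ′) = triVerts Δ ++ triVerts Δ′

module Bounds {H : Graph n} {C : List (Tri n)} {M : List (Edge n)} {I : List (Fin n)} (opt : Optimal H C M I) where

  open Structure opt public

  private
    e⟦_,_⟧ : Fin n → Fin n → ℕ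
    e⟦ u , v ⟧ = χ H u v

    EΔ : Tri n → Tri n → ℕ
    EΔ Δ Δ′ = E H (triVerts Δ) (triVerts Δ′)

  length-O : length O ≡ length M * 2 + length I
  length-O = trans (Listₚ.length-++ (everts M)) (cong (_+ length I) (length-concatMap-const edgeVerts 2 (λ _ → refl) M))

  O-column : ∀ {u v w} → (u , v) ∈ M → w ∈ O → e⟦ w , u ⟧ + (e⟦ w , v ⟧ + 0) ≤ 1
  O-column {u} {v} {w} e∈ w∈ = subst (_≤ 1) (cong (e⟦ w , u ⟧ +_) (sym (ℕₚ.+-identityʳ _)))
    (not-both (adj H w u) (adj H w v) λ (wu , wv) →
      O-triangle-free w∈ (∈-++⁺ˡ (∈-everts e∈ (here refl))) (∈-++⁺ˡ (∈-everts e∈ (there (here refl)))) wu wv (edge-of e∈))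

  E-edge-O : ∀ {e xs} → e ∈ M → (∀ {w} → w ∈ xs → w ∈ O) → E H (edgeVerts e) xs ≤ length xs * 1
  E-edge-O {e} {xs} e∈ xs⊆ = ℕₚ.≤-trans (ℕₚ.≤-reflexive (E-sym H (edgeVerts e) xs)) (∑-bound xs (O-column e∈ ∘ xs⊆))

  -- By `O-triangle-free` an outside vertex is joined to at most one end of each edge of `M`, and
  -- `I` is independent. Against (2m + i)²/2, the ordered count of the balanced complete bipartite
  -- graph up to rounding, i²/2 is missing.
  E-O-O : E H O O ≤ 2 * (length M * length M) + 2 * (length M * length I)
  E-O-O = begin
      E H (everts M ++ I) O                                   ≡⟨ E-++ˡ H (everts M) I O ⟩
      E H (everts M) O + E H I (everts M ++ I)                ≡⟨ cong (E H (everts M) O +_) (E-++ʳ H I (everts M) I) ⟩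
      E H (everts M) O + (E H I (everts M) + E H I I)         ≤⟨ ℕₚ.+-mono-≤ (E-bound H edgeVerts M O (λ e∈ → E-edge-O e∈ id)) (ℕₚ.+-mono-≤ I-M I-I) ⟩
      length M * (length O * 1) + (length M * (length I * 1) + 0) ≡⟨ cong (λ l → length M * (l * 1) + (length M * (length I * 1) + 0)) length-O ⟩
      _                                                       ≡⟨ arith (length M) (length I) ⟩
      2 * (length M * length M) + 2 * (length M * length I)   ∎
    where
    open ℕₚ.≤-Reasoning
    arith : ∀ m i → m * ((m * 2 + i) * 1) + (m * (i * 1) + 0) ≡ 2 * (m * m) + 2 * (m * i)
    arith = solve-∀
    I-M : E H I (everts M) ≤ length M * (length I * 1)
    I-M = ℕₚ.≤-trans (ℕₚ.≤-reflexive (E-sym H I (everts M))) (E-bound H edgeVerts M I (λ e∈ → E-edge-O e∈ (∈-++⁺ʳ (everts M))))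
    I-I : E H I I ≤ 0
    I-I = ℕₚ.≤-trans (∑-bound I λ {v} v∈ → ℕₚ.≤-trans (∑-bound I λ {w} w∈ → not-true (adj H v w) (I-independent v∈ w∈))
            (ℕₚ.≤-reflexive (ℕₚ.*-zeroʳ (length I)))) (ℕₚ.≤-reflexive (ℕₚ.*-zeroʳ (length I)))

  E-hub-O : ∀ {Δ} → Δ ∈ C → Hub H M Δ → E H (triVerts Δ) O ≤ 4 * length M + 2 * length I
  E-hub-O {Δ@(x , y , z)} Δ∈ h@(hub e₁≢e₂ e₁∈ e₂∈ s₁ s₂) = begin
      E H (triVerts Δ) (everts M ++ I)                       ≡⟨ E-++ʳ H (triVerts Δ) (everts M) I ⟩
      E H (triVerts Δ) (everts M) + E H (triVerts Δ) I       ≤⟨ ℕₚ.+-mono-≤ (E-matching-bound H M (λ _ → 0) 4 0 (triVerts Δ) edge)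
                                                                            (E-vertices-bound H I (λ _ → 0) 2 0 (triVerts Δ) vertex) ⟩
      _                                                      ≡⟨ arith (length M) (length I) (∑ (λ _ → 0) M) (∑ (λ _ → 0) I) ⟩
      4 * length M + 2 * length I                            ∎
    where
    open ℕₚ.≤-Reasoning
    arith : ∀ m i a b → (m * 4 + a * 0) + (i * 2 + b * 0) ≡ 4 * m + 2 * i
    arith = solve-∀
    edge : ∀ {e} → e ∈ M → E H (edgeVerts e) (triVerts Δ) ≤ 4
    edge {u , v} e∈ = ℕₚ.≤-trans (ℕₚ.≤-reflexive (E-edge-columns H u v x y z))
      (ℕₚ.+-mono-≤ (ℕₚ.+-mono-≤ (two≤2 H u x v x)
        (not-both (adj H u y) (adj H v y) λ s →
          -- The exchange needs an edge at `x` other than `(u , v)`. With two edges at `x` one is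
          -- always available, which is why a hub requires two.
          let e′ , e′≢e , e′∈ , s′ = hub-edge-≢ h (u , v) in two-edges-see-y Δ∈ e′∈ e∈ e′≢e s′ s))
        (not-both (adj H u z) (adj H v z) λ s →
          let e′ , e′≢e , e′∈ , s′ = hub-edge-≢ h (u , v) in two-edges-see-z Δ∈ e′∈ e∈ e′≢e s′ s))
    vertex : ∀ {w} → w ∈ I → ∑ (λ v → e⟦ w , v ⟧) (triVerts Δ) ≤ 2
    vertex {w} w∈ = ℕₚ.+-mono-≤ (b2n≤1 (adj H w x)) (subst (_≤ 1) (cong (e⟦ w , y ⟧ +_) (sym (ℕₚ.+-identityʳ _)))
      (not-both (adj H w y) (adj H w z) λ (wy , wz) → hub-vertex Δ∈ e₁∈ s₁ w∈ (∼-sym wy) (∼-sym wz)))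

  -- No edge has both ends joined to `z`, so an edge exceeds 3 only by seeing `Δ` at `x` or `y`, by
  -- at most 2, and at most one edge does so. No vertex of `I` is joined to `z`: whichever vertex is
  -- tried, the twin has another one to stand in for `z`.
  E-twin-O : ∀ {Δ} → Δ ∈ C → Twin H I Δ → edgesSeeing H M Δ ≤ 1 → E H (triVerts Δ) O ≤ 3 * length M + 2 * length I + 2
  E-twin-O {Δ@(x , y , z)} Δ∈ t@(twin w₁≢w₂ w₁∈ w₂∈ (xw , yw) j₂) few = begin
      E H (triVerts Δ) (everts M ++ I)                       ≡⟨ E-++ʳ H (triVerts Δ) (everts M) I ⟩
      E H (triVerts Δ) (everts M) + E H (triVerts Δ) I       ≤⟨ ℕₚ.+-mono-≤ (E-matching-bound H M (λ e → b2n (edgeSees H e Δ)) 3 2 (triVerts Δ) edge)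
                                                                            (E-vertices-bound H I (λ _ → 0) 2 0 (triVerts Δ) vertex) ⟩
      (length M * 3 + ∑ (λ e → b2n (edgeSees H e Δ)) M * 2) + (length I * 2 + ∑ (λ _ → 0) I * 0)
        ≤⟨ ℕₚ.+-monoˡ-≤ _ (ℕₚ.+-monoʳ-≤ (length M * 3) (ℕₚ.*-monoˡ-≤ 2 (subst (_≤ 1) (countᵇ-∑ (λ e → edgeSees H e Δ) M) few))) ⟩
      (length M * 3 + 2) + (length I * 2 + ∑ (λ _ → 0) I * 0) ≡⟨ arith (length M) (length I) (∑ (λ _ → 0) I) ⟩
      3 * length M + 2 * length I + 2                        ∎
    where
    open ℕₚ.≤-Reasoning
    arith : ∀ m i a → (m * 3 + 2) + (i * 2 + a * 0) ≡ 3 * m + 2 * i + 2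
    arith = solve-∀
    arith′ : ∀ a b → (1 + a) + (1 + b) + 1 ≡ 3 + (a + b)
    arith′ = solve-∀
    edge : ∀ {e} → e ∈ M → E H (edgeVerts e) (triVerts Δ) ≤ 3 + b2n (edgeSees H e Δ) * 2
    edge {u , v} e∈ = begin
      E H (u ∷ v ∷ []) (x ∷ y ∷ z ∷ [])    ≡⟨ E-edge-columns H u v x y z ⟩
      _  ≤⟨ ℕₚ.+-mono-≤ (ℕₚ.+-mono-≤ (both-∧ (adj H u x) (adj H v x)) (both-∧ (adj H u y) (adj H v y)))
                        (not-both (adj H u z) (adj H v z) (twin-edge Δ∈ w₁∈ xw yw e∈)) ⟩
      _  ≡⟨ arith′ (b2n (adj H u x ∧ adj H v x)) (b2n (adj H u y ∧ adj H v y)) ⟩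
      _  ≤⟨ ℕₚ.+-monoʳ-≤ 3 (∨₂-bound (adj H u x ∧ adj H v x) (adj H u y ∧ adj H v y) (adj H u z ∧ adj H v z)) ⟩
      3 + b2n (edgeSees H (u , v) Δ) * 2   ∎
    vertex : ∀ {w} → w ∈ I → ∑ (λ v → e⟦ w , v ⟧) (triVerts Δ) ≤ 2
    vertex {w} w∈ = ℕₚ.+-mono-≤ (b2n≤1 (adj H w x)) (ℕₚ.+-mono-≤ (b2n≤1 (adj H w y))
      (ℕₚ.≤-trans (ℕₚ.≤-reflexive (ℕₚ.+-identityʳ _)) (not-true (adj H w z) λ wz →
        let w′ , w′≢w , w′∈ , (xw′ , yw′) = twin-vertex-≢ t w in twin-vertex Δ∈ w′∈ w∈ w′≢w xw′ yw′ (∼-sym wz))))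

  -- The row of `x` and the column of `x′` may be full, while each of the other two columns misses
  -- an edge: 3 + 2 + 1 + 1, exactly the value in the extremal graph.
  hub-hub≤7 : ∀ {Δ Δ′} → Δ ∈ C → Δ′ ∈ C → Δ ≢ Δ′ → Hub H M Δ → Hub H M Δ′ → EΔ Δ Δ′ ≤ 7
  hub-hub≤7 {Δ@(x , y , z)} {Δ′@(x′ , y′ , z′)} Δ∈ Δ′∈ Δ≢Δ′ (hub {e} {_} _ e∈ _ s _) h′ =
    let f , f≢e , f∈ , s′ = hub-edge-≢ h′ e in
    ℕₚ.≤-trans (E-by-columns H x y z x′ y′ z′)
      (ℕₚ.+-monoʳ-≤ 3 (ℕₚ.+-mono-≤ (ℕₚ.+-mono-≤ (two≤2 H y x′ z x′)
        (not-both (adj H y y′) (adj H z y′) λ (p , q) → hub-hub-y Δ∈ Δ′∈ Δ≢Δ′ e∈ f∈ (f≢e ∘ sym) s s′ p q))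
        (not-both (adj H y z′) (adj H z z′) λ (p , q) → hub-hub-z Δ∈ Δ′∈ Δ≢Δ′ e∈ f∈ (f≢e ∘ sym) s s′ p q)))

  -- The two hubs can be given distinct edges, and each then frees its pair `y`, `z`. Full columns
  -- of these pairs at different vertices of `Δ` are excluded by `two-hubs`, and `two-columns`
  -- leaves at most 3 + 4 edges for one of the hubs. The pairwise form is the one that
  -- `∑-bound-one-exception` takes.
  hub-exception : ∀ {Δ₁ Δ₂ Δ} → Δ₁ ∈ C → Δ₂ ∈ C → Δ ∈ C → Unique (Δ₁ ∷ Δ₂ ∷ Δ ∷ []) →
                  Hub H M Δ₁ → Hub H M Δ₂ → EΔ Δ₁ Δ ≤ 7 ⊎ EΔ Δ₂ Δ ≤ 7
  hub-exception {Δ₁@(x₁ , y₁ , z₁)} {Δ₂@(x₂ , y₂ , z₂)} {Δ@(x , y , z)} Δ₁∈ Δ₂∈ Δ∈ Δ! (hub {e} {_} _ e∈ _ s _) h₂ =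
    let f , f≢e , f∈ , s′ = hub-edge-≢ h₂ e
        blocked : (i j : Fin 13) →
             {True (UniqueDec.unique? Finₚ._≟_ (verts ((# 9 , # 10 , # 0) ∷ (# 11 , # 12 , # 3) ∷ (# 1 , # 2 , i) ∷ (# 4 , # 5 , j) ∷ [])))} → _
        blocked i j {ts!} = two-hubs Δ₁∈ Δ₂∈ Δ∈ Δ! e∈ f∈ (f≢e ∘ sym) s s′ i j {ts!}
    in [ (λ le → inj₁ (ℕₚ.≤-trans (E-by-columns H x₁ y₁ z₁ x y z) (ℕₚ.+-monoʳ-≤ 3 le)))
       , (λ le → inj₂ (ℕₚ.≤-trans (E-by-columns H x₂ y₂ z₂ x y z) (ℕₚ.+-monoʳ-≤ 3 le))) ]′
       (two-columns (two≤2 H y₁ x z₁ x) (two≤2 H y₁ y z₁ y) (two≤2 H y₁ z z₁ z)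
         (one x y (blocked (# 6) (# 7))) (one x z (blocked (# 6) (# 8))) (one y x (blocked (# 7) (# 6)))
         (one y z (blocked (# 7) (# 8))) (one z x (blocked (# 8) (# 6))) (one z y (blocked (# 8) (# 7))))
    where
    one : ∀ p q → ¬ ((y₁ ∼ p × z₁ ∼ p) × (y₂ ∼ q × z₂ ∼ q)) → e⟦ y₁ , p ⟧ + e⟦ z₁ , p ⟧ ≤ 1 ⊎ e⟦ y₂ , q ⟧ + e⟦ z₂ , q ⟧ ≤ 1
    one p q ¬pq with both-or (adj H y₁ p) (adj H z₁ p)
    ... | inj₂ le = inj₁ le
    ... | inj₁ b₁ = inj₂ (not-both (adj H y₂ q) (adj H z₂ q) λ b₂ → ¬pq (b₁ , b₂))

  hub-twin≤8 : ∀ {Δ Δ′} → Δ ∈ C → Δ′ ∈ C → Δ ≢ Δ′ → Hub H M Δ → Twin H I Δ′ → EΔ Δ Δ′ ≤ 8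
  hub-twin≤8 {Δ@(x , y , z)} {Δ′@(x′ , y′ , z′)} Δ∈ Δ′∈ Δ≢Δ′ (hub _ e∈ _ s _) (twin _ w∈ _ (x′w , y′w) _) =
    ℕₚ.≤-trans (E-by-columns H x y z x′ y′ z′)
      (ℕₚ.+-monoʳ-≤ 3 (ℕₚ.+-mono-≤ (ℕₚ.+-mono-≤ (two≤2 H y x′ z x′) (two≤2 H y y′ z y′))
        (not-both (adj H y z′) (adj H z z′) (hub-twin Δ∈ Δ′∈ Δ≢Δ′ e∈ s w∈ x′w y′w))))

  complete-or≤8 : ∀ Δ Δ′ → Complete H (triVerts Δ) (triVerts Δ′) ⊎ EΔ Δ Δ′ ≤ 8
  complete-or≤8 Δ Δ′ = [ inj₂ ∘ ℕₚ.≤-pred , inj₁ ]′ (E<-or-complete H (triVerts Δ) (triVerts Δ′))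

  twin-twin≤8 : ∀ {Δ Δ′} → Δ ∈ C → Δ′ ∈ C → Δ ≢ Δ′ → Twin H I Δ → Twin H I Δ′ → EΔ Δ Δ′ ≤ 8
  twin-twin≤8 {Δ} {Δ′} Δ∈ Δ′∈ Δ≢Δ′ (twin {w} _ w∈ _ j _) t′ with complete-or≤8 Δ Δ′
  ... | inj₂ le = le
  ... | inj₁ (_ ∷ _ ∷ (_ ∷ _ ∷ zz′ ∷ []) ∷ []) =
    let w′ , w′≢w , w′∈ , j′ = twin-vertex-≢ t′ w
    in ⊥-elim (twin-twin Δ∈ Δ′∈ Δ≢Δ′ w∈ w′∈ (w′≢w ∘ sym) j j′ zz′)

  twin-exception : ∀ {Δ₁ Δ₂ Δ} → Δ₁ ∈ C → Δ₂ ∈ C → Δ ∈ C → Unique (Δ₁ ∷ Δ₂ ∷ Δ ∷ []) →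
                   Twin H I Δ₁ → Twin H I Δ₂ → EΔ Δ₁ Δ ≤ 8 ⊎ EΔ Δ₂ Δ ≤ 8
  twin-exception {Δ₁} {Δ₂} {Δ} Δ₁∈ Δ₂∈ Δ∈ Δ! (twin {w} _ w∈ _ j _) t₂ with complete-or≤8 Δ₁ Δ | complete-or≤8 Δ₂ Δ
  ... | inj₂ le | _       = inj₁ le
  ... | _       | inj₂ le = inj₂ le
  ... | inj₁ (_ ∷ _ ∷ (z₁x ∷ z₁y ∷ _ ∷ []) ∷ []) | inj₁ (_ ∷ _ ∷ (_ ∷ _ ∷ z₂z ∷ []) ∷ []) =
    let w′ , w′≢w , w′∈ , j′ = twin-vertex-≢ t₂ w
    in ⊥-elim (two-twins Δ₁∈ Δ₂∈ Δ∈ Δ! w∈ w′∈ (w′≢w ∘ sym) j j′ ((z₁x , z₁y) , z₂z))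

  -- `Δ₄` is the triangle that gets broken up, so only the other three have to be rich. Completeness
  -- of the two K₆'s supplies `z₁z₂` and the edges from `z₃` to `Δ₄`, leaving the edges from `x₄` or
  -- `y₄` to `z₁` and `z₂` as the obstruction.
  rich-corner : ∀ {Δ₁ Δ₂ Δ₃ Δ₄} → Δ₁ ∈ C → Δ₂ ∈ C → Δ₃ ∈ C → Δ₄ ∈ C → Unique (Δ₁ ∷ Δ₂ ∷ Δ₃ ∷ Δ₄ ∷ []) →
    Rich H O Δ₁ → Rich H O Δ₂ → Rich H O Δ₃ → Complete H (triVerts Δ₁) (triVerts Δ₂) → Complete H (triVerts Δ₃) (triVerts Δ₄) →
    let (_ , _ , z₁) = Δ₁ ; (_ , _ , z₂) = Δ₂ ; (x₄ , y₄ , _) = Δ₄ in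
    ¬ (x₄ ∼ z₁ × x₄ ∼ z₂) × ¬ (y₄ ∼ z₁ × y₄ ∼ z₂)
  rich-corner Δ₁∈ Δ₂∈ Δ₃∈ Δ₄∈ Δ! (rich {w₁} _ (w₁∈ ∷ _) (j₁ ∷ _)) r₂ r₃
    (_ ∷ _ ∷ (_ ∷ _ ∷ z₁z₂ ∷ []) ∷ []) (_ ∷ _ ∷ (z₃x₄ ∷ z₃y₄ ∷ z₃z₄ ∷ []) ∷ []) =
    let w₂ , w₂≢w₁ , _ , w₂∈ , j₂ = rich-vertex-≢ r₂ w₁ w₁
        w₃ , w₃≢w₁ , w₃≢w₂ , w₃∈ , j₃ = rich-vertex-≢ r₃ w₁ w₂
        w! = unique₃ (w₂≢w₁ ∘ sym) (w₃≢w₁ ∘ sym) (w₃≢w₂ ∘ sym)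
        w⊆ = w₁∈ ∷ w₂∈ ∷ w₃∈ ∷ []
    in rich-rich-x Δ₁∈ Δ₂∈ Δ₃∈ Δ₄∈ Δ! w! w⊆ j₁ j₂ j₃ z₁z₂ z₃z₄ z₃y₄ ,
       rich-rich-y Δ₁∈ Δ₂∈ Δ₃∈ Δ₄∈ Δ! w! w⊆ j₁ j₂ j₃ z₁z₂ z₃z₄ z₃x₄

  Complete-sym : ∀ {xs ys} → Complete H xs ys → Complete H ys xs
  Complete-sym {xs} c = All.map (All.map ∼-sym) (Allₚ.All-swap c)

  -- Four uses of `rich-corner` show that each of the four vertices named x or y in either K₆ misses
  -- one of the two vertices named z in the other. These are eight different missing edges out of
  -- 36.
  hex-hex≤28 : ∀ {Δ₁ Δ₂ Δ₃ Δ₄} → Δ₁ ∈ C → Δ₂ ∈ C → Δ₃ ∈ C → Δ₄ ∈ C → Unique (Δ₁ ∷ Δ₂ ∷ Δ₃ ∷ Δ₄ ∷ []) →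
    Rich H O Δ₁ → Rich H O Δ₂ → Rich H O Δ₃ → Rich H O Δ₄ →
    Complete H (triVerts Δ₁) (triVerts Δ₂) → Complete H (triVerts Δ₃) (triVerts Δ₄) →
    E H (hexVerts (Δ₁ , Δ₂)) (hexVerts (Δ₃ , Δ₄)) ≤ 28
  hex-hex≤28 {x₁ , y₁ , z₁} {x₂ , y₂ , z₂} {x₃ , y₃ , z₃} {x₄ , y₄ , z₄} Δ₁∈ Δ₂∈ Δ₃∈ Δ₄∈
    Δ!@((d₁₂ ∷ d₁₃ ∷ d₁₄ ∷ []) ∷ (d₂₃ ∷ d₂₄ ∷ []) ∷ (d₃₄ ∷ []) ∷ _) r₁ r₂ r₃ r₄ k₁₂ k₃₄ =
    let nx₄ , ny₄ = rich-corner Δ₁∈ Δ₂∈ Δ₃∈ Δ₄∈ Δ! r₁ r₂ r₃ k₁₂ k₃₄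
        nx₃ , ny₃ = rich-corner Δ₁∈ Δ₂∈ Δ₄∈ Δ₃∈ ((d₁₂ ∷ d₁₄ ∷ d₁₃ ∷ []) ∷ (d₂₄ ∷ d₂₃ ∷ []) ∷ unique₂ (d₃₄ ∘ sym))
                      r₁ r₂ r₄ k₁₂ (Complete-sym k₃₄)
        nx₂ , ny₂ = rich-corner Δ₃∈ Δ₄∈ Δ₁∈ Δ₂∈ ((d₃₄ ∷ d₁₃ ∘ sym ∷ d₂₃ ∘ sym ∷ []) ∷ (d₁₄ ∘ sym ∷ d₂₄ ∘ sym ∷ []) ∷ unique₂ d₁₂)
                      r₃ r₄ r₁ k₃₄ k₁₂
        nx₁ , ny₁ = rich-corner Δ₃∈ Δ₄∈ Δ₂∈ Δ₁∈ ((d₃₄ ∷ d₂₃ ∘ sym ∷ d₁₃ ∘ sym ∷ []) ∷ (d₂₄ ∘ sym ∷ d₁₄ ∘ sym ∷ []) ∷ unique₂ (d₁₂ ∘ sym))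
                      r₃ r₄ r₂ k₃₄ (Complete-sym k₁₂)
    in begin
      row x₁ + (row y₁ + (row z₁ + (row x₂ + (row y₂ + (row z₂ + 0))))) ≡⟨ arith (row x₁) (row y₁) (row z₁) (row x₂) (row y₂) (row z₂) ⟩
      (row x₁ + row y₁ + row x₂ + row y₂) + (row z₁ + row z₂)
        ≤⟨ ℕₚ.+-mono-≤ (ℕₚ.+-mono-≤ (ℕₚ.+-mono-≤ (ℕₚ.+-mono-≤ (row≤5 x₁ nx₁) (row≤5 y₁ ny₁)) (row≤5 x₂ nx₂)) (row≤5 y₂ ny₂))
                       (apex-rows nx₃ ny₃ nx₄ ny₄) ⟩
      28 ∎
    where
    open ℕₚ.≤-Reasoning
    V′ = hexVerts ((x₃ , y₃ , z₃) , (x₄ , y₄ , z₄))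
    row : Fin n → ℕ
    row r = ∑ (λ v → e⟦ r , v ⟧) V′
    arith : ∀ a b c d e f → a + (b + (c + (d + (e + (f + 0))))) ≡ (a + b + d + e) + (c + f)
    arith = solve-∀
    row≤5 : ∀ r → ¬ (r ∼ z₃ × r ∼ z₄) → row r ≤ 5
    row≤5 r ¬zz = ℕₚ.≤-trans (ℕₚ.≤-reflexive (arith e⟦ r , x₃ ⟧ e⟦ r , y₃ ⟧ e⟦ r , z₃ ⟧ e⟦ r , x₄ ⟧ e⟦ r , y₄ ⟧ e⟦ r , z₄ ⟧))
      (ℕₚ.+-mono-≤ (ℕₚ.+-mono-≤ (ℕₚ.+-mono-≤ (two≤2 H r x₃ r y₃) (b2n≤1 (adj H r x₄))) (b2n≤1 (adj H r y₄)))
        (not-both (adj H r z₃) (adj H r z₄) ¬zz))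
    arith₂ : ∀ a b c d e f a′ b′ c′ d′ e′ f′ →
      (a + (b + (c + (d + (e + (f + 0)))))) + (a′ + (b′ + (c′ + (d′ + (e′ + (f′ + 0)))))) ≡
      (a + a′) + (b + b′) + (c + c′) + (d + d′) + (e + e′) + (f + f′)
    arith₂ = solve-∀
    column : ∀ c → ¬ (c ∼ z₁ × c ∼ z₂) → e⟦ z₁ , c ⟧ + e⟦ z₂ , c ⟧ ≤ 1
    column c ¬zz = not-both (adj H z₁ c) (adj H z₂ c) λ (p , q) → ¬zz (∼-sym p , ∼-sym q)
    apex-rows : ¬ (x₃ ∼ z₁ × x₃ ∼ z₂) → ¬ (y₃ ∼ z₁ × y₃ ∼ z₂) → ¬ (x₄ ∼ z₁ × x₄ ∼ z₂) → ¬ (y₄ ∼ z₁ × y₄ ∼ z₂) →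
                row z₁ + row z₂ ≤ 8
    apex-rows nx₃ ny₃ nx₄ ny₄ = ℕₚ.≤-trans
      (ℕₚ.≤-reflexive (arith₂ e⟦ z₁ , x₃ ⟧ e⟦ z₁ , y₃ ⟧ e⟦ z₁ , z₃ ⟧ e⟦ z₁ , x₄ ⟧ e⟦ z₁ , y₄ ⟧ e⟦ z₁ , z₄ ⟧
                              e⟦ z₂ , x₃ ⟧ e⟦ z₂ , y₃ ⟧ e⟦ z₂ , z₃ ⟧ e⟦ z₂ , x₄ ⟧ e⟦ z₂ , y₄ ⟧ e⟦ z₂ , z₄ ⟧))
      (ℕₚ.+-mono-≤ (ℕₚ.+-mono-≤ (ℕₚ.+-mono-≤ (ℕₚ.+-mono-≤ (ℕₚ.+-mono-≤ (column x₃ nx₃) (column y₃ ny₃))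
        (two≤2 H z₁ z₃ z₂ z₃)) (column x₄ nx₄)) (column y₄ ny₄)) (two≤2 H z₁ z₄ z₂ z₄))

-- Classification of the triangles

-- Rotations suffice: they bring any vertex to the first place, as hubs require, and any unordered
-- pair to the first two places, as twins and rich triangles require.
rot : Tri n → Tri n
rot (x , y , z) = y , z , x

rot-↭ : (Δ : Tri n) → triVerts Δ ↭ triVerts (rot Δ)
rot-↭ (x , y , z) = ++-comm (x ∷ []) (y ∷ z ∷ [])

∨-rotate : ∀ p q r → (p ∨ (q ∨ (r ∨ false))) ≡ (q ∨ (r ∨ (p ∨ false)))
∨-rotate true  true  r     = refl
∨-rotate true  false true  = refl
∨-rotate true  false false = refl
∨-rotate false true  r     = refl
∨-rotate false false true  = refl
∨-rotate false false false = refl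

∧-true : ∀ p q → (p ∧ q) ≡ true → p ≡ true × q ≡ true
∧-true true true _ = refl , refl

∨₃-true : ∀ p q r → (p ∨ (q ∨ (r ∨ false))) ≡ true → p ≡ true ⊎ q ≡ true ⊎ r ≡ true
∨₃-true true  q     r    _ = inj₁ refl
∨₃-true false true  r    _ = inj₂ (inj₁ refl)
∨₃-true false false true _ = inj₂ (inj₂ refl)

majority-true : ∀ p q r → (1 <ᵇ (b2n p + b2n q + b2n r)) ≡ true →
  (p ≡ true × q ≡ true) ⊎ (q ≡ true × r ≡ true) ⊎ (r ≡ true × p ≡ true)
majority-true true  true  r     _ = inj₁ (refl , refl)
majority-true true  false true  _ = inj₂ (inj₂ (refl , refl))
majority-true false true  true  _ = inj₂ (inj₁ (refl , refl))
majority-true true  false false ()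
majority-true false true  false ()
majority-true false false true  ()
majority-true false false false ()

row-by-pairs : ∀ p q r → b2n p + (b2n q + (b2n r + 0)) ≤ 1 + (b2n (p ∧ q) + b2n (q ∧ r) + b2n (r ∧ p))
row-by-pairs true  true  true  = ℕₚ.n≤1+n 3
row-by-pairs true  true  false = ℕₚ.≤-refl
row-by-pairs true  false true  = ℕₚ.≤-refl
row-by-pairs true  false false = ℕₚ.≤-refl
row-by-pairs false true  true  = ℕₚ.≤-refl
row-by-pairs false true  false = ℕₚ.≤-refl
row-by-pairs false false true  = ℕₚ.≤-refl
row-by-pairs false false false = z≤n

countᵇ-three : (p : A → Bool) (xs : List A) → Unique xs → 3 ≤ countᵇ p xs →
  ∃ λ x → ∃₂ λ y z → Unique (x ∷ y ∷ z ∷ []) × All (λ v → v ∈ xs × p v ≡ true) (x ∷ y ∷ z ∷ [])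
countᵇ-three p (x ∷ xs) (x∉ ∷ u) le with p x in eq
... | true  = let y , z , y≢z , (y∈ , py) , (z∈ , pz) = countᵇ-two p xs u (ℕₚ.≤-pred le)
              in x , y , z , unique₃ (All.lookup x∉ y∈) (All.lookup x∉ z∈) y≢z ,
                 (here refl , eq) ∷ (there y∈ , py) ∷ (there z∈ , pz) ∷ []
... | false = let x′ , y , z , u′ , all = countᵇ-three p xs u le
              in x′ , y , z , u′ , All.map (λ (v∈ , pv) → there v∈ , pv) all

module _ (H : Graph n) where

  rot-triangle : ∀ Δ → IsTriangle H Δ → IsTriangle H (rot Δ)
  rot-triangle (x , y , z) (xy , xz , yz) = yz , trans (Graph.sym H y x) xy , trans (Graph.sym H z x) xz

  edgesSeeing-rot : ∀ M Δ → edgesSeeing H M (rot Δ) ≡ edgesSeeing H M Δ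
  edgesSeeing-rot M Δ@(x , y , z) = begin
      edgesSeeing H M (rot Δ)               ≡⟨ countᵇ-∑ (λ e → edgeSees H e (rot Δ)) M ⟩
      ∑ (λ e → b2n (edgeSees H e (rot Δ))) M ≡⟨ ∑-cong (λ (u , v) → cong b2n (sym
                                                 (∨-rotate (adj H u x ∧ adj H v x) (adj H u y ∧ adj H v y) (adj H u z ∧ adj H v z)))) M ⟩
      ∑ (λ e → b2n (edgeSees H e Δ)) M      ≡⟨ countᵇ-∑ (λ e → edgeSees H e Δ) M ⟨
      edgesSeeing H M Δ                     ∎
    where open ≡-Reasoning

  Reordering : (Tri n → Set) → Tri n → Set
  Reordering P Δ = ∃ λ c → triVerts Δ ↭ triVerts c × IsTriangle H c × P c

  reorder-rot : ∀ {P Δ} → Reordering P (rot Δ) → Reordering P Δ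
  reorder-rot {Δ = Δ} (c , p , t , pc) = c , ↭-trans (rot-↭ Δ) p , t , pc

  reorder-id : ∀ {P} Δ → IsTriangle H Δ → P Δ → Reordering P Δ
  reorder-id Δ t p = Δ , ↭-refl , t , p

  edgeSees⇒Sees : ∀ e x y z → edgeSees H e (x , y , z) ≡ true → Sees H e x ⊎ Sees H e y ⊎ Sees H e z
  edgeSees⇒Sees (u , v) x y z s =
    [ inj₁ ∘ ∧-true _ _ , inj₂ ∘ [ inj₁ ∘ ∧-true _ _ , inj₂ ∘ ∧-true _ _ ]′ ]′
      (∨₃-true (adj H u x ∧ adj H v x) (adj H u y ∧ adj H v y) (adj H u z ∧ adj H v z) s)

  SeesSome : Edge n → Tri n → Set
  SeesSome e (x , y , z) = Sees H e x ⊎ Sees H e y ⊎ Sees H e z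

  -- The second edge may still see any vertex. That it sees the first one as well is derived from
  -- maximality in `hub-of`, after the reordered triangles have been assembled into an `Optimal`
  -- family; `PreTwin` and `twin-of` work the same way.
  record PreHub (M : List (Edge n)) (Δ : Tri n) : Set where
    constructor prehub
    field
      {e₁ e₂} : Edge n
      e₁≢e₂   : e₁ ≢ e₂
      e₁∈     : e₁ ∈ M
      e₂∈     : e₂ ∈ M
      sees₁   : Sees H e₁ (proj₁ Δ)
      sees₂   : SeesSome e₂ Δ

  reorder-hub : ∀ M Δ → Unique M → IsTriangle H Δ → 2 ≤ edgesSeeing H M Δ → Reordering (PreHub M) Δ
  reorder-hub M Δ@(x , y , z) M! t two
    with e₁ , e₂ , e₁≢e₂ , (e₁∈ , s₁) , (e₂∈ , s₂) ← countᵇ-two (λ e → edgeSees H e Δ) M M! two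
    with edgeSees⇒Sees e₁ x y z s₁ | edgeSees⇒Sees e₂ x y z s₂
  ... | inj₁ sx        | s = reorder-id Δ t (prehub e₁≢e₂ e₁∈ e₂∈ sx s)
  ... | inj₂ (inj₁ sy) | s = reorder-rot (reorder-id (rot Δ) (rot-triangle Δ t) (prehub e₁≢e₂ e₁∈ e₂∈ sy (turn s)))
    where
    turn : SeesSome e₂ Δ → SeesSome e₂ (rot Δ)
    turn = [ inj₂ ∘ inj₂ , [ inj₁ , inj₂ ∘ inj₁ ]′ ]′
  ... | inj₂ (inj₂ sz) | s =
    reorder-rot (reorder-rot (reorder-id (rot (rot Δ)) (rot-triangle (rot Δ) (rot-triangle Δ t)) (prehub e₁≢e₂ e₁∈ e₂∈ sz (turn s))))
    where
    turn : SeesSome e₂ Δ → SeesSome e₂ (rot (rot Δ))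
    turn = [ inj₂ ∘ inj₁ , [ inj₂ ∘ inj₂ , inj₁ ]′ ]′

  JoinsTwo : Tri n → Fin n → Set
  JoinsTwo Δ w = JoinsXY H Δ w ⊎ JoinsXY H (rot Δ) w ⊎ JoinsXY H (rot (rot Δ)) w

  vertexSees⇒JoinsTwo : ∀ w Δ → vertexSees H w Δ ≡ true → JoinsTwo Δ w
  vertexSees⇒JoinsTwo w (x , y , z) s =
    [ inj₁ ∘ flip-both , inj₂ ∘ [ inj₁ ∘ flip-both , inj₂ ∘ flip-both ]′ ]′ (majority-true (adj H w x) (adj H w y) (adj H w z) s)
    where
    flip-both : ∀ {a b} → adj H w a ≡ true × adj H w b ≡ true → adj H a w ≡ true × adj H b w ≡ true
    flip-both {a} {b} (wa , wb) = trans (Graph.sym H a w) wa , trans (Graph.sym H b w) wb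

  record PreTwin (M : List (Edge n)) (I : List (Fin n)) (Δ : Tri n) : Set where
    constructor pretwin
    field
      {w₁ w₂} : Fin n
      w₁≢w₂   : w₁ ≢ w₂
      w₁∈     : w₁ ∈ I
      w₂∈     : w₂ ∈ I
      joins₁  : JoinsXY H Δ w₁
      joins₂  : JoinsTwo Δ w₂
      unseen  : edgesSeeing H M Δ ≤ 1

  reorder-twin : ∀ M I Δ → Unique I → IsTriangle H Δ → edgesSeeing H M Δ ≤ 1 → 2 ≤ verticesSeeing H I Δ → Reordering (PreTwin M I) Δ
  reorder-twin M I Δ@(x , y , z) I! t few two
    with w₁ , w₂ , w₁≢w₂ , (w₁∈ , s₁) , (w₂∈ , s₂) ← countᵇ-two (λ w → vertexSees H w Δ) I I! two
    with vertexSees⇒JoinsTwo w₁ Δ s₁ | vertexSees⇒JoinsTwo w₂ Δ s₂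
  ... | inj₁ j        | s = reorder-id Δ t (pretwin w₁≢w₂ w₁∈ w₂∈ j s few)
  ... | inj₂ (inj₁ j) | s = reorder-rot (reorder-id (rot Δ) (rot-triangle Δ t)
          (pretwin w₁≢w₂ w₁∈ w₂∈ j ([ inj₂ ∘ inj₂ , [ inj₁ , inj₂ ∘ inj₁ ]′ ]′ s) (subst (_≤ 1) (sym (edgesSeeing-rot M Δ)) few)))
  ... | inj₂ (inj₂ j) | s = reorder-rot (reorder-rot (reorder-id (rot (rot Δ)) (rot-triangle (rot Δ) (rot-triangle Δ t))
          (pretwin w₁≢w₂ w₁∈ w₂∈ j ([ inj₂ ∘ inj₁ , [ inj₂ ∘ inj₂ , inj₁ ]′ ]′ s)
            (subst (_≤ 1) (sym (trans (edgesSeeing-rot M (rot Δ)) (edgesSeeing-rot M Δ))) few))))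

  joinsXY : Tri n → Fin n → Bool
  joinsXY (x , y , z) w = adj H w x ∧ adj H w y

  joiners : List (Fin n) → Tri n → ℕ
  joiners O Δ = countᵇ (joinsXY Δ) O

  rich-from-joiners : ∀ O Δ → Unique O → 3 ≤ joiners O Δ → Rich H O Δ
  rich-from-joiners O Δ@(x , y , z) O! three
    with a , b , c , u , all ← countᵇ-three (joinsXY Δ) O O! three =
      rich u (All.map proj₁ all) (All.map (λ {w} (_ , j) → flip-both w (∧-true _ _ j)) all)
    where
    flip-both : ∀ w → adj H w x ≡ true × adj H w y ≡ true → JoinsXY H Δ w
    flip-both w (wx , wy) = trans (Graph.sym H x w) wx , trans (Graph.sym H y w) wy

  -- A vertex joined to d vertices of `Δ` exceeds 1 by at most the number of pairs of `Δ` that it is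
  -- joined to completely. The three rotations list the three pairs.
  E-joiners : ∀ O Δ → E H (triVerts Δ) O ≤ length O + (joiners O Δ + joiners O (rot Δ) + joiners O (rot (rot Δ)))
  E-joiners O Δ@(x , y , z) = begin
      E H (triVerts Δ) O                                           ≡⟨ E-sym H (triVerts Δ) O ⟩
      E H O (triVerts Δ)                                           ≤⟨ ∑-mono O (λ {w} _ → row-by-pairs (adj H w x) (adj H w y) (adj H w z)) ⟩
      ∑ (λ w → 1 + (f w + g w + h w)) O                            ≡⟨ ∑-+ (λ _ → 1) (λ w → f w + g w + h w) O ⟩
      ∑ (λ _ → 1) O + ∑ (λ w → f w + g w + h w) O                  ≡⟨ cong₂ _+_ (trans (∑-const 1 O) (ℕₚ.*-identityʳ (length O)))
                                                                         (trans (∑-+ (λ w → f w + g w) h O) (cong (_+ ∑ h O) (∑-+ f g O))) ⟩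
      length O + (∑ f O + ∑ g O + ∑ h O)                           ≡⟨ cong (length O +_) (cong₂ _+_ (cong₂ _+_
                                                                         (sym (countᵇ-∑ (joinsXY Δ) O)) (sym (countᵇ-∑ (joinsXY (rot Δ)) O)))
                                                                         (sym (countᵇ-∑ (joinsXY (rot (rot Δ))) O))) ⟩
      length O + (joiners O Δ + joiners O (rot Δ) + joiners O (rot (rot Δ))) ∎
    where
    open ℕₚ.≤-Reasoning
    f = λ w → b2n (joinsXY Δ w)
    g = λ w → b2n (joinsXY (rot Δ) w)
    h = λ w → b2n (joinsXY (rot (rot Δ)) w)

  RichBounded : ℕ → List (Fin n) → Tri n → Set
  RichBounded b O Δ = Rich H O Δ × E H (triVerts Δ) O ≤ b

  -- The 6 arises from at most two common outside neighbours for each of the three pairs of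
  -- vertices.
  Poor : List (Fin n) → Tri n → Set
  Poor O Δ = E H (triVerts Δ) O ≤ length O + 6

  reorder-rich-or-poor : ∀ b O Δ → Unique O → IsTriangle H Δ → E H (triVerts Δ) O ≤ b →
                         Reordering (RichBounded b O) Δ ⊎ Reordering (Poor O) Δ
  reorder-rich-or-poor b O Δ O! t bound with 3 ≤? joiners O Δ | 3 ≤? joiners O (rot Δ) | 3 ≤? joiners O (rot (rot Δ))
  ... | yes r | _     | _     = inj₁ (reorder-id Δ t (rich-from-joiners O Δ O! r , bound))
  ... | _     | yes r | _     = inj₁ (reorder-rot (reorder-id (rot Δ) (rot-triangle Δ t)
          (rich-from-joiners O (rot Δ) O! r , subst (_≤ b) (E-↭ˡ H O (rot-↭ Δ)) bound)))
  ... | _     | _     | yes r = inj₁ (reorder-rot (reorder-rot (reorder-id (rot (rot Δ)) (rot-triangle (rot Δ) (rot-triangle Δ t))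
          (rich-from-joiners O (rot (rot Δ)) O! r , subst (_≤ b) (E-↭ˡ H O (↭-trans (rot-↭ Δ) (rot-↭ (rot Δ)))) bound))))
  ... | no p  | no q  | no r  = inj₂ (reorder-id Δ t (ℕₚ.≤-trans (E-joiners O Δ)
          (ℕₚ.+-monoʳ-≤ (length O) (ℕₚ.+-mono-≤ (ℕₚ.+-mono-≤ (≤2 p) (≤2 q)) (≤2 r)))))
    where
    ≤2 : ∀ {k} → ¬ 3 ≤ k → k ≤ 2
    ≤2 3≰k = ℕₚ.≤-pred (ℕₚ.≰⇒> 3≰k)

  collect : ∀ {P} (Ts : List (Tri n)) → (∀ {Δ} → Δ ∈ Ts → Reordering P Δ) →
    ∃ λ Cs → length Cs ≡ length Ts × verts Ts ↭ verts Cs × All (IsTriangle H) Cs × All P Cs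
  collect [] _ = [] , refl , ↭-refl , [] , []
  collect (Δ ∷ Ts) r =
    let c , p , t , pc = r (here refl)
        Cs , l , ps , ts , pcs = collect Ts (r ∘ there)
    in c ∷ Cs , cong suc l , ++⁺ p ps , t ∷ ts , pc ∷ pcs

  collect₃ : ∀ {P Q R} (Ts : List (Tri n)) → (∀ {Δ} → Δ ∈ Ts → Reordering P Δ ⊎ Reordering Q Δ ⊎ Reordering R Δ) →
    ∃ λ As → ∃₂ λ Bs Ds → length As + (length Bs + length Ds) ≡ length Ts × verts Ts ↭ verts (As ++ (Bs ++ Ds)) ×
      All (IsTriangle H) (As ++ (Bs ++ Ds)) × All P As × All Q Bs × All R Ds
  collect₃ [] _ = [] , [] , [] , refl , ↭-refl , [] , [] , [] , []
  collect₃ (Δ ∷ Ts) r with r (here refl) | collect₃ Ts (r ∘ there)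
  ... | inj₁ (c , p , t , pc) | As , Bs , Ds , l , ps , ts , as , bs , ds =
    c ∷ As , Bs , Ds , cong suc l , ++⁺ p ps , t ∷ ts , pc ∷ as , bs , ds
  ... | inj₂ (inj₁ (c , p , t , pc)) | As , Bs , Ds , l , ps , ts , as , bs , ds =
    As , c ∷ Bs , Ds , trans (ℕₚ.+-suc (length As) _) (cong suc l) ,
    ↭-trans (++⁺ p ps) (concatMap-↭ triVerts insert) , All-resp-↭ insert (t ∷ ts) , as , pc ∷ bs , ds
    where
    insert = ↭-sym (shift c As (Bs ++ Ds))
  ... | inj₂ (inj₂ (c , p , t , pc)) | As , Bs , Ds , l , ps , ts , as , bs , ds =
    As , Bs , c ∷ Ds ,
    trans (trans (cong (length As +_) (ℕₚ.+-suc (length Bs) _)) (ℕₚ.+-suc (length As) _)) (cong suc l) ,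
    ↭-trans (++⁺ p ps) (concatMap-↭ triVerts insert) , All-resp-↭ insert (t ∷ ts) , as , bs , pc ∷ ds
    where
    insert : c ∷ As ++ (Bs ++ Ds) ↭ As ++ (Bs ++ c ∷ Ds)
    insert = ↭-trans (↭-sym (shift c As (Bs ++ Ds))) (++⁺ˡ As (↭-sym (shift c Bs Ds)))

reorder-optimal : {H : Graph n} {C C′ : List (Tri n)} {M : List (Edge n)} {I : List (Fin n)} → Optimal H C M I →
  verts C ↭ verts C′ → length C′ ≡ length C → All (IsTriangle H) C′ → Optimal H C′ M I
reorder-optimal {M = M} {I} opt p l t = record
  { triangles = t
  ; edges     = edges
  ; cover     = ↭-trans (++⁺ʳ (everts M ++ I) (↭-sym p)) cover
  ; maxT      = λ Ts ts u → subst (length Ts ≤_) (sym l) (maxT Ts ts u)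
  ; maxM      = λ Ts Ms ts es u le → maxM Ts Ms ts es u (subst (_≤ length Ts) l le)
  }
  where open Optimal opt

-- Any disjoint family of triangles and edges becomes a tiling triple by declaring the uncovered
-- vertices single; comparing the first two sizes lexicographically gives both clauses.
maximal⇒optimal : {H : Graph n} (τ : TilingData n) → IsMaximalTilingTriple H τ → Optimal H (𝒯 τ) (ℳ τ) (ℐ τ)
maximal⇒optimal {n} {H} τ ((ts , es , cov) , max) = record
  { triangles = All.tabulate (ts _)
  ; edges     = All.tabulate (es _)
  ; cover     = cov
  ; maxT      = λ Ts tris u → bound₁ (larger Ts [] tris [] (subst Unique (sym (Listₚ.++-identityʳ (verts Ts))) u))
  ; maxM      = λ Ts Ms tris edgs u le → bound₂ (larger Ts Ms tris edgs u) le
  }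
  where
  larger : ∀ Ts Ms → All (IsTriangle H) Ts → All (IsEdge H) Ms → Unique (verts Ts ++ everts Ms) →
           ∃ λ ys → (length Ts , length Ms , length ys) ≤lex sizes τ
  larger Ts Ms tris edgs u =
    let ys , p = complement (verts Ts ++ everts Ms) (allFin n) u (All.tabulate λ {v} _ → ∈-allFin v)
    in ys , max (tiling Ts Ms ys) ((λ Δ → All.lookup tris) , (λ e → All.lookup edgs) ,
         ↭-trans (↭-reflexive (sym (Listₚ.++-assoc (verts Ts) (everts Ms) ys))) (↭-sym p))
  bound₁ : ∀ {a b} → (∃ λ ys → (a , b , length {A = Fin n} ys) ≤lex sizes τ) → a ≤ length (𝒯 τ)
  bound₁ (_ , inj₁ a<)          = ℕₚ.<⇒≤ a<
  bound₁ (_ , inj₂ (refl , _)) = ℕₚ.≤-refl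
  bound₂ : ∀ {a b} → (∃ λ ys → (a , b , length {A = Fin n} ys) ≤lex sizes τ) → length (𝒯 τ) ≤ a → b ≤ length (ℳ τ)
  bound₂ (_ , inj₁ a<)                     le = contradiction a< (ℕₚ.≤⇒≯ le)
  bound₂ (_ , inj₂ (_ , inj₁ b<))          le = ℕₚ.<⇒≤ b<
  bound₂ (_ , inj₂ (_ , inj₂ (refl , _))) le = ℕₚ.≤-refl

-- Pairing triangles into K₆'s

AllPairs-map-∈ : {R S : A → A → Set} (xs : List A) → (∀ {x y} → x ∈ xs → y ∈ xs → R x y → S x y) → AllPairs R xs → AllPairs S xs
AllPairs-map-∈ []       f []         = []
AllPairs-map-∈ (x ∷ xs) f (px ∷ pxs) =
  All.tabulate (λ y∈ → f (here refl) (there y∈) (All.lookup px y∈)) ∷ AllPairs-map-∈ xs (λ y∈ z∈ → f (there y∈) (there z∈)) pxs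

2ab≤a²+b² : ∀ a b → 2 * (a * b) ≤ a * a + b * b
2ab≤a²+b² a b = [ go a b , (λ b≤a → subst₂ _≤_ (cong (2 *_) (ℕₚ.*-comm b a)) (ℕₚ.+-comm (b * b) (a * a)) (go b a b≤a)) ]′ (ℕₚ.≤-total a b)
  where
  arith : ∀ a d → 2 * (a * (a + d)) + d * d ≡ a * a + (a + d) * (a + d)
  arith = solve-∀
  go : ∀ a b → a ≤ b → 2 * (a * b) ≤ a * a + b * b
  go a b a≤b with d , refl ← ℕₚ.m≤n⇒∃[o]m+o≡n a≤b = subst (2 * (a * (a + d)) ≤_) (arith a d) (ℕₚ.m≤m+n _ (d * d))

flatten : List (A × A) → List A
flatten = concatMap (λ p → proj₁ p ∷ proj₂ p ∷ [])

length-flatten : (ps : List (A × A)) → length (flatten ps) ≡ length ps * 2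
length-flatten = length-concatMap-const _ 2 (λ _ → refl)

∈-flatten : {ps : List (A × A)} {p : A × A} → p ∈ ps → proj₁ p ∈ flatten ps × proj₂ p ∈ flatten ps
∈-flatten (here refl) = here refl , there (here refl)
∈-flatten (there p∈)  = let a , b = ∈-flatten p∈ in there (there a) , there (there b)

flatten-unique : (ps : List (A × A)) → Unique (flatten ps) →
  AllPairs (λ p q → Unique (proj₁ p ∷ proj₂ p ∷ proj₁ q ∷ proj₂ q ∷ [])) ps × All (λ p → proj₁ p ≢ proj₂ p) ps
flatten-unique []       _ = [] , []
flatten-unique (p ∷ ps) ((a≢b ∷ a∉) ∷ (b∉ ∷ u)) =
  let pairs , distinct = flatten-unique ps u
  in All.tabulate (λ q∈ → let c∈ , d∈ = ∈-flatten q∈ in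
       (a≢b ∷ All.lookup a∉ c∈ ∷ All.lookup a∉ d∈ ∷ []) ∷ (All.lookup b∉ c∈ ∷ All.lookup b∉ d∈ ∷ []) ∷
       unique₂ (All.lookup distinct q∈)) ∷ pairs , a≢b ∷ distinct

verts-flatten : (ps : List (Tri n × Tri n)) → verts (flatten ps) ≡ concatMap hexVerts ps
verts-flatten []       = refl
verts-flatten (p ∷ ps) = cong (λ vs → hexVerts p ++ vs) (verts-flatten ps)

module _ (H : Graph n) where

  private
    Sparse : Tri n → Tri n → Set
    Sparse Δ Δ′ = E H (triVerts Δ) (triVerts Δ′) ≤ 8

  find-K₆ : (Δ : Tri n) (U : List (Tri n)) →
    (∃₂ λ Δ′ U′ → U ↭ Δ′ ∷ U′ × Complete H (triVerts Δ) (triVerts Δ′)) ⊎ All (Sparse Δ) U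
  find-K₆ Δ [] = inj₂ []
  find-K₆ Δ (Δ′ ∷ U) with E<-or-complete H (triVerts Δ) (triVerts Δ′) | find-K₆ Δ U
  ... | inj₂ c  | _                      = inj₁ (Δ′ , U , ↭-refl , c)
  ... | inj₁ _  | inj₁ (Δ″ , U′ , p , c) = inj₁ (Δ″ , Δ′ ∷ U′ , ↭-trans (prep Δ′ p) (swap Δ′ Δ″ ↭-refl) , c)
  ... | inj₁ lt | inj₂ all               = inj₂ (ℕₚ.≤-pred lt ∷ all)

  -- Greedy: a new triangle is paired with an unpaired one completely joined to it if there is any.
  -- Otherwise it misses an edge to each unpaired triangle, so at most 8 of 9 are present and `U`
  -- stays sparse.
  K₆-matching : (Q : List (Tri n)) → ∃₂ λ Ps U →
    Q ↭ flatten Ps ++ U × All (λ p → Complete H (triVerts (proj₁ p)) (triVerts (proj₂ p))) Ps × AllPairs Sparse U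
  K₆-matching [] = [] , [] , ↭-refl , [] , []
  K₆-matching (Δ ∷ Q) with K₆-matching Q
  ... | Ps , U , p , cs , sparse with find-K₆ Δ U
  ...   | inj₂ all = Ps , Δ ∷ U , ↭-trans (prep Δ p) (↭-sym (shift Δ (flatten Ps) U)) , cs , all ∷ sparse
  ...   | inj₁ (Δ′ , U′ , r , c) = (Δ , Δ′) ∷ Ps , U′ ,
            prep Δ (↭-trans p (↭-trans (++⁺ˡ (flatten Ps) r) (shift Δ′ (flatten Ps) U′))) , c ∷ cs , tail (resp r sparse)
    where
    resp : ∀ {xs ys} → xs ↭ ys → AllPairs Sparse xs → AllPairs Sparse ys
    resp p = PermSetoidₚ.AllPairs-resp-↭ (setoid (Tri n)) (λ {x} {y} → subst (_≤ 8) (E-sym H (triVerts x) (triVerts y)))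
               ((λ { refl s → s }) , (λ { refl s → s })) (↭⇒↭ₛ p)
    tail : ∀ {x xs} → AllPairs Sparse (x ∷ xs) → AllPairs Sparse xs
    tail (_ ∷ s) = s

  E-triangle-self : ∀ Δ → E H (triVerts Δ) (triVerts Δ) ≤ 6
  E-triangle-self (x , y , z) rewrite Graph.irrefl H x | Graph.irrefl H y | Graph.irrefl H z =
    ℕₚ.≤-trans (ℕₚ.≤-reflexive (arith (χ H x y) (χ H x z) (χ H y x) (χ H y z) (χ H z x) (χ H z y)))
      (ℕₚ.+-mono-≤ (ℕₚ.+-mono-≤ (two≤2 H x y x z) (two≤2 H y x y z)) (two≤2 H z x z y))
    where
    arith : ∀ a b c d e f → (a + (b + 0)) + ((c + (d + 0)) + ((e + (f + 0)) + 0)) ≡ (a + b) + (c + d) + (e + f)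
    arith = solve-∀

-- Edge counts for the whole decomposition

module Count {H : Graph n} {C₁ C₂ Q G : List (Tri n)} {M : List (Edge n)} {I : List (Fin n)}
  (opt : Optimal H (C₁ ++ (C₂ ++ (Q ++ G))) M I)
  (prehubs : All (PreHub H M) C₁) (pretwins : All (PreTwin H M I) C₂)
  (riches : All (RichBounded H (3 * length M + length I + 5) (everts M ++ I)) Q)
  (poors : All (Poor H (everts M ++ I)) G) where

  open Bounds opt

  private
    C = C₁ ++ (C₂ ++ (Q ++ G))
    m = length M
    i = length I
    t₁ = length C₁
    t₂ = length C₂
    q = length Q
    g = length G

    EΔ : Tri n → Tri n → ℕ
    EΔ Δ Δ′ = E H (triVerts Δ) (triVerts Δ′)

  in₁ : ∀ {Δ} → Δ ∈ C₁ → Δ ∈ C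
  in₁ = ∈-++⁺ˡ

  in₂ : ∀ {Δ} → Δ ∈ C₂ → Δ ∈ C
  in₂ = ∈-++⁺ʳ C₁ ∘ ∈-++⁺ˡ

  in-P : ∀ {Δ} → Δ ∈ Q ++ G → Δ ∈ C
  in-P = ∈-++⁺ʳ C₁ ∘ ∈-++⁺ʳ C₂

  in-Q : ∀ {Δ} → Δ ∈ Q → Δ ∈ C
  in-Q = in-P ∘ ∈-++⁺ˡ

  rest-unique : Unique (C₂ ++ (Q ++ G))
  rest-unique = Unique-++ʳ C₁ C-unique

  Q-unique : Unique Q
  Q-unique = Unique-++ˡ Q (Unique-++ʳ C₂ rest-unique)

  hub-of : ∀ {Δ} → Δ ∈ C₁ → Hub H M Δ
  hub-of Δ∈ with All.lookup prehubs Δ∈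
  ... | prehub e₁≢e₂ e₁∈ e₂∈ s₁ (inj₁ s)        = hub e₁≢e₂ e₁∈ e₂∈ s₁ s
  ... | prehub e₁≢e₂ e₁∈ e₂∈ s₁ (inj₂ (inj₁ s)) = ⊥-elim (two-edges-see-y (in₁ Δ∈) e₁∈ e₂∈ e₁≢e₂ s₁ s)
  ... | prehub e₁≢e₂ e₁∈ e₂∈ s₁ (inj₂ (inj₂ s)) = ⊥-elim (two-edges-see-z (in₁ Δ∈) e₁∈ e₂∈ e₁≢e₂ s₁ s)

  twin-of : ∀ {Δ} → Δ ∈ C₂ → Twin H I Δ
  twin-of Δ∈ with All.lookup pretwins Δ∈
  ... | pretwin w₁≢w₂ w₁∈ w₂∈ j (inj₁ j′) _ = twin w₁≢w₂ w₁∈ w₂∈ j j′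
  ... | pretwin w₁≢w₂ w₁∈ w₂∈ (xw , yw) (inj₂ (inj₁ (_ , zw))) _ = ⊥-elim (twin-vertex (in₂ Δ∈) w₁∈ w₂∈ w₁≢w₂ xw yw zw)
  ... | pretwin w₁≢w₂ w₁∈ w₂∈ (xw , yw) (inj₂ (inj₂ (zw , _))) _ = ⊥-elim (twin-vertex (in₂ Δ∈) w₁∈ w₂∈ w₁≢w₂ xw yw zw)

  E₁₁ : E H (verts C₁) (verts C₁) + t₁ * 7 ≤ t₁ * 6 + t₁ * t₁ * 7
  E₁₁ = E-self-bound H triVerts C₁ (λ {Δ} _ → E-triangle-self H Δ)
    (AllPairs-from-Unique C₁ (Unique-++ˡ C₁ C-unique) λ Δ∈ Δ′∈ Δ≢Δ′ → hub-hub≤7 (in₁ Δ∈) (in₁ Δ′∈) Δ≢Δ′ (hub-of Δ∈) (hub-of Δ′∈))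

  -- `e` is the surplus over 7 granted to the one exceptional hub: 1 towards a twin, by
  -- `hub-twin≤8`, and 2 towards a rich or poor triangle, where only the trivial 9 is available.
  hubs-to : ∀ {Δ} e → Δ ∈ C₂ ++ (Q ++ G) → (∀ {Δ′} → Δ′ ∈ C₁ → EΔ Δ′ Δ ≤ 7 + e) → E H (triVerts Δ) (verts C₁) ≤ t₁ * 7 + e
  hubs-to {Δ} e Δ∈ le = ℕₚ.≤-trans (ℕₚ.≤-reflexive (trans (E-sym H (triVerts Δ) (verts C₁)) (E-blocks H triVerts C₁ (triVerts Δ))))
    (∑-bound-one-exception 7 e C₁
      (AllPairs-from-Unique C₁ (Unique-++ˡ C₁ C-unique) λ Δ₁∈ Δ₂∈ Δ₁≢Δ₂ →
        hub-exception (in₁ Δ₁∈) (in₁ Δ₂∈) (∈-++⁺ʳ C₁ Δ∈)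
          (unique₃ Δ₁≢Δ₂ (Unique-++-disjoint C₁ C-unique Δ₁∈ Δ∈) (Unique-++-disjoint C₁ C-unique Δ₂∈ Δ∈)) (hub-of Δ₁∈) (hub-of Δ₂∈))
      le)

  E₁₂ : E H (verts C₁) (verts C₂) ≤ t₂ * (t₁ * 7 + 1)
  E₁₂ = ℕₚ.≤-trans (ℕₚ.≤-reflexive (E-sym H (verts C₁) (verts C₂)))
    (E-bound H triVerts C₂ (verts C₁) λ Δ∈ → hubs-to 1 (∈-++⁺ˡ Δ∈) λ Δ′∈ →
      hub-twin≤8 (in₁ Δ′∈) (in₂ Δ∈) (Unique-++-disjoint C₁ C-unique Δ′∈ (∈-++⁺ˡ Δ∈)) (hub-of Δ′∈) (twin-of Δ∈))

  E₁-part : (P : List (Tri n)) → (∀ {Δ} → Δ ∈ P → Δ ∈ Q ++ G) → E H (verts C₁) (verts P) ≤ length P * (t₁ * 7 + 2)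
  E₁-part P P⊆ = ℕₚ.≤-trans (ℕₚ.≤-reflexive (E-sym H (verts C₁) (verts P)))
    (E-bound H triVerts P (verts C₁) λ {Δ} Δ∈ → hubs-to 2 (∈-++⁺ʳ C₂ (P⊆ Δ∈)) λ {Δ′} _ → E≤size H (triVerts Δ′) (triVerts Δ))

  E₂₂ : E H (verts C₂) (verts C₂) + t₂ * 8 ≤ t₂ * 6 + t₂ * t₂ * 8
  E₂₂ = E-self-bound H triVerts C₂ (λ {Δ} _ → E-triangle-self H Δ)
    (AllPairs-from-Unique C₂ (Unique-++ˡ C₂ rest-unique) λ Δ∈ Δ′∈ Δ≢Δ′ → twin-twin≤8 (in₂ Δ∈) (in₂ Δ′∈) Δ≢Δ′ (twin-of Δ∈) (twin-of Δ′∈))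

  E₂-part : (P : List (Tri n)) → (∀ {Δ} → Δ ∈ P → Δ ∈ Q ++ G) → E H (verts C₂) (verts P) ≤ length P * (t₂ * 8 + 1)
  E₂-part P P⊆ = ℕₚ.≤-trans (ℕₚ.≤-reflexive (E-sym H (verts C₂) (verts P)))
    (E-bound H triVerts P (verts C₂) λ {Δ} Δ∈ →
      ℕₚ.≤-trans (ℕₚ.≤-reflexive (trans (E-sym H (triVerts Δ) (verts C₂)) (E-blocks H triVerts C₂ (triVerts Δ))))
      (∑-bound-one-exception 8 1 C₂
        (AllPairs-from-Unique C₂ (Unique-++ˡ C₂ rest-unique) λ Δ₁∈ Δ₂∈ Δ₁≢Δ₂ →
          twin-exception (in₂ Δ₁∈) (in₂ Δ₂∈) (in-P (P⊆ Δ∈))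
            (unique₃ Δ₁≢Δ₂ (Unique-++-disjoint C₂ rest-unique Δ₁∈ (P⊆ Δ∈)) (Unique-++-disjoint C₂ rest-unique Δ₂∈ (P⊆ Δ∈)))
            (twin-of Δ₁∈) (twin-of Δ₂∈))
        (λ {Δ′} _ → E≤size H (triVerts Δ′) (triVerts Δ))))

  -- With a = 2μ paired and u unpaired triangles the leading terms are 7a² + 18au + 8u², as 28 edges
  -- between two K₆'s make 7 per pair of triangles. Since 25(a + u)²/3 exceeds this form by (2a -
  -- u)²/3, the constant 25/3 is its exact maximum, attained at u = 2a; the factor 3 clears the
  -- denominator.
  E-QQ : 3 * E H (verts Q) (verts Q) ≤ 25 * (q * q) + 3 * q
  E-QQ with Ps , U , p , cs , sparse ← K₆-matching H Q = bound
    where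
    open ℕₚ.≤-Reasoning
    X = concatMap hexVerts Ps
    Y = verts U
    μ = length Ps
    u = length U
    flat! : Unique (flatten Ps)
    flat! = Unique-++ˡ (flatten Ps) (Unique-resp-↭ p Q-unique)
    in-pairs : ∀ {Δ} → Δ ∈ flatten Ps → Δ ∈ Q
    in-pairs Δ∈ = ∈-resp-↭ (↭-sym p) (∈-++⁺ˡ Δ∈)
    rich-of : ∀ {Δ} → Δ ∈ flatten Ps → Rich H O Δ
    rich-of Δ∈ = proj₁ (All.lookup riches (in-pairs Δ∈))
    q≡ : q ≡ μ * 2 + u
    q≡ = trans (↭-length p) (trans (Listₚ.length-++ (flatten Ps)) (cong (_+ u) (length-flatten Ps)))
    perm : verts Q ↭ X ++ Y
    perm = ↭-trans (concatMap-↭ triVerts p) (↭-reflexive (trans (Listₚ.concatMap-++ triVerts (flatten Ps) U) (cong (_++ Y) (verts-flatten Ps))))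
    hex-self : ∀ p → E H (hexVerts p) (hexVerts p) ≤ 30
    hex-self (Δ , Δ′) = ℕₚ.≤-trans (ℕₚ.≤-reflexive (E-++-self H (triVerts Δ) (triVerts Δ′)))
      (ℕₚ.+-mono-≤ (ℕₚ.+-mono-≤ (E-triangle-self H Δ) (ℕₚ.*-monoʳ-≤ 2 (E≤size H (triVerts Δ) (triVerts Δ′)))) (E-triangle-self H Δ′))
    E-XX : E H X X + μ * 28 ≤ μ * 30 + μ * μ * 28
    E-XX = E-self-bound H hexVerts Ps (λ {p} _ → hex-self p)
      (AllPairs-map-∈ Ps (λ a∈ b∈ u → let a₁ , a₂ = ∈-flatten a∈ ; b₁ , b₂ = ∈-flatten b∈ in
        hex-hex≤28 (in-Q (in-pairs a₁)) (in-Q (in-pairs a₂)) (in-Q (in-pairs b₁)) (in-Q (in-pairs b₂)) u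
          (rich-of a₁) (rich-of a₂) (rich-of b₁) (rich-of b₂) (All.lookup cs a∈) (All.lookup cs b∈))
        (proj₁ (flatten-unique Ps flat!)))
    E-XY : E H X Y ≤ μ * (u * 18)
    E-XY = E-bound₂ H hexVerts triVerts Ps U (λ {a} {b} _ _ → E≤size H (hexVerts a) (triVerts b))
    E-YY : E H Y Y + u * 8 ≤ u * 6 + u * u * 8
    E-YY = E-self-bound H triVerts U (λ {Δ} _ → E-triangle-self H Δ) sparse
    arith₁ : ∀ x y z μ u → 3 * (x + 2 * y + z) + (84 * μ + 24 * u) ≡ 3 * (x + μ * 28) + 6 * y + 3 * (z + u * 8)
    arith₁ = solve-∀
    arith₂ : ∀ μ u → 3 * (μ * 30 + μ * μ * 28) + 6 * (μ * (u * 18)) + 3 * (u * 6 + u * u * 8) + 9 * u ≡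
             (84 * (μ * μ) + 100 * (μ * u) + 24 * (u * u) + 90 * μ + 27 * u) + 2 * (4 * μ * u)
    arith₂ = solve-∀
    arith₃ : ∀ μ u → (84 * (μ * μ) + 100 * (μ * u) + 24 * (u * u) + 90 * μ + 27 * u) + (4 * μ * (4 * μ) + u * u) ≡
             25 * ((μ * 2 + u) * (μ * 2 + u)) + 3 * (μ * 2 + u) + (84 * μ + 24 * u)
    arith₃ = solve-∀
    bound : 3 * E H (verts Q) (verts Q) ≤ 25 * (q * q) + 3 * q
    bound = ℕₚ.+-cancelʳ-≤ (84 * μ + 24 * u) _ _ (begin
      3 * E H (verts Q) (verts Q) + (84 * μ + 24 * u)
        ≡⟨ cong (λ e → 3 * e + (84 * μ + 24 * u)) (trans (E-↭ˡ H (verts Q) perm) (trans (E-↭ʳ H (X ++ Y) perm) (E-++-self H X Y))) ⟩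
      3 * (E H X X + 2 * E H X Y + E H Y Y) + (84 * μ + 24 * u)                    ≡⟨ arith₁ (E H X X) (E H X Y) (E H Y Y) μ u ⟩
      3 * (E H X X + μ * 28) + 6 * E H X Y + 3 * (E H Y Y + u * 8)
        ≤⟨ ℕₚ.+-mono-≤ (ℕₚ.+-mono-≤ (ℕₚ.*-monoʳ-≤ 3 E-XX) (ℕₚ.*-monoʳ-≤ 6 E-XY)) (ℕₚ.*-monoʳ-≤ 3 E-YY) ⟩
      -- Padding by 9u brings the linear part to 90μ + 27u, which is 3q plus the 84μ + 24u to be
      -- cancelled.
      3 * (μ * 30 + μ * μ * 28) + 6 * (μ * (u * 18)) + 3 * (u * 6 + u * u * 8)     ≤⟨ ℕₚ.m≤m+n _ (9 * u) ⟩
      _                                                                            ≡⟨ arith₂ μ u ⟩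
      _                                                                            ≤⟨ ℕₚ.+-monoʳ-≤ (84 * (μ * μ) + 100 * (μ * u) + 24 * (u * u) + 90 * μ + 27 * u) (2ab≤a²+b² (4 * μ) u) ⟩
      _                                                                            ≡⟨ arith₃ μ u ⟩
      25 * ((μ * 2 + u) * (μ * 2 + u)) + 3 * (μ * 2 + u) + (84 * μ + 24 * u)       ≡⟨ cong (λ k → 25 * (k * k) + 3 * k + (84 * μ + 24 * u)) q≡ ⟨
      25 * (q * q) + 3 * q + (84 * μ + 24 * u)                                     ∎)

  E-QG : E H (verts Q) (verts G) ≤ q * (g * 9)
  E-QG = E-bound₂ H triVerts triVerts Q G (λ {Δ} {Δ′} _ _ → E≤size H (triVerts Δ) (triVerts Δ′))

  E-GG : E H (verts G) (verts G) + g * 9 ≤ g * 6 + g * g * 9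
  E-GG = E-self-bound H triVerts G (λ {Δ} _ → E-triangle-self H Δ)
    (AllPairs-from-Unique G (Unique-++ʳ Q (Unique-++ʳ C₂ rest-unique)) λ {Δ} {Δ′} _ _ _ → E≤size H (triVerts Δ) (triVerts Δ′))

  E₁-O : E H (verts C₁) O ≤ t₁ * (4 * m + 2 * i)
  E₁-O = E-bound H triVerts C₁ O λ Δ∈ → E-hub-O (in₁ Δ∈) (hub-of Δ∈)

  E₂-O : E H (verts C₂) O ≤ t₂ * (3 * m + 2 * i + 2)
  E₂-O = E-bound H triVerts C₂ O λ Δ∈ → E-twin-O (in₂ Δ∈) (twin-of Δ∈) (PreTwin.unseen (All.lookup pretwins Δ∈))

  E-Q-O : E H (verts Q) O ≤ q * (3 * m + i + 5)
  E-Q-O = E-bound H triVerts Q O λ Δ∈ → proj₂ (All.lookup riches Δ∈)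

  E-G-O : E H (verts G) O ≤ g * (m * 2 + i + 6)
  E-G-O = E-bound H triVerts G O λ Δ∈ → ℕₚ.≤-trans (All.lookup poors Δ∈) (ℕₚ.≤-reflexive (cong (_+ 6) length-O))

  -- A surplus towards twins presupposes an exceptional hub. Recording ε ≤ t₁ lets the case ε = 1
  -- split off a hub, whose contribution to the final inequality helps pay for the term ε t₂.
  E₁₂-sharp : ∃ λ ε → ε ≤ 1 × ε ≤ t₁ × E H (verts C₁) (verts C₂) ≤ t₂ * (t₁ * 7 + ε)
  E₁₂-sharp = go C₁ refl
    where
    go : ∀ C′ → C′ ≡ C₁ → ∃ λ ε → ε ≤ 1 × ε ≤ length C′ × E H (verts C′) (verts C₂) ≤ t₂ * (length C′ * 7 + ε)
    go []       _    = 0 , z≤n , z≤n , z≤n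
    go (_ ∷ _) refl = 1 , ℕₚ.≤-refl , s≤s z≤n , E₁₂

  E-total : 2 * edgeCount H ≡
    E H (verts C₁) (verts C₁) + 2 * (E H (verts C₁) (verts C₂) + (E H (verts C₁) (verts Q) + (E H (verts C₁) (verts G) + E H (verts C₁) O))) +
    (E H (verts C₂) (verts C₂) + 2 * (E H (verts C₂) (verts Q) + (E H (verts C₂) (verts G) + E H (verts C₂) O)) +
    (E H (verts Q) (verts Q) + 2 * (E H (verts Q) (verts G) + E H (verts Q) O) +
    (E H (verts G) (verts G) + 2 * E H (verts G) O + E H O O)))
  E-total = begin
      2 * edgeCount H             ≡⟨ 2edgeCount H ⟩
      E H (allFin n) (allFin n)   ≡⟨ trans (E-↭ˡ H (allFin n) (↭-sym parts)) (E-↭ʳ H (V₁ ++ R₁) (↭-sym parts)) ⟩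
      E H (V₁ ++ R₁) (V₁ ++ R₁)   ≡⟨ E-++-self H V₁ R₁ ⟩
      E H V₁ V₁ + 2 * E H V₁ R₁ + E H R₁ R₁ ≡⟨ cong₂ (λ a b → E H V₁ V₁ + 2 * a + b)
          (trans (E-++ʳ H V₁ V₂ R₂) (cong (E H V₁ V₂ +_) (trans (E-++ʳ H V₁ V₃ R₃) (cong (E H V₁ V₃ +_) (E-++ʳ H V₁ V₄ O)))))
          (trans (E-++-self H V₂ R₂) (cong₂ (λ a b → E H V₂ V₂ + 2 * a + b)
            (trans (E-++ʳ H V₂ V₃ R₃) (cong (E H V₂ V₃ +_) (E-++ʳ H V₂ V₄ O)))
            (trans (E-++-self H V₃ R₃) (cong₂ (λ a b → E H V₃ V₃ + 2 * a + b) (E-++ʳ H V₃ V₄ O) (E-++-self H V₄ O))))) ⟩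
      _ ∎
    where
    open ≡-Reasoning
    V₁ = verts C₁
    V₂ = verts C₂
    V₃ = verts Q
    V₄ = verts G
    R₃ = V₄ ++ O
    R₂ = V₃ ++ R₃
    R₁ = V₂ ++ R₂
    parts : V₁ ++ R₁ ↭ allFin n
    parts = ↭-trans (↭-reflexive (sym (trans
      (cong (_++ O) (trans (Listₚ.concatMap-++ triVerts C₁ (C₂ ++ (Q ++ G))) (cong (V₁ ++_)
                     (trans (Listₚ.concatMap-++ triVerts C₂ (Q ++ G)) (cong (V₂ ++_) (Listₚ.concatMap-++ triVerts Q G))))))
      (trans (Listₚ.++-assoc V₁ (V₂ ++ (V₃ ++ V₄)) O) (cong (V₁ ++_)
        (trans (Listₚ.++-assoc V₂ (V₃ ++ V₄) O) (cong (V₂ ++_) (Listₚ.++-assoc V₃ V₄ O)))))))) cover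

-- The extremal graph

parity : ℕ → Bool
parity zero    = false
parity (suc n) = not (parity n)

-- The first t vertices are universal; the others form a complete bipartite graph split by parity.
joinAdj : ℕ → ℕ → ℕ → Bool
joinAdj zero    u       v       = parity u xor parity v
joinAdj (suc t) zero    zero    = false
joinAdj (suc t) zero    (suc v) = true
joinAdj (suc t) (suc u) zero    = true
joinAdj (suc t) (suc u) (suc v) = joinAdj t u v

joinAdj-sym : ∀ t u v → joinAdj t u v ≡ joinAdj t v u
joinAdj-sym zero    u       v       = Boolₚ.xor-comm (parity u) (parity v)
joinAdj-sym (suc t) zero    zero    = refl
joinAdj-sym (suc t) zero    (suc v) = refl
joinAdj-sym (suc t) (suc u) zero    = refl
joinAdj-sym (suc t) (suc u) (suc v) = joinAdj-sym t u v

joinAdj-irrefl : ∀ t u → joinAdj t u u ≡ false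
joinAdj-irrefl zero    u       = Boolₚ.xor-same (parity u)
joinAdj-irrefl (suc t) zero    = refl
joinAdj-irrefl (suc t) (suc u) = joinAdj-irrefl t u

joinGraph : ℕ → (n : ℕ) → Graph n
joinGraph t n = record
  { adj    = λ u v → joinAdj t (toℕ u) (toℕ v)
  ; sym    = λ u v → joinAdj-sym t (toℕ u) (toℕ v)
  ; irrefl = λ u → joinAdj-irrefl t (toℕ u)
  }

joinAdj-triangle : ∀ t u v w → joinAdj t u v ≡ true → joinAdj t u w ≡ true → joinAdj t v w ≡ true → u < t ⊎ v < t ⊎ w < t
joinAdj-triangle zero u v w uv uw vw = ⊥-elim (odd-cycle (parity u) (parity v) (parity w) uv uw vw)
  where
  odd-cycle : ∀ p q r → p xor q ≡ true → p xor r ≡ true → q xor r ≡ true → ⊥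
  odd-cycle true  false false _ _ ()
  odd-cycle false true  true  _ _ ()
joinAdj-triangle (suc t) zero    v       w       _  _  _  = inj₁ (s≤s z≤n)
joinAdj-triangle (suc t) (suc u) zero    w       _  _  _  = inj₂ (inj₁ (s≤s z≤n))
joinAdj-triangle (suc t) (suc u) (suc v) zero    _  _  _  = inj₂ (inj₂ (s≤s z≤n))
joinAdj-triangle (suc t) (suc u) (suc v) (suc w) uv uw vw =
  [ inj₁ ∘ s≤s , inj₂ ∘ [ inj₁ ∘ s≤s , inj₂ ∘ s≤s ]′ ]′ (joinAdj-triangle t u v w uv uw vw)

-- Every triangle contains one of the `t` universal vertices, the rest being bipartite, so the
-- pigeonhole principle makes two of `t + 1` triangles share a vertex.
joinGraph-free : ∀ t n → SK3Free (t + 1) (joinGraph t n)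
joinGraph-free t n (f , f-inj , tri) =
  let a , b , a<b , eq = Finₚ.pigeonhole (ℕₚ.≤-reflexive (ℕₚ.+-comm 1 t)) (λ a → Fin.fromℕ< (proj₂ (small a)))
      fa≡fb = Finₚ.toℕ-injective (trans (sym (Finₚ.toℕ-fromℕ< (proj₂ (small a)))) (trans (cong toℕ eq) (Finₚ.toℕ-fromℕ< (proj₂ (small b)))))
  in Finₚ.<⇒≢ a<b (cong proj₁ (f-inj fa≡fb))
  where
  small : ∀ a → ∃ λ j → toℕ (f (a , j)) < t
  small a = let xy , xz , yz = tri a in
    [ (# 0 ,_) , [ (# 1 ,_) , (# 2 ,_) ]′ ]′ (joinAdj-triangle t _ _ _ xy xz yz)

∑-allFin-suc : ∀ n (f : Fin (suc n) → ℕ) → ∑ f (allFin (suc n)) ≡ f Fin.zero + ∑ (λ v → f (Fin.suc v)) (allFin n)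
∑-allFin-suc n f = cong (f Fin.zero +_) (trans (cong (∑ f) (sym (Listₚ.map-tabulate id Fin.suc))) (cong sum (sym (Listₚ.map-∘ (allFin n)))))

-- Indexed by natural numbers so that deleting vertex 0 is a shift of the indices, which matches the
-- recursion of `joinAdj`.
∑∑ : ∀ n → (ℕ → ℕ → Bool) → ℕ
∑∑ n F = ∑ (λ u → ∑ (λ v → b2n (F (toℕ u) (toℕ v))) (allFin n)) (allFin n)

∑∑-suc : ∀ n F → ∑∑ (suc n) F ≡
  b2n (F 0 0) + ∑ (λ (v : Fin n) → b2n (F 0 (suc (toℕ v)))) (allFin n) +
  (∑ (λ (u : Fin n) → b2n (F (suc (toℕ u)) 0)) (allFin n) + ∑∑ n (λ u v → F (suc u) (suc v)))
∑∑-suc n F = trans (∑-allFin-suc n (λ u → ∑ (λ v → b2n (F (toℕ u) (toℕ v))) (allFin (suc n))))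
  (cong₂ _+_ (∑-allFin-suc n (λ v → b2n (F 0 (toℕ v))))
             (trans (∑-cong (λ u → ∑-allFin-suc n (λ v → b2n (F (suc (toℕ u)) (toℕ v)))) (allFin n)) (∑-+ _ _ (allFin n))))

∑-one : ∀ n → ∑ (λ _ → 1) (allFin n) ≡ n
∑-one n = trans (∑-const 1 (allFin n)) (trans (ℕₚ.*-identityʳ _) (Listₚ.length-tabulate id))

parity-count : ∀ n → 2 * ∑ (λ (v : Fin n) → b2n (not (parity (toℕ v)))) (allFin n) ≡ n + b2n (parity n) ×
                     2 * ∑ (λ (v : Fin n) → b2n (parity (toℕ v))) (allFin n) + b2n (parity n) ≡ n
parity-count zero    = refl , refl
parity-count (suc n) =
  let even , odd = parity-count n
      odds = ∑ (λ (v : Fin n) → b2n (parity (toℕ v))) (allFin n)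
      evens = ∑ (λ (v : Fin n) → b2n (not (parity (toℕ v)))) (allFin n)
      nn : ∀ (v : Fin n) → b2n (not (not (parity (toℕ v)))) ≡ b2n (parity (toℕ v))
      nn v = cong b2n (Boolₚ.not-involutive (parity (toℕ v)))
  in trans (cong (2 *_) (trans (∑-allFin-suc n (λ v → b2n (not (parity (toℕ v))))) (cong suc (∑-cong nn (allFin n)))))
       (step₁ (parity n) odds odd) ,
     trans (cong (λ s → 2 * s + b2n (not (parity n))) (∑-allFin-suc n (λ v → b2n (parity (toℕ v))))) (step₂ (parity n) evens even)
  where
  step₁ : ∀ p odds → 2 * odds + b2n p ≡ n → 2 * suc odds ≡ suc n + b2n (not p)
  step₁ true  o eq = trans (arith o) (cong suc (trans eq (sym (ℕₚ.+-identityʳ n))))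
    where
    arith : ∀ o → 2 * suc o ≡ suc (2 * o + 1)
    arith = solve-∀
  step₁ false o eq = trans (arith o) (cong (λ k → suc (k + 1)) eq)
    where
    arith : ∀ o → 2 * suc o ≡ suc ((2 * o + 0) + 1)
    arith = solve-∀
  step₂ : ∀ p evens → 2 * evens ≡ n + b2n p → 2 * evens + b2n (not p) ≡ suc n
  step₂ true  e eq = trans (ℕₚ.+-identityʳ _) (trans eq (ℕₚ.+-comm n 1))
  step₂ false e eq = trans (cong (_+ 1) (trans eq (ℕₚ.+-identityʳ n))) (ℕₚ.+-comm n 1)

-- The left sum is four times the number of edges, so this says ⌊n²/4⌋ edges, with the parity bit as
-- remainder. In the induction, deleting vertex 0 flips all parities and leaves `xor` unchanged.
bipartite-total : ∀ n → 2 * ∑∑ n (joinAdj 0) + b2n (parity n) ≡ n * n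
bipartite-total zero    = refl
bipartite-total (suc n) = begin
    2 * ∑∑ (suc n) (joinAdj 0) + b2n (not (parity n))
      ≡⟨ cong (λ s → 2 * s + b2n (not (parity n))) (trans (∑∑-suc n (joinAdj 0))
           (cong₂ (λ a b → evens + (a + b)) (∑-cong (λ u → cong b2n (Boolₚ.xor-comm (not (parity (toℕ u))) false)) (allFin n))
             (∑-cong (λ u → ∑-cong (λ v → cong b2n (not-xor (parity (toℕ u)) (parity (toℕ v)))) (allFin n)) (allFin n)))) ⟩
    2 * (evens + (evens + S)) + b2n (not (parity n))         ≡⟨ arith₁ evens S (b2n (not (parity n))) ⟩
    2 * (2 * evens) + 2 * S + b2n (not (parity n))           ≡⟨ cong (λ s → 2 * s + 2 * S + b2n (not (parity n))) (proj₁ (parity-count n)) ⟩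
    2 * (n + b2n (parity n)) + 2 * S + b2n (not (parity n))  ≡⟨ arith₂ n S (b2n (parity n)) (b2n (not (parity n))) ⟩
    2 * n + (2 * S + b2n (parity n)) + (b2n (parity n) + b2n (not (parity n)))
      ≡⟨ cong₂ (λ a b → 2 * n + a + b) (bipartite-total n) (b2n-not (parity n)) ⟩
    2 * n + n * n + 1                                        ≡⟨ arith₃ n ⟩
    suc n * suc n                                            ∎
  where
  open ≡-Reasoning
  evens = ∑ (λ (v : Fin n) → b2n (not (parity (toℕ v)))) (allFin n)
  S = ∑∑ n (joinAdj 0)
  not-xor : ∀ p q → not p xor not q ≡ p xor q
  not-xor true  q = refl
  not-xor false q = Boolₚ.not-involutive q
  b2n-not : ∀ p → b2n p + b2n (not p) ≡ 1
  b2n-not true  = refl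
  b2n-not false = refl
  arith₁ : ∀ e s p → 2 * (e + (e + s)) + p ≡ 2 * (2 * e) + 2 * s + p
  arith₁ = solve-∀
  arith₂ : ∀ n s p p′ → 2 * (n + p) + 2 * s + p′ ≡ 2 * n + (2 * s + p) + (p + p′)
  arith₂ = solve-∀
  arith₃ : ∀ n → 2 * n + n * n + 1 ≡ suc n * suc n
  arith₃ = solve-∀

join-total : ∀ t r → 2 * ∑∑ (t + r) (joinAdj t) + b2n (parity r) + 2 * t ≡ 2 * (t * t) + 4 * (t * r) + r * r
join-total zero    r = trans (ℕₚ.+-identityʳ _) (bipartite-total r)
join-total (suc t) r = begin
    2 * ∑∑ (suc (t + r)) (joinAdj (suc t)) + π + 2 * suc t
      ≡⟨ cong (λ s → 2 * s + π + 2 * suc t) (trans (∑∑-suc (t + r) (joinAdj (suc t))) (cong₂ (λ a b → a + (b + S)) (∑-one (t + r)) (∑-one (t + r)))) ⟩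
    2 * ((t + r) + ((t + r) + S)) + π + 2 * suc t     ≡⟨ arith₁ t r S π ⟩
    (2 * S + π + 2 * t) + (4 * t + 4 * r + 2)         ≡⟨ cong (_+ (4 * t + 4 * r + 2)) (join-total t r) ⟩
    _                                                 ≡⟨ arith₂ t r ⟩
    2 * (suc t * suc t) + 4 * (suc t * r) + r * r     ∎
  where
  open ≡-Reasoning
  π = b2n (parity r)
  S = ∑∑ (t + r) (joinAdj t)
  arith₁ : ∀ t r s p → 2 * ((t + r) + ((t + r) + s)) + p + 2 * suc t ≡ (2 * s + p + 2 * t) + (4 * t + 4 * r + 2)
  arith₁ = solve-∀
  arith₂ : ∀ t r → (2 * (t * t) + 4 * (t * r) + r * r) + (4 * t + 4 * r + 2) ≡ 2 * (suc t * suc t) + 4 * (suc t * r) + r * r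
  arith₂ = solve-∀

joinGraph-edges : ∀ t r → 2 * (t * t) + 4 * (t * r) + r * r ≤ 4 * edgeCount (joinGraph t (t + r)) + 1 + 2 * t
joinGraph-edges t r = begin
    2 * (t * t) + 4 * (t * r) + r * r                                ≡⟨ join-total t r ⟨
    2 * ∑∑ (t + r) (joinAdj t) + b2n (parity r) + 2 * t              ≤⟨ ℕₚ.+-monoˡ-≤ (2 * t) (ℕₚ.+-monoʳ-≤ (2 * ∑∑ (t + r) (joinAdj t)) (b2n≤1 (parity r))) ⟩
    2 * ∑∑ (t + r) (joinAdj t) + 1 + 2 * t                           ≡⟨ cong (λ s → 2 * s + 1 + 2 * t) (2edgeCount (joinGraph t (t + r))) ⟨
    2 * (2 * edgeCount (joinGraph t (t + r))) + 1 + 2 * t            ≡⟨ cong (λ s → s + 1 + 2 * t) (ℕₚ.*-assoc 2 2 (edgeCount (joinGraph t (t + r)))) ⟨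
    4 * edgeCount (joinGraph t (t + r)) + 1 + 2 * t                  ∎
  where open ℕₚ.≤-Reasoning

-- Lists of disjoint triangles and copies of sK₃

triVertex : Tri n → Fin 3 → Fin n
triVertex (x , y , z) Fin.zero                     = x
triVertex (x , y , z) (Fin.suc Fin.zero)           = y
triVertex (x , y , z) (Fin.suc (Fin.suc Fin.zero)) = z

triVertex-∈ : (Δ : Tri n) (j : Fin 3) → triVertex Δ j ∈ triVerts Δ
triVertex-∈ Δ Fin.zero                     = here refl
triVertex-∈ Δ (Fin.suc Fin.zero)           = there (here refl)
triVertex-∈ Δ (Fin.suc (Fin.suc Fin.zero)) = there (there (here refl))

triVertex-injective : (Δ : Tri n) → Unique (triVerts Δ) → ∀ p q → triVertex Δ p ≡ triVertex Δ q → p ≡ q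
triVertex-injective Δ u p q eq = lookup-injective (triVerts Δ) u (trans (as-lookup p) (trans eq (sym (as-lookup q))))
  where
  as-lookup : ∀ j → lookup (triVerts Δ) j ≡ triVertex Δ j
  as-lookup Fin.zero                     = refl
  as-lookup (Fin.suc Fin.zero)           = refl
  as-lookup (Fin.suc (Fin.suc Fin.zero)) = refl

tiling-vertex-injective : (Ts : List (Tri n)) → Unique (verts Ts) → ∀ a b p q →
  triVertex (lookup Ts a) p ≡ triVertex (lookup Ts b) q → a ≡ b × p ≡ q
tiling-vertex-injective (Δ ∷ Ts) u Fin.zero Fin.zero p q eq = refl , triVertex-injective Δ (Unique-++ˡ (triVerts Δ) u) p q eq
tiling-vertex-injective (Δ ∷ Ts) u Fin.zero (Fin.suc b) p q eq =
  contradiction eq (Unique-++-disjoint (triVerts Δ) u (triVertex-∈ Δ p) (∈-verts {Ts = Ts} (∈-lookup b) (triVertex-∈ (lookup Ts b) q)))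
tiling-vertex-injective (Δ ∷ Ts) u (Fin.suc a) Fin.zero p q eq =
  contradiction (sym eq) (Unique-++-disjoint (triVerts Δ) u (triVertex-∈ Δ q) (∈-verts {Ts = Ts} (∈-lookup a) (triVertex-∈ (lookup Ts a) p)))
tiling-vertex-injective (Δ ∷ Ts) u (Fin.suc a) (Fin.suc b) p q eq =
  let a≡b , p≡q = tiling-vertex-injective Ts (Unique-++ʳ (triVerts Δ) u) a b p q eq in cong Fin.suc a≡b , p≡q

triangles⇒ContainsSK3 : (H : Graph n) (s : ℕ) (Ts : List (Tri n)) → All (IsTriangle H) Ts → Unique (verts Ts) →
                        s ≤ length Ts → ContainsSK3 s H
triangles⇒ContainsSK3 H s Ts tris u le =
  (λ (a , j) → triVertex (lookup Ts (Fin.inject≤ a le)) j) ,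
  (λ {x} {y} eq → let a≡b , p≡q = tiling-vertex-injective Ts u _ _ _ _ eq
                  in cong₂ _,_ (Finₚ.inject≤-injective le le (proj₁ x) (proj₁ y) a≡b) p≡q) ,
  (λ a → All.lookup tris (∈-lookup (Fin.inject≤ a le)))

ContainsSK3⇒triangles : (H : Graph n) (s : ℕ) → ContainsSK3 s H →
                        ∃ λ Ts → All (IsTriangle H) Ts × Unique (verts Ts) × length Ts ≡ s
ContainsSK3⇒triangles {n} H s (f , f-inj , tri) =
  map Δ (allFin s) , Allₚ.map⁺ (All.tabulate λ {a} _ → tri a) ,
  subst Unique (image (allFin s)) (Uniqueₚ.map⁺ f-inj (Uniqueₚ.cartesianProduct⁺ (Uniqueₚ.allFin⁺ s) (Uniqueₚ.allFin⁺ 3))) ,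
  trans (Listₚ.length-map Δ (allFin s)) (Listₚ.length-tabulate id)
  where
  Δ : Fin s → Tri n
  Δ a = f (a , # 0) , f (a , # 1) , f (a , # 2)
  image : ∀ as → map f (cartesianProduct as (allFin 3)) ≡ verts (map Δ as)
  image []       = refl
  image (a ∷ as) = cong (λ vs → triVerts (Δ a) ++ vs) (image as)

-- The quadratic inequality

-- The pattern of all estimates below: `P ≤ R` is a combination of hypotheses, `s` a polynomial
-- slack with natural coefficients, and the ring solver proves the identity. Subtraction never
-- occurs.
transfer : ∀ {P R} L N s → P ≤ R → R + L + s ≡ P + N → L ≤ N
transfer {P} {R} L N s P≤R eq = ℕₚ.+-cancelˡ-≤ P L N (begin
    P + L       ≤⟨ ℕₚ.+-monoˡ-≤ L P≤R ⟩
    R + L       ≤⟨ ℕₚ.m≤m+n (R + L) s ⟩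
    R + L + s   ≡⟨ eq ⟩
    P + N       ∎)
  where open ℕₚ.≤-Reasoning

-- Twice the edge count is multiplied by 3 because of the 25/3 for rich triangles. The terms 21, 24
-- and 27 are three times the diagonal corrections 7, 8 and 9 from `E-self-bound`.
edge-upper-bound : ∀ {t₁ t₂ q g m i ε e e₁₁ e₁₂ e₁q e₁g e₁o e₂₂ e₂q e₂g e₂o eqq eqg eqo egg ego eoo} →
  2 * e ≡ e₁₁ + 2 * (e₁₂ + (e₁q + (e₁g + e₁o))) + (e₂₂ + 2 * (e₂q + (e₂g + e₂o)) + (eqq + 2 * (eqg + eqo) + (egg + 2 * ego + eoo))) →
  e₁₁ + t₁ * 7 ≤ t₁ * 6 + t₁ * t₁ * 7 →
  e₁₂ ≤ t₂ * (t₁ * 7 + ε) →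
  e₁q ≤ q * (t₁ * 7 + 2) →
  e₁g ≤ g * (t₁ * 7 + 2) →
  e₁o ≤ t₁ * (4 * m + 2 * i) →
  e₂₂ + t₂ * 8 ≤ t₂ * 6 + t₂ * t₂ * 8 →
  e₂q ≤ q * (t₂ * 8 + 1) →
  e₂g ≤ g * (t₂ * 8 + 1) →
  e₂o ≤ t₂ * (3 * m + 2 * i + 2) →
  3 * eqq ≤ 25 * (q * q) + 3 * q →
  eqg ≤ q * (g * 9) →
  eqo ≤ q * (3 * m + i + 5) →
  egg + g * 9 ≤ g * 6 + g * g * 9 →
  ego ≤ g * (m * 2 + i + 6) →
  eoo ≤ 2 * (m * m) + 2 * (m * i) →
  6 * e + (21 * t₁ + 24 * t₂ + 27 * g) ≤
    3 * (t₁ * 6 + t₁ * t₁ * 7) + 6 * (t₂ * (t₁ * 7 + ε) + (q * (t₁ * 7 + 2) + (g * (t₁ * 7 + 2) + t₁ * (4 * m + 2 * i)))) +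
    (3 * (t₂ * 6 + t₂ * t₂ * 8) + 6 * (q * (t₂ * 8 + 1) + (g * (t₂ * 8 + 1) + t₂ * (3 * m + 2 * i + 2))) +
    ((25 * (q * q) + 3 * q) + 6 * (q * (g * 9) + q * (3 * m + i + 5)) +
    (3 * (g * 6 + g * g * 9) + 6 * (g * (m * 2 + i + 6)) + 3 * (2 * (m * m) + 2 * (m * i)))))
edge-upper-bound {t₁} {t₂} {q} {g} {m} {i} {ε} {e} {e₁₁} {e₁₂} {e₁q} {e₁g} {e₁o} {e₂₂} {e₂q} {e₂g} {e₂o} {eqq} {eqg} {eqo} {egg} {ego} {eoo}
  total b₁₁ b₁₂ b₁q b₁g b₁o b₂₂ b₂q b₂g b₂o bqq bqg bqo bgg bgo boo = begin
    6 * e + (21 * t₁ + 24 * t₂ + 27 * g)                  ≡⟨ cong (_+ (21 * t₁ + 24 * t₂ + 27 * g)) (trans (ℕₚ.*-assoc 3 2 e) (cong (3 *_) total)) ⟩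
    3 * (e₁₁ + 2 * s₁ + (e₂₂ + 2 * s₂ + (eqq + 2 * s₃ + (egg + 2 * ego + eoo)))) + (21 * t₁ + 24 * t₂ + 27 * g)
      ≡⟨ arith e₁₁ s₁ e₂₂ s₂ eqq s₃ egg ego eoo t₁ t₂ g ⟩
    3 * (e₁₁ + t₁ * 7) + 6 * s₁ + (3 * (e₂₂ + t₂ * 8) + 6 * s₂ + (3 * eqq + 6 * s₃ + (3 * (egg + g * 9) + 6 * ego + 3 * eoo)))
      ≤⟨ (3 *≤ b₁₁ ⊕ 6 *≤ (b₁₂ ⊕ (b₁q ⊕ (b₁g ⊕ b₁o)))) ⊕ ((3 *≤ b₂₂ ⊕ 6 *≤ (b₂q ⊕ (b₂g ⊕ b₂o))) ⊕
         ((bqq ⊕ 6 *≤ (bqg ⊕ bqo)) ⊕ ((3 *≤ bgg ⊕ 6 *≤ bgo) ⊕ 3 *≤ boo))) ⟩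
    _ ∎
  where
  open ℕₚ.≤-Reasoning
  infixr 5 _⊕_
  infixr 6 _*≤_
  _⊕_ : ∀ {a b c d} → a ≤ b → c ≤ d → a + c ≤ b + d
  _⊕_ = ℕₚ.+-mono-≤
  _*≤_ : ∀ c {a b} → a ≤ b → c * a ≤ c * b
  c *≤ le = ℕₚ.*-monoʳ-≤ c le
  s₁ = e₁₂ + (e₁q + (e₁g + e₁o))
  s₂ = e₂q + (e₂g + e₂o)
  s₃ = eqg + eqo
  arith : ∀ a s₁ b s₂ c s₃ d f h t₁ t₂ g →
    3 * (a + 2 * s₁ + (b + 2 * s₂ + (c + 2 * s₃ + (d + 2 * f + h)))) + (21 * t₁ + 24 * t₂ + 27 * g) ≡
    3 * (a + t₁ * 7) + 6 * s₁ + (3 * (b + t₂ * 8) + 6 * s₂ + (3 * c + 6 * s₃ + (3 * (d + g * 9) + 6 * f + 3 * h)))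
  arith = solve-∀

-- The number of edges of the extremal graph, plus two, is at most the upper bound for e(H): twelve times this,
-- with the negative terms moved to the right.
Excess : (t₁ t₂ q g m i ε : ℕ) → Set
Excess t₁ t₂ q g m i ε =
  3 * (i * i) + 12 * (m * (t₂ + q + 2 * g)) + 12 * (i * (q + g)) + 24 ≤
    6 * (t₂ * t₂) + 12 * (t₂ * (q + g)) + 8 * (q * q) + 24 * (q * g) + 12 * (g * g) + 18 * t₂ + 12 * (ε * t₂) + 108 * q + 96 * g +
    6 * (2 * m + i) + 12 * (t₁ + (t₂ + (q + g)))

-- `r` is n - t, the number of vertices of the bipartite part of the extremal graph, expressed
-- through k = t + 1 and n = 3k + 2m + i.
excess-bound : ∀ t₁ t₂ q g m i ε e t →
  6 * e + (21 * t₁ + 24 * t₂ + 27 * g) ≤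
    3 * (t₁ * 6 + t₁ * t₁ * 7) + 6 * (t₂ * (t₁ * 7 + ε) + (q * (t₁ * 7 + 2) + (g * (t₁ * 7 + 2) + t₁ * (4 * m + 2 * i)))) +
    (3 * (t₂ * 6 + t₂ * t₂ * 8) + 6 * (q * (t₂ * 8 + 1) + (g * (t₂ * 8 + 1) + t₂ * (3 * m + 2 * i + 2))) +
    ((25 * (q * q) + 3 * q) + 6 * (q * (g * 9) + q * (3 * m + i + 5)) +
    (3 * (g * 6 + g * g * 9) + 6 * (g * (m * 2 + i + 6)) + 3 * (2 * (m * m) + 2 * (m * i))))) →
  suc t ≡ t₁ + (t₂ + (q + g)) →
  (r : ℕ) → r ≡ 2 * suc t + 2 * m + i + 1 →
  2 * (t * t) + 4 * (t * r) + r * r + 8 ≤ 4 * e + 1 + 2 * t →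
  Excess t₁ t₂ q g m i ε
-- Three times the lower bound for 4e is combined with twice the upper bound for 6e, so that `e`
-- cancels.
excess-bound t₁ t₂ q g m i ε e t upper k≡ r r≡ lower = transfer _ _ 0 (ℕₚ.+-mono-≤ lower′ (ℕₚ.*-monoʳ-≤ 2 upper)) (identity t₁ t₂ q g m i ε e)
  where
  k = t₁ + (t₂ + (q + g))
  -- Adding 4t + 5 + 4r completes the left side to an expression in t + 1, so that k can be
  -- substituted without a predecessor.
  step : ∀ t r → 2 * (t * t) + 4 * (t * r) + r * r + 8 + (4 * t + 5 + 4 * r) ≡ 2 * (suc t * suc t) + 4 * (suc t * r) + r * r + 11
  step = solve-∀
  step′ : ∀ e t r → 4 * e + 1 + 2 * t + (4 * t + 5 + 4 * r) ≡ 4 * e + 6 * suc t + 4 * r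
  step′ = solve-∀
  lower′ : 3 * (2 * (k * k) + 4 * (k * (2 * k + 2 * m + i + 1)) + (2 * k + 2 * m + i + 1) * (2 * k + 2 * m + i + 1) + 11) ≤
           3 * (4 * e + 6 * k + 4 * (2 * k + 2 * m + i + 1))
  lower′ = subst (λ k → 3 * (2 * (k * k) + 4 * (k * (2 * k + 2 * m + i + 1)) + (2 * k + 2 * m + i + 1) * (2 * k + 2 * m + i + 1) + 11) ≤
                        3 * (4 * e + 6 * k + 4 * (2 * k + 2 * m + i + 1))) k≡
    (subst (λ r → 3 * (2 * (suc t * suc t) + 4 * (suc t * r) + r * r + 11) ≤ 3 * (4 * e + 6 * suc t + 4 * r)) r≡
      (ℕₚ.*-monoʳ-≤ 3 (subst₂ _≤_ (step t r) (step′ e t r) (ℕₚ.+-monoˡ-≤ (4 * t + 5 + 4 * r) lower))))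
  identity : ∀ t₁ t₂ q g m i ε e → let k = t₁ + (t₂ + (q + g)) in
    3 * (4 * e + 6 * k + 4 * (2 * k + 2 * m + i + 1)) +
    2 * (3 * (t₁ * 6 + t₁ * t₁ * 7) + 6 * (t₂ * (t₁ * 7 + ε) + (q * (t₁ * 7 + 2) + (g * (t₁ * 7 + 2) + t₁ * (4 * m + 2 * i)))) +
      (3 * (t₂ * 6 + t₂ * t₂ * 8) + 6 * (q * (t₂ * 8 + 1) + (g * (t₂ * 8 + 1) + t₂ * (3 * m + 2 * i + 2))) +
      ((25 * (q * q) + 3 * q) + 6 * (q * (g * 9) + q * (3 * m + i + 5)) +
      (3 * (g * 6 + g * g * 9) + 6 * (g * (m * 2 + i + 6)) + 3 * (2 * (m * m) + 2 * (m * i)))))) +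
    (3 * (i * i) + 12 * (m * (t₂ + q + 2 * g)) + 12 * (i * (q + g)) + 24) + 0 ≡
    3 * (2 * (k * k) + 4 * (k * (2 * k + 2 * m + i + 1)) + (2 * k + 2 * m + i + 1) * (2 * k + 2 * m + i + 1) + 11) +
    2 * (6 * e + (21 * t₁ + 24 * t₂ + 27 * g)) +
    (6 * (t₂ * t₂) + 12 * (t₂ * (q + g)) + 8 * (q * q) + 24 * (q * g) + 12 * (g * g) + 18 * t₂ + 12 * (ε * t₂) + 108 * q + 96 * g +
     6 * (2 * m + i) + 12 * (t₁ + (t₂ + (q + g))))
  identity = solve-∀

eliminate-m : ∀ t₁ t₂ q g m i ε ℓ → Excess t₁ t₂ q g m i ε →
  3 * (t₁ + (t₂ + (q + g))) + 15 + ℓ ≡ 4 * m + 2 * i → 1 ≤ t₂ + q + 2 * g →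
  3 * (i * i) + 6 * (i * q) + 3 * ((t₂ + q + 2 * g) * (3 * (t₁ + (t₂ + (q + g))) + 15)) + 24 ≤
    6 * (t₂ * t₂) + 12 * (t₂ * (q + g)) + 8 * (q * q) + 24 * (q * g) + 12 * (g * g) + 18 * t₂ + 12 * (ε * t₂) + 108 * q + 96 * g +
    3 * (3 * (t₁ + (t₂ + (q + g))) + 15) + 12 * (t₁ + (t₂ + (q + g))) + 6 * (i * t₂)
eliminate-m t₁ t₂ q g m i ε ℓ excess c≡ pos = transfer _ _ 0
  (ℕₚ.+-mono-≤ (ℕₚ.+-mono-≤ excess (ℕₚ.≤-reflexive (cong (λ c → 3 * ((t₂ + q + 2 * g) * c)) c≡)))
    (ℕₚ.+-mono-≤ (ℕₚ.≤-reflexive (cong (3 *_) (sym c≡))) (ℕₚ.*-monoˡ-≤ (3 * ℓ) pos)))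
  (identity t₁ t₂ q g m i ε ℓ)
  where
  identity : ∀ t₁ t₂ q g m i ε ℓ →
    6 * (t₂ * t₂) + 12 * (t₂ * (q + g)) + 8 * (q * q) + 24 * (q * g) + 12 * (g * g) + 18 * t₂ + 12 * (ε * t₂) + 108 * q + 96 * g +
    6 * (2 * m + i) + 12 * (t₁ + (t₂ + (q + g))) + 3 * ((t₂ + q + 2 * g) * (4 * m + 2 * i)) +
    (3 * (3 * (t₁ + (t₂ + (q + g))) + 15 + ℓ) + (t₂ + q + 2 * g) * (3 * ℓ)) +
    (3 * (i * i) + 6 * (i * q) + 3 * ((t₂ + q + 2 * g) * (3 * (t₁ + (t₂ + (q + g))) + 15)) + 24) + 0 ≡
    3 * (i * i) + 12 * (m * (t₂ + q + 2 * g)) + 12 * (i * (q + g)) + 24 +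
    3 * ((t₂ + q + 2 * g) * (3 * (t₁ + (t₂ + (q + g))) + 15 + ℓ)) +
    (3 * (4 * m + 2 * i) + 1 * (3 * ℓ)) +
    (6 * (t₂ * t₂) + 12 * (t₂ * (q + g)) + 8 * (q * q) + 24 * (q * g) + 12 * (g * g) + 18 * t₂ + 12 * (ε * t₂) + 108 * q + 96 * g +
     3 * (3 * (t₁ + (t₂ + (q + g))) + 15) + 12 * (t₁ + (t₂ + (q + g))) + 6 * (i * t₂))
  identity = solve-∀

outgrows : ∀ {s} y q g → 3 ≤ s → q + g ≤ s → 100 ≤ y → 84 * q + 27 * g + 43 ≤ y * s
outgrows {s} y q g 3≤s q+g≤s 100≤y = begin
    84 * q + 27 * g + 43               ≤⟨ ℕₚ.m≤m+n _ (57 * g + 5) ⟩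
    _                                  ≡⟨ arith q g ⟩
    84 * (q + g) + 16 * 3              ≤⟨ ℕₚ.+-mono-≤ (ℕₚ.*-monoʳ-≤ 84 q+g≤s) (ℕₚ.*-monoʳ-≤ 16 3≤s) ⟩
    84 * s + 16 * s                    ≡⟨ ℕₚ.*-distribʳ-+ s 84 16 ⟨
    100 * s                            ≤⟨ ℕₚ.*-monoˡ-≤ s 100≤y ⟩
    y * s                              ∎
  where
  open ℕₚ.≤-Reasoning
  arith : ∀ q g → 84 * q + 27 * g + 43 + (57 * g + 5) ≡ 84 * (q + g) + 16 * 3
  arith = solve-∀

absurd-bound : ∀ {a L} → a + 43 ≤ L → ¬ L ≤ a + 42
absurd-bound {a} lo hi = ℕₚ.1+n≰n (subst (_≤ a + 42) (ℕₚ.+-suc a 42) (ℕₚ.≤-trans lo hi))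

large-split : ∀ a b s → a < 50 → 150 ≤ b + (a + s) → b ≤ 1 → 100 ≤ s
large-split a b s a<50 big b≤1 = (ℕₚ.+-cancelˡ-≤ 50 100 s (ℕₚ.≤-trans big (begin
    b + (a + s)   ≤⟨ ℕₚ.+-mono-≤ b≤1 (ℕₚ.≤-refl {a + s}) ⟩
    suc (a + s)   ≤⟨ ℕₚ.+-monoˡ-≤ s a<50 ⟩
    50 + s        ∎)))
  where open ℕₚ.≤-Reasoning

-- The number of hubs is `b + a` with `b` in the role of ε: for ε = 1 one hub has been split off to
-- pay for ε t₂.
module _ {a b : ℕ} (b≤1 : b ≤ 1) where

  -- `q + d` stands for t₂. Either many hubs make 2as dominate, or t₂ is large and its products with
  -- `q` and `g` dominate, or both are small, and then `q` is too, so `g` must be large.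
  finish-twin-heavy : ∀ q d g → 3 ≤ (q + d) + (q + g) → 150 ≤ b + (a + ((q + d) + (q + g))) →
    ¬ 10 * ((q + d) * q) + 15 * ((q + d) * g) + 3 * (q * g) + 6 * (g * g) + 2 * (a * ((q + d) + (q + g))) + 3 * (q + d) ≤ 84 * q + 27 * g + 42
  finish-twin-heavy q d g s≥3 big with 50 ≤? a
  ... | yes a≥50 = absurd-bound (begin
      84 * q + 27 * g + 43                       ≤⟨ outgrows (2 * a) q g s≥3 (ℕₚ.m≤n+m (q + g) (q + d)) (ℕₚ.*-monoʳ-≤ 2 a≥50) ⟩
      2 * a * ((q + d) + (q + g))                ≤⟨ ℕₚ.m≤m+n _ _ ⟩
      _                                          ≡⟨ arith q d g a ⟩
      _                                          ∎)
    where
    open ℕₚ.≤-Reasoning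
    arith : ∀ q d g a → 2 * a * ((q + d) + (q + g)) + (10 * ((q + d) * q) + 15 * ((q + d) * g) + 3 * (q * g) + 6 * (g * g) + 3 * (q + d)) ≡
      10 * ((q + d) * q) + 15 * ((q + d) * g) + 3 * (q * g) + 6 * (g * g) + 2 * (a * ((q + d) + (q + g))) + 3 * (q + d)
    arith = solve-∀
  -- 15 is the least value for which the linear term 3(q + d) exceeds 42. For a = q = g = 0 nothing
  -- else is left on the left side: the square of t₂ has cancelled completely.
  ... | no a≱50 with 15 ≤? q + d
  ...   | yes t≥15 = absurd-bound (begin
      84 * q + 27 * g + 43                       ≤⟨ ℕₚ.m≤m+n _ (66 * q + 198 * g + 2) ⟩
      _                                          ≡⟨ arith₁ q g ⟩
      10 * (15 * q) + 15 * (15 * g) + 3 * 15     ≤⟨ ℕₚ.+-mono-≤ (ℕₚ.+-mono-≤ (ℕₚ.*-monoʳ-≤ 10 (ℕₚ.*-monoˡ-≤ q t≥15))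
                                                      (ℕₚ.*-monoʳ-≤ 15 (ℕₚ.*-monoˡ-≤ g t≥15))) (ℕₚ.*-monoʳ-≤ 3 t≥15) ⟩
      10 * ((q + d) * q) + 15 * ((q + d) * g) + 3 * (q + d) ≤⟨ ℕₚ.m≤m+n _ (3 * (q * g) + 6 * (g * g) + 2 * (a * ((q + d) + (q + g)))) ⟩
      _                                          ≡⟨ arith₂ q d g a ⟩
      _                                          ∎)
    where
    open ℕₚ.≤-Reasoning
    arith₁ : ∀ q g → 84 * q + 27 * g + 43 + (66 * q + 198 * g + 2) ≡ 10 * (15 * q) + 15 * (15 * g) + 3 * 15
    arith₁ = solve-∀
    arith₂ : ∀ q d g a → 10 * ((q + d) * q) + 15 * ((q + d) * g) + 3 * (q + d) + (3 * (q * g) + 6 * (g * g) + 2 * (a * ((q + d) + (q + g)))) ≡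
      10 * ((q + d) * q) + 15 * ((q + d) * g) + 3 * (q * g) + 6 * (g * g) + 2 * (a * ((q + d) + (q + g))) + 3 * (q + d)
    arith₂ = solve-∀
  ...   | no t≱15 = absurd-bound (begin
      84 * q + 27 * g + 43                       ≤⟨ ℕₚ.+-monoʳ-≤ (84 * q + 27 * g) (ℕₚ.*-monoʳ-≤ 43 (ℕₚ.≤-trans (s≤s z≤n) g≥50)) ⟩
      84 * q + 27 * g + 43 * g                   ≤⟨ ℕₚ.m≤m+n _ (66 * q + 230 * g) ⟩
      _                                          ≡⟨ arith₁ q g ⟩
      3 * (q * 50) + 6 * (g * 50)                ≤⟨ ℕₚ.+-mono-≤ (ℕₚ.*-monoʳ-≤ 3 (ℕₚ.*-monoʳ-≤ q g≥50)) (ℕₚ.*-monoʳ-≤ 6 (ℕₚ.*-monoʳ-≤ g g≥50)) ⟩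
      3 * (q * g) + 6 * (g * g)                  ≤⟨ ℕₚ.m≤m+n _ _ ⟩
      _                                          ≡⟨ arith₂ q d g a ⟩
      _                                          ∎)
    where
    open ℕₚ.≤-Reasoning
    t≤14 : q + d ≤ 14
    t≤14 = ℕₚ.≤-pred (ℕₚ.≰⇒> t≱15)
    g≥50 : 50 ≤ g
    g≥50 = ℕₚ.≤-trans (ℕₚ.m≤m+n 50 22) (ℕₚ.+-cancelˡ-≤ 28 72 g
      (ℕₚ.≤-trans (large-split a b _ (ℕₚ.≰⇒> a≱50) big b≤1)
                  (ℕₚ.+-mono-≤ t≤14 (ℕₚ.+-monoˡ-≤ g (ℕₚ.≤-trans (ℕₚ.m≤m+n q d) t≤14)))))
    arith₁ : ∀ q g → 84 * q + 27 * g + 43 * g + (66 * q + 230 * g) ≡ 3 * (q * 50) + 6 * (g * 50)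
    arith₁ = solve-∀
    arith₂ : ∀ q d g a → 3 * (q * g) + 6 * (g * g) + (10 * ((q + d) * q) + 15 * ((q + d) * g) + 2 * (a * ((q + d) + (q + g))) + 3 * (q + d)) ≡
      10 * ((q + d) * q) + 15 * ((q + d) * g) + 3 * (q * g) + 6 * (g * g) + 2 * (a * ((q + d) + (q + g))) + 3 * (q + d)
    arith₂ = solve-∀

  -- Either 2as dominates, or s is at least 100 and the left side contains s², which outgrows a
  -- linear form with coefficients below 100.
  finish-rich-heavy : ∀ t q g → 3 ≤ t + (q + g) → 150 ≤ b + (a + (t + (q + g))) →
    ¬ 3 * (t * t) + 6 * (t * q) + q * q + 15 * (t * g) + 3 * (q * g) + 6 * (g * g) + 2 * (a * (t + (q + g))) + 3 * t ≤ 84 * q + 27 * g + 42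
  finish-rich-heavy t q g s≥3 big with 50 ≤? a
  ... | yes a≥50 = absurd-bound (begin
      84 * q + 27 * g + 43                       ≤⟨ outgrows (2 * a) q g s≥3 (ℕₚ.m≤n+m (q + g) t) (ℕₚ.*-monoʳ-≤ 2 a≥50) ⟩
      2 * a * (t + (q + g))                      ≤⟨ ℕₚ.m≤m+n _ _ ⟩
      _                                          ≡⟨ arith t q g a ⟩
      _                                          ∎)
    where
    open ℕₚ.≤-Reasoning
    arith : ∀ t q g a → 2 * a * (t + (q + g)) + (3 * (t * t) + 6 * (t * q) + q * q + 15 * (t * g) + 3 * (q * g) + 6 * (g * g) + 3 * t) ≡
      3 * (t * t) + 6 * (t * q) + q * q + 15 * (t * g) + 3 * (q * g) + 6 * (g * g) + 2 * (a * (t + (q + g))) + 3 * t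
    arith = solve-∀
  ... | no a≱50 = absurd-bound (begin
      84 * q + 27 * g + 43                       ≤⟨ outgrows (t + (q + g)) q g s≥3 (ℕₚ.m≤n+m (q + g) t) (large-split a b _ (ℕₚ.≰⇒> a≱50) big b≤1) ⟩
      (t + (q + g)) * (t + (q + g))              ≤⟨ ℕₚ.m≤m+n _ _ ⟩
      _                                          ≡⟨ arith t q g a ⟩
      _                                          ∎)
    where
    open ℕₚ.≤-Reasoning
    arith : ∀ t q g a → (t + (q + g)) * (t + (q + g)) +
        (2 * (t * t) + 4 * (t * q) + 13 * (t * g) + q * g + 5 * (g * g) + 2 * (a * (t + (q + g))) + 3 * t) ≡
      3 * (t * t) + 6 * (t * q) + q * q + 15 * (t * g) + 3 * (q * g) + 6 * (g * g) + 2 * (a * (t + (q + g))) + 3 * t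
    arith = solve-∀

-- The linear hub terms on the right amount to 21a, at most 7as when s ≥ 3, against at least 9as on
-- the left; for s = 2 this would fail, which is where the threshold for s comes from. The term
-- 6i(t₂ - q) = 6id is absorbed by 3i² + 3d².
weaken-twin-heavy-0 : ∀ a q d g i → 3 ≤ ((q + d) + (q + g)) →
  3 * (i * i) + 6 * (i * q) + 3 * (((q + d) + q + 2 * g) * (3 * (a + ((q + d) + (q + g))) + 15)) + 24 ≤
    6 * ((q + d) * (q + d)) + 12 * ((q + d) * (q + g)) + 8 * (q * q) + 24 * (q * g) + 12 * (g * g) + 18 * (q + d) + 12 * (0 * (q + d)) + 108 * q + 96 * g + 3 * (3 * (a + ((q + d) + (q + g))) + 15) + 12 * (a + ((q + d) + (q + g))) + 6 * (i * (q + d)) →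
  10 * ((q + d) * q) + 15 * ((q + d) * g) + 3 * (q * g) + 6 * (g * g) + 2 * (a * ((q + d) + (q + g))) + 3 * (q + d) ≤ 84 * q + 27 * g + 42
weaken-twin-heavy-0 a q d g i s≥3 le = transfer _ _ (2 * (d * q) + (21 + 3 * (q + d)) + 9 * (a * g))
  (ℕₚ.+-mono-≤ le (ℕₚ.+-mono-≤ (ℕₚ.*-monoʳ-≤ 7 (ℕₚ.*-monoʳ-≤ a s≥3)) (ℕₚ.*-monoʳ-≤ 3 (2ab≤a²+b² i d)))) (identity a q d g i)
  where
  identity : ∀ a q d g i →
    6 * ((q + d) * (q + d)) + 12 * ((q + d) * (q + g)) + 8 * (q * q) + 24 * (q * g) + 12 * (g * g) + 18 * (q + d) + 12 * (0 * (q + d)) + 108 * q + 96 * g + 3 * (3 * (a + ((q + d) + (q + g))) + 15) + 12 * (a + ((q + d) + (q + g))) + 6 * (i * (q + d)) + (7 * (a * ((q + d) + (q + g))) + 3 * (i * i + d * d)) +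
    (10 * ((q + d) * q) + 15 * ((q + d) * g) + 3 * (q * g) + 6 * (g * g) + 2 * (a * ((q + d) + (q + g))) + 3 * (q + d)) +
    (2 * (d * q) + (21 + 3 * (q + d)) + 9 * (a * g)) ≡
    3 * (i * i) + 6 * (i * q) + 3 * (((q + d) + q + 2 * g) * (3 * (a + ((q + d) + (q + g))) + 15)) + 24 + (7 * (a * 3) + 3 * (2 * (i * d))) +
    (84 * q + 27 * g + 42)
  identity = solve-∀

-- The hub split off contributes 9(t₂ + q + 2g) on the left and 21 on the right, and ε adds 12t₂ on
-- the right. The slack 21 + 3t₂ of the case ε = 0 covers exactly the difference in t₂ and the
-- constant.
weaken-twin-heavy-1 : ∀ a q d g i → 3 ≤ ((q + d) + (q + g)) →
  3 * (i * i) + 6 * (i * q) + 3 * (((q + d) + q + 2 * g) * (3 * ((suc a) + ((q + d) + (q + g))) + 15)) + 24 ≤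
    6 * ((q + d) * (q + d)) + 12 * ((q + d) * (q + g)) + 8 * (q * q) + 24 * (q * g) + 12 * (g * g) + 18 * (q + d) + 12 * (1 * (q + d)) + 108 * q + 96 * g + 3 * (3 * ((suc a) + ((q + d) + (q + g))) + 15) + 12 * ((suc a) + ((q + d) + (q + g))) + 6 * (i * (q + d)) →
  10 * ((q + d) * q) + 15 * ((q + d) * g) + 3 * (q * g) + 6 * (g * g) + 2 * (a * ((q + d) + (q + g))) + 3 * (q + d) ≤ 84 * q + 27 * g + 42
weaken-twin-heavy-1 a q d g i s≥3 le = transfer _ _ (2 * (d * q) + (9 * q + 18 * g) + 9 * (a * g))
  (ℕₚ.+-mono-≤ le (ℕₚ.+-mono-≤ (ℕₚ.*-monoʳ-≤ 7 (ℕₚ.*-monoʳ-≤ a s≥3)) (ℕₚ.*-monoʳ-≤ 3 (2ab≤a²+b² i d)))) (identity a q d g i)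
  where
  identity : ∀ a q d g i →
    6 * ((q + d) * (q + d)) + 12 * ((q + d) * (q + g)) + 8 * (q * q) + 24 * (q * g) + 12 * (g * g) + 18 * (q + d) + 12 * (1 * (q + d)) + 108 * q + 96 * g + 3 * (3 * ((suc a) + ((q + d) + (q + g))) + 15) + 12 * ((suc a) + ((q + d) + (q + g))) + 6 * (i * (q + d)) + (7 * (a * ((q + d) + (q + g))) + 3 * (i * i + d * d)) +
    (10 * ((q + d) * q) + 15 * ((q + d) * g) + 3 * (q * g) + 6 * (g * g) + 2 * (a * ((q + d) + (q + g))) + 3 * (q + d)) +
    (2 * (d * q) + (9 * q + 18 * g) + 9 * (a * g)) ≡
    3 * (i * i) + 6 * (i * q) + 3 * (((q + d) + q + 2 * g) * (3 * ((suc a) + ((q + d) + (q + g))) + 15)) + 24 + (7 * (a * 3) + 3 * (2 * (i * d))) +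
    (84 * q + 27 * g + 42)
  identity = solve-∀

-- For t₂ ≤ q the terms in `i` are all on the favourable side and are discarded. Of 9q² on the left,
-- 8q² is spent on the 25/3 bound; the trivial 9 edges per rich pair would have demanded 12q².
weaken-rich-heavy-0 : ∀ a t d g i → 3 ≤ (t + ((t + d) + g)) →
  3 * (i * i) + 6 * (i * (t + d)) + 3 * ((t + (t + d) + 2 * g) * (3 * (a + (t + ((t + d) + g))) + 15)) + 24 ≤
    6 * (t * t) + 12 * (t * ((t + d) + g)) + 8 * ((t + d) * (t + d)) + 24 * ((t + d) * g) + 12 * (g * g) + 18 * t + 12 * (0 * t) + 108 * (t + d) + 96 * g + 3 * (3 * (a + (t + ((t + d) + g))) + 15) + 12 * (a + (t + ((t + d) + g))) + 6 * (i * t) →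
  3 * (t * t) + 6 * (t * (t + d)) + (t + d) * (t + d) + 15 * (t * g) + 3 * ((t + d) * g) + 6 * (g * g) + 2 * (a * (t + ((t + d) + g))) + 3 * t ≤ 84 * (t + d) + 27 * g + 42
weaken-rich-heavy-0 a t d g i s≥3 le = transfer _ _ (3 * (i * i) + 6 * (i * d) + (21 + 3 * t) + 9 * (a * g))
  (ℕₚ.+-mono-≤ le (ℕₚ.*-monoʳ-≤ 7 (ℕₚ.*-monoʳ-≤ a s≥3))) (identity a t d g i)
  where
  identity : ∀ a t d g i →
    6 * (t * t) + 12 * (t * ((t + d) + g)) + 8 * ((t + d) * (t + d)) + 24 * ((t + d) * g) + 12 * (g * g) + 18 * t + 12 * (0 * t) + 108 * (t + d) + 96 * g + 3 * (3 * (a + (t + ((t + d) + g))) + 15) + 12 * (a + (t + ((t + d) + g))) + 6 * (i * t) + (7 * (a * (t + ((t + d) + g)))) +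
    (3 * (t * t) + 6 * (t * (t + d)) + (t + d) * (t + d) + 15 * (t * g) + 3 * ((t + d) * g) + 6 * (g * g) + 2 * (a * (t + ((t + d) + g))) + 3 * t) +
    (3 * (i * i) + 6 * (i * d) + (21 + 3 * t) + 9 * (a * g)) ≡
    3 * (i * i) + 6 * (i * (t + d)) + 3 * ((t + (t + d) + 2 * g) * (3 * (a + (t + ((t + d) + g))) + 15)) + 24 + (7 * (a * 3)) +
    (84 * (t + d) + 27 * g + 42)
  identity = solve-∀

weaken-rich-heavy-1 : ∀ a t d g i → 3 ≤ (t + ((t + d) + g)) →
  3 * (i * i) + 6 * (i * (t + d)) + 3 * ((t + (t + d) + 2 * g) * (3 * ((suc a) + (t + ((t + d) + g))) + 15)) + 24 ≤
    6 * (t * t) + 12 * (t * ((t + d) + g)) + 8 * ((t + d) * (t + d)) + 24 * ((t + d) * g) + 12 * (g * g) + 18 * t + 12 * (1 * t) + 108 * (t + d) + 96 * g + 3 * (3 * ((suc a) + (t + ((t + d) + g))) + 15) + 12 * ((suc a) + (t + ((t + d) + g))) + 6 * (i * t) →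
  3 * (t * t) + 6 * (t * (t + d)) + (t + d) * (t + d) + 15 * (t * g) + 3 * ((t + d) * g) + 6 * (g * g) + 2 * (a * (t + ((t + d) + g))) + 3 * t ≤ 84 * (t + d) + 27 * g + 42
weaken-rich-heavy-1 a t d g i s≥3 le = transfer _ _ (3 * (i * i) + 6 * (i * d) + (9 * (t + d) + 18 * g) + 9 * (a * g))
  (ℕₚ.+-mono-≤ le (ℕₚ.*-monoʳ-≤ 7 (ℕₚ.*-monoʳ-≤ a s≥3))) (identity a t d g i)
  where
  identity : ∀ a t d g i →
    6 * (t * t) + 12 * (t * ((t + d) + g)) + 8 * ((t + d) * (t + d)) + 24 * ((t + d) * g) + 12 * (g * g) + 18 * t + 12 * (1 * t) + 108 * (t + d) + 96 * g + 3 * (3 * ((suc a) + (t + ((t + d) + g))) + 15) + 12 * ((suc a) + (t + ((t + d) + g))) + 6 * (i * t) + (7 * (a * (t + ((t + d) + g)))) +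
    (3 * (t * t) + 6 * (t * (t + d)) + (t + d) * (t + d) + 15 * (t * g) + 3 * ((t + d) * g) + 6 * (g * g) + 2 * (a * (t + ((t + d) + g))) + 3 * t) +
    (3 * (i * i) + 6 * (i * d) + (9 * (t + d) + 18 * g) + 9 * (a * g)) ≡
    3 * (i * i) + 6 * (i * (t + d)) + 3 * ((t + (t + d) + 2 * g) * (3 * ((suc a) + (t + ((t + d) + g))) + 15)) + 24 + (7 * (a * 3)) +
    (84 * (t + d) + 27 * g + 42)
  identity = solve-∀

many-hubs : ∀ t₁ t₂ q g m i ε → ε ≤ 1 → ε ≤ t₁ → Excess t₁ t₂ q g m i ε →
  150 ≤ t₁ + (t₂ + (q + g)) → 3 * (t₁ + (t₂ + (q + g))) + 15 ≤ 4 * m + 2 * i → t₂ + (q + g) ≤ 2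
many-hubs t₁ t₂ q g m i ε ε≤1 ε≤t₁ excess big room with 3 ≤? t₂ + (q + g)
... | no  s≱3 = ℕₚ.≤-pred (ℕₚ.≰⇒> s≱3)
... | yes s≥3 with ℓ , c≡ ← ℕₚ.m≤n⇒∃[o]m+o≡n room
  = ⊥-elim (split t₁ ε ε≤1 ε≤t₁ big (eliminate-m t₁ t₂ q g m i ε ℓ excess c≡ pos) (ℕₚ.≤-total q t₂))
  where
  pos : 1 ≤ t₂ + q + 2 * g
  pos = ℕₚ.≤-trans (ℕₚ.≤-trans (s≤s z≤n) s≥3) (ℕₚ.≤-trans (ℕₚ.≤-reflexive (sym (ℕₚ.+-assoc t₂ q g))) (ℕₚ.+-monoʳ-≤ (t₂ + q) (ℕₚ.m≤m+n g (g + 0))))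
  split : ∀ t₁ ε → ε ≤ 1 → ε ≤ t₁ → 150 ≤ t₁ + (t₂ + (q + g)) →
    3 * (i * i) + 6 * (i * q) + 3 * ((t₂ + q + 2 * g) * (3 * (t₁ + (t₂ + (q + g))) + 15)) + 24 ≤
      6 * (t₂ * t₂) + 12 * (t₂ * (q + g)) + 8 * (q * q) + 24 * (q * g) + 12 * (g * g) + 18 * t₂ + 12 * (ε * t₂) + 108 * q + 96 * g +
      3 * (3 * (t₁ + (t₂ + (q + g))) + 15) + 12 * (t₁ + (t₂ + (q + g))) + 6 * (i * t₂) →
    q ≤ t₂ ⊎ t₂ ≤ q → ⊥
  -- The order of `q` and `t₂` decides the sign of 6i(t₂ - q), and `d` names the difference.
  split t₁ 0 _ _ big le (inj₁ q≤t) with d , refl ← ℕₚ.m≤n⇒∃[o]m+o≡n q≤t =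
    finish-twin-heavy {t₁} {0} z≤n q d g s≥3 big (weaken-twin-heavy-0 t₁ q d g i s≥3 le)
  split t₁ 0 _ _ big le (inj₂ t≤q) with d , refl ← ℕₚ.m≤n⇒∃[o]m+o≡n t≤q =
    finish-rich-heavy {t₁} {0} z≤n t₂ (t₂ + d) g s≥3 big (weaken-rich-heavy-0 t₁ t₂ d g i s≥3 le)
  split (suc a) 1 _ _ big le (inj₁ q≤t) with d , refl ← ℕₚ.m≤n⇒∃[o]m+o≡n q≤t =
    finish-twin-heavy {a} {1} ℕₚ.≤-refl q d g s≥3 big (weaken-twin-heavy-1 a q d g i s≥3 le)
  split (suc a) 1 _ _ big le (inj₂ t≤q) with d , refl ← ℕₚ.m≤n⇒∃[o]m+o≡n t≤q =
    finish-rich-heavy {a} {1} ℕₚ.≤-refl t₂ (t₂ + d) g s≥3 big (weaken-rich-heavy-1 a t₂ d g i s≥3 le)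
  split _ (suc (suc _)) (s≤s ()) _ _ _ _

-- For s = 0 the comparison reads 3i² + 24 ≤ 6(2m + i) + 12k, whose right side is 6k below 6n. Two
-- further triangles contribute only a constant, which 6k outweighs.
few-isolated : ∀ t₁ t₂ q g m i ε → ε ≤ 1 → Excess t₁ t₂ q g m i ε → 150 ≤ t₁ + (t₂ + (q + g)) → t₂ + (q + g) ≤ 2 →
  i * i < 2 * (3 * (t₁ + (t₂ + (q + g))) + (2 * m + i))
few-isolated t₁ t₂ q g m i ε ε≤1 excess big s≤2 = ℕₚ.≰⇒> λ many →
  -- 924 is 6 * 150 + 24, and 264 is 12 * 2² + 108 * 2.
  contradiction (ℕₚ.≤-trans (ℕₚ.+-monoˡ-≤ 24 (ℕₚ.*-monoʳ-≤ 6 big)) (ℕₚ.≤-trans (combined many) remainder≤264)) (from-no (924 ≤? 264))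
  where
  s = t₂ + (q + g)
  remainder = 6 * (t₂ * t₂) + 12 * (t₂ * (q + g)) + 8 * (q * q) + 24 * (q * g) + 12 * (g * g) + 18 * t₂ + 12 * (ε * t₂) + 108 * q + 96 * g
  combined : 2 * (3 * (t₁ + s) + (2 * m + i)) ≤ i * i → 6 * (t₁ + s) + 24 ≤ remainder
  combined many = transfer (6 * (t₁ + s) + 24) remainder (12 * (m * (t₂ + q + 2 * g)) + 12 * (i * (q + g))) (ℕₚ.+-mono-≤ excess (ℕₚ.*-monoʳ-≤ 3 many))
    (arith (t₁ + s) m i (m * (t₂ + q + 2 * g)) (i * (q + g)) remainder)
    where
    arith : ∀ k m i x y r → r + 6 * (2 * m + i) + 12 * k + 3 * (i * i) + (6 * k + 24) + (12 * x + 12 * y) ≡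
      3 * (i * i) + 12 * x + 12 * y + 24 + 3 * (2 * (3 * k + (2 * m + i))) + r
    arith = solve-∀
  remainder≤264 : remainder ≤ 264
  remainder≤264 = begin
      6 * (t₂ * t₂) + 12 * (t₂ * (q + g)) + 8 * (q * q) + 24 * (q * g) + 12 * (g * g) + 18 * t₂ + 12 * (ε * t₂) + 108 * q + 96 * g
        ≤⟨ ℕₚ.+-monoˡ-≤ (96 * g) (ℕₚ.+-monoˡ-≤ (108 * q) (ℕₚ.+-monoʳ-≤ quadratic (ℕₚ.*-monoʳ-≤ 12 (ℕₚ.*-monoˡ-≤ t₂ ε≤1)))) ⟩
      quadratic + 12 * (1 * t₂) + 108 * q + 96 * g   ≤⟨ ℕₚ.m≤m+n _ (6 * (t₂ * t₂) + 12 * (t₂ * (q + g)) + 4 * (q * q) + 78 * t₂ + 12 * g) ⟩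
      _                                              ≡⟨ arith t₂ q g ⟩
      12 * (s * s) + 108 * s                         ≤⟨ ℕₚ.+-mono-≤ (ℕₚ.*-monoʳ-≤ 12 (ℕₚ.*-mono-≤ s≤2 s≤2)) (ℕₚ.*-monoʳ-≤ 108 s≤2) ⟩
      264                                            ∎
    where
    open ℕₚ.≤-Reasoning
    quadratic = 6 * (t₂ * t₂) + 12 * (t₂ * (q + g)) + 8 * (q * q) + 24 * (q * g) + 12 * (g * g) + 18 * t₂
    arith : ∀ t₂ q g → 6 * (t₂ * t₂) + 12 * (t₂ * (q + g)) + 8 * (q * q) + 24 * (q * g) + 12 * (g * g) + 18 * t₂ + 12 * (1 * t₂) + 108 * q + 96 * g +
      (6 * (t₂ * t₂) + 12 * (t₂ * (q + g)) + 4 * (q * q) + 78 * t₂ + 12 * g) ≡ 12 * ((t₂ + (q + g)) * (t₂ + (q + g))) + 108 * (t₂ + (q + g))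
    arith = solve-∀

-- Rational and integer arithmetic

open import Data.Integer as ℤ using (+_; -[1+_]; _-_)
import Data.Integer.Properties as ℤₚ
open import Data.Rational as ℚ using (ℚ; mkℚ; 0ℚ; _/_)
import Data.Rational.Properties as ℚₚ
open import Data.Rational.Unnormalised as ℚᵘ using (mkℚᵘ)
import Data.Rational.Unnormalised.Properties as ℚᵘₚ

-- The numerator of δ is at least 1, so n ≥ c times the denominator gives δn ≥ c. In unnormalised
-- rationals the order is plain cross-multiplication.
large-t : (δ : ℚ) → 0ℚ ℚ.< δ → ∀ c n t → c * ℚ.↧ₙ δ ≤ n → δ ℚ.* (+ n / 1) ℚ.≤ (+ t / 1) → c ≤ t
large-t (mkℚ (+ zero)  _ _) (ℚ.*<* (ℤ.+<+ ())) _ _ _ _ _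
large-t (mkℚ -[1+ _ ] _ _) (ℚ.*<* ()) _ _ _ _ _
large-t δ@(mkℚ (+ suc a) d _) _ c n t le δn≤t = ℕₚ.*-cancelʳ-≤ c t (suc d) (begin
    c * suc d                     ≤⟨ le ⟩
    n                             ≤⟨ ℕₚ.m≤n*m n (suc a) ⟩
    suc a * n                     ≡⟨ ℕₚ.*-identityʳ (suc a * n) ⟨
    suc a * n * 1                 ≤⟨ cross ⟩
    t * (suc d * 1)               ≡⟨ cong (t *_) (ℕₚ.*-identityʳ (suc d)) ⟩
    t * suc d                     ∎)
  where
  open ℕₚ.≤-Reasoning
  unnormalised : mkℚᵘ (+ suc a) d ℚᵘ.* mkℚᵘ (+ n) 0 ℚᵘ.≤ mkℚᵘ (+ t) 0
  unnormalised = ℚᵘₚ.≤-respʳ-≃ (ℚₚ.toℚᵘ-fromℚᵘ (mkℚᵘ (+ t) 0))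
    (ℚᵘₚ.≤-respˡ-≃ (ℚᵘₚ.≃-trans (ℚₚ.toℚᵘ-homo-* δ (+ n / 1)) (ℚᵘₚ.*-congˡ {mkℚᵘ (+ suc a) d} (ℚₚ.toℚᵘ-fromℚᵘ (mkℚᵘ (+ n) 0))))
      (ℚₚ.toℚᵘ-mono-≤ δn≤t))
  cross : suc a * n * 1 ≤ t * (suc d * 1)
  cross with ℚᵘ.*≤* le′ ← unnormalised = ℤₚ.drop‿+≤+ (subst₂ ℤ._≤_ lhs rhs le′)
    where
    lhs : (+ suc a ℤ.* + n) ℤ.* + 1 ≡ + (suc a * n * 1)
    lhs = trans (cong (ℤ._* + 1) (sym (ℤₚ.pos-* (suc a) n))) (sym (ℤₚ.pos-* (suc a * n) 1))
    rhs : + t ℤ.* + (suc d * 1) ≡ + (t * (suc d * 1))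
    rhs = sym (ℤₚ.pos-* t (suc d * 1))

difference : ∀ {n} a b → n ≡ a + b → + n - + a ≡ + b
difference {n} a b refl = trans (ℤₚ.m-n≡m⊖n (a + b) a) (trans (ℤₚ.⊖-≥ (ℕₚ.m≤m+n a b)) (cong +_ (ℕₚ.m+n∸m≡n a b)))

-- Assembling the theorem

tiling-size : {H : Graph n} {t ex : ℕ} (τ : TilingData n) → Optimal H (𝒯 τ) (ℳ τ) (ℐ τ) →
  SK3Free (t + 2) H → IsEx n (t + 1) ex → edgeCount H ≡ ex + 2 → length (𝒯 τ) ≡ suc t
tiling-size {H = H} {t} {ex} τ opt free (_ , largest) e≡ = ℕₚ.≤-antisym upper lower
  where
  open Exchange opt
  upper : length (𝒯 τ) ≤ suc t
  upper = ℕₚ.≮⇒≥ λ lt → free (triangles⇒ContainsSK3 H (t + 2) (𝒯 τ) triangles (Unique-++ˡ (verts (𝒯 τ)) all-unique)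
    (subst (_≤ length (𝒯 τ)) (ℕₚ.+-comm 2 t) lt))
  lower : suc t ≤ length (𝒯 τ)
  lower = ℕₚ.≮⇒≥ λ lt → ℕₚ.m+1+n≰m ex (subst (_≤ ex) e≡ (largest H λ contains →
    let Ts , tris , Ts! , l = ContainsSK3⇒triangles H (t + 1) contains
    in ℕₚ.<⇒≱ lt (subst (_≤ length (𝒯 τ)) (trans l (ℕₚ.+-comm t 1)) (maxT Ts tris Ts!))))

size-equation : {H : Graph n} {C : List (Tri n)} {M : List (Edge n)} {I : List (Fin n)} → Optimal H C M I →
  n ≡ 3 * length C + (2 * length M + length I)
size-equation {n} {C = C} {M} {I} opt = begin
    n                                              ≡⟨ Listₚ.length-tabulate id ⟨
    length (allFin n)                              ≡⟨ ↭-length cover ⟨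
    length (verts C ++ everts M ++ I)              ≡⟨ Listₚ.length-++ (verts C) ⟩
    length (verts C) + length (everts M ++ I)      ≡⟨ cong₂ _+_ (length-concatMap-const triVerts 3 (λ _ → refl) C)
                                                        (trans (Listₚ.length-++ (everts M)) (cong (_+ length I) (length-concatMap-const edgeVerts 2 (λ _ → refl) M))) ⟩
    length C * 3 + (length M * 2 + length I)       ≡⟨ cong₂ _+_ (ℕₚ.*-comm (length C) 3) (cong (_+ length I) (ℕₚ.*-comm (length M) 2)) ⟩
    3 * length C + (2 * length M + length I)       ∎
  where
  open Optimal opt
  open ≡-Reasoning

record Decomposition (H : Graph n) (M : List (Edge n)) (I : List (Fin n)) (T₁ S : List (Tri n)) : Set where
  field
    {C₁ C₂ Q G} : List (Tri n)
    opt      : Optimal H (C₁ ++ (C₂ ++ (Q ++ G))) M I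
    prehubs  : All (PreHub H M) C₁
    pretwins : All (PreTwin H M I) C₂
    riches   : All (RichBounded H (3 * length M + length I + 5) (everts M ++ I)) Q
    poors    : All (Poor H (everts M ++ I)) G
    length₁  : length C₁ ≡ length T₁
    lengthₛ  : length C₂ + (length Q + length G) ≡ length S

decompose : {H : Graph n} {C : List (Tri n)} {M : List (Edge n)} {I : List (Fin n)} (T₁ S : List (Tri n)) → Optimal H C M I → T₁ ++ S ↭ C →
  (∀ {Δ} → Δ ∈ T₁ → 2 ≤ edgesSeeing H M Δ) → (∀ {Δ} → Δ ∈ S → ¬ 2 ≤ edgesSeeing H M Δ) → Decomposition H M I T₁ S
decompose {H = H} {C} {M} {I} T₁ S opt p seen unseen =
  let C₁ , l₁ , p₁ , tris₁ , hubs = collect H T₁ λ {Δ} Δ∈ → reorder-hub H M Δ M-unique (tri (∈-++⁺ˡ Δ∈)) (seen Δ∈)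
      C₂ , Q , G , l₂ , p₂ , tris₂ , twins , riches , poors = collect₃ H S classify
      lengths = trans (Listₚ.length-++ C₁) (trans (cong₂ _+_ l₁ (trans (Listₚ.length-++ C₂) (trans (cong (λ l → length C₂ + l) (Listₚ.length-++ Q)) l₂)))
                  (trans (sym (Listₚ.length-++ T₁)) (↭-length p)))
      vertices = ↭-trans (concatMap-↭ triVerts (↭-sym p)) (↭-trans (↭-reflexive (Listₚ.concatMap-++ triVerts T₁ S))
                   (↭-trans (++⁺ p₁ p₂) (↭-reflexive (sym (Listₚ.concatMap-++ triVerts C₁ (C₂ ++ (Q ++ G)))))))
  in record { opt = reorder-optimal opt vertices lengths (Allₚ.++⁺ tris₁ tris₂)
            ; prehubs = hubs ; pretwins = twins ; riches = riches ; poors = poors ; length₁ = l₁ ; lengthₛ = l₂ }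
  where
  open Exchange opt
  tri : ∀ {Δ} → Δ ∈ T₁ ++ S → IsTriangle H Δ
  tri Δ∈ = All.lookup triangles (∈-resp-↭ p Δ∈)
  classify : ∀ {Δ} → Δ ∈ S → Reordering H (PreTwin H M I) Δ ⊎
    Reordering H (RichBounded H (3 * length M + length I + 5) (everts M ++ I)) Δ ⊎ Reordering H (Poor H (everts M ++ I)) Δ
  classify {Δ} Δ∈ with 2 ≤? verticesSeeing H I Δ
  ... | yes two = inj₁ (reorder-twin H M I Δ I-unique (tri (∈-++⁺ʳ T₁ Δ∈)) (ℕₚ.≤-pred (ℕₚ.≰⇒> (unseen Δ∈))) two)
  ... | no ¬two = inj₂ (reorder-rich-or-poor H _ _ Δ O-unique (tri (∈-++⁺ʳ T₁ Δ∈))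
                    (E-barely-seen H Δ M I (ℕₚ.≤-pred (ℕₚ.≰⇒> (unseen Δ∈))) (ℕₚ.≤-pred (ℕₚ.≰⇒> ¬two))))

structure-bounds : {H : Graph n} {M : List (Edge n)} {I : List (Fin n)} {T₁ S : List (Tri n)} → Decomposition H M I T₁ S →
  (t r : ℕ) → suc t ≡ length T₁ + length S → r ≡ 2 * suc t + 2 * length M + length I + 1 → 150 ≤ suc t →
  3 * suc t + 15 ≤ 4 * length M + 2 * length I →
  2 * (t * t) + 4 * (t * r) + r * r + 8 ≤ 4 * edgeCount H + 1 + 2 * t →
  length S ≤ 2 × length I * length I < 2 * (3 * suc t + (2 * length M + length I))
structure-bounds {H = H} {M} {I} {T₁} {S} D t r k≡ r≡ big room lower =
  let open Decomposition D
      open Count opt prehubs pretwins riches poors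
      open Bounds opt using (E-O-O)
      ε , ε≤1 , ε≤t₁ , b₁₂ = E₁₂-sharp
      k≡′ : suc t ≡ length C₁ + (length C₂ + (length Q + length G))
      k≡′ = trans k≡ (sym (cong₂ _+_ length₁ lengthₛ))
      upper = edge-upper-bound {t₁ = length C₁} {t₂ = length C₂} {q = length Q} {g = length G} {m = length M} {i = length I} {ε = ε}
        {e = edgeCount H} {eqq = E H (verts Q) (verts Q)}
        E-total E₁₁ b₁₂ (E₁-part Q ∈-++⁺ˡ) (E₁-part G (∈-++⁺ʳ Q)) E₁-O
        E₂₂ (E₂-part Q ∈-++⁺ˡ) (E₂-part G (∈-++⁺ʳ Q)) E₂-O E-QQ E-QG E-Q-O E-GG E-G-O E-O-O
      excess = excess-bound (length C₁) (length C₂) (length Q) (length G) (length M) (length I) ε (edgeCount H) t upper k≡′ r r≡ lower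
      s≤2 = many-hubs (length C₁) (length C₂) (length Q) (length G) (length M) (length I) ε ε≤1 ε≤t₁ excess (subst (150 ≤_) k≡′ big)
              (subst (λ k → 3 * k + 15 ≤ 4 * length M + 2 * length I) k≡′ room)
      few = few-isolated (length C₁) (length C₂) (length Q) (length G) (length M) (length I) ε ε≤1 excess (subst (150 ≤_) k≡′ big) s≤2
  in subst (_≤ 2) lengthₛ s≤2 , subst (λ k → length I * length I < 2 * (3 * k + (2 * length M + length I))) (sym k≡′) few

theorem3p1 : (δ : ℚ) → 0ℚ ℚ.< δ →
    Σ ℕ λ N₁ → (n : ℕ) → n ≥ N₁ →
    (t : ℕ) → δ ℚ.* (+ n / 1) ℚ.≤ (+ t / 1) → 9 * t + 24 ≤ 2 * n →
    (H : Graph n) → SK3Free (t + 2) H →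
    (ex : ℕ) → IsEx n (t + 1) ex → edgeCount H ≡ ex + 2 →
    (τ : TilingData n) → IsMaximalTilingTriple H τ →
    (T1 T2 T3 T4 : List (Tri n)) → IsIdealPartition H τ T1 T2 T3 T4 →
    ((t ≤ length T1 + 1) × (length T1 ≤ t + 1)) ×
    ((+ (2 * length (ℳ τ)) ℤ.≤ + n - + (3 * (t + 1))) ×
    ((+ n - + (3 * (t + 1)) - + (2 * length (ℳ τ))) <√ (2 * n))) ×
    (length (ℐ τ) * length (ℐ τ) < 2 * n)
theorem3p1 δ δ>0 = 149 * ℚ.↧ₙ δ , λ n n≥N₁ t δn≤t 9t+24≤2n H free ex isEx e≡ τ max T1 T2 T3 T4 (R , T↭ , inT1 , _ , _) →
  let opt = maximal⇒optimal {H = H} τ max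
      m = length (ℳ τ)
      i = length (ℐ τ)
      -- `R` is the input of the peeling process, so `S` consists of all triangles outside `T1`.
      S = T2 ++ R
      size = tiling-size {t = t} τ opt free isEx e≡
      n≡ : n ≡ 3 * suc t + (2 * m + i)
      n≡ = trans (size-equation opt) (cong (λ k → 3 * k + (2 * m + i)) size)
      k≡ : suc t ≡ length T1 + length S
      k≡ = trans (sym size) (trans (sym (↭-length T↭)) (Listₚ.length-++ T1))
      T! = Unique-resp-↭ (↭-sym T↭) (Exchange.C-unique opt)
      D = decompose T1 S opt T↭
            (λ {Δ} Δ∈ → proj₁ (inT1 Δ (∈-resp-↭ T↭ (∈-++⁺ˡ Δ∈))) Δ∈)
            (λ {Δ} Δ∈ seen → Unique-++-disjoint T1 T! (proj₂ (inT1 Δ (∈-resp-↭ T↭ (∈-++⁺ʳ T1 Δ∈))) seen) Δ∈ refl)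
      -- The choice of N₁ gives t ≥ 149, so k = t + 1 is at least 150, as the final estimates
      -- require.
      few , i²<′ = structure-bounds D t (2 * suc t + 2 * m + i + 1) k≡ refl (s≤s (large-t δ δ>0 149 n t n≥N₁ δn≤t))
                 (room t m i (subst (λ n → 9 * t + 24 ≤ 2 * n) n≡ 9t+24≤2n))
                 (subst (λ e → 2 * (t * t) + 4 * (t * (2 * suc t + 2 * m + i + 1)) + (2 * suc t + 2 * m + i + 1) * (2 * suc t + 2 * m + i + 1) + 8 ≤ 4 * e + 1 + 2 * t)
                   (sym e≡) (extremal n t (2 * suc t + 2 * m + i + 1) ex (trans n≡ (split t m i)) isEx))
      i²< = subst (λ n → i * i < 2 * n) (sym n≡) i²<′
      rest≡ = difference (3 * (t + 1)) (2 * m + i) (trans n≡ (cong (λ k → 3 * k + (2 * m + i)) (ℕₚ.+-comm 1 t)))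
  in (ℕₚ.≤-pred (begin-t t (length T1) (length S) k≡ few) ,
      ℕₚ.≤-trans (ℕₚ.m≤m+n (length T1) (length S)) (ℕₚ.≤-reflexive (trans (sym k≡) (ℕₚ.+-comm 1 t)))) ,
     (subst (+ (2 * m) ℤ.≤_) (sym rest≡) (ℤ.+≤+ (ℕₚ.m≤m+n (2 * m) i)) ,
      inj₂ (subst (λ z → ℤ.∣ z ∣ * ℤ.∣ z ∣ < 2 * n) (sym (trans (cong (_- + (2 * m)) rest≡) (difference (2 * m) i refl))) i²<)) ,
     i²<
  where
  room : ∀ t m i → 9 * t + 24 ≤ 2 * (3 * suc t + (2 * m + i)) → 3 * suc t + 15 ≤ 4 * m + 2 * i
  room t m i le = transfer _ _ 0 le (arith t m i)
    where
    arith : ∀ t m i → 2 * (3 * suc t + (2 * m + i)) + (3 * suc t + 15) + 0 ≡ 9 * t + 24 + (4 * m + 2 * i)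
    arith = solve-∀
  split : ∀ t m i → 3 * suc t + (2 * m + i) ≡ t + (2 * suc t + 2 * m + i + 1)
  split = solve-∀
  extremal : ∀ n t r ex → n ≡ t + r → IsEx n (t + 1) ex → 2 * (t * t) + 4 * (t * r) + r * r + 8 ≤ 4 * (ex + 2) + 1 + 2 * t
  extremal n t r ex refl (_ , largest) = begin
      2 * (t * t) + 4 * (t * r) + r * r + 8            ≤⟨ ℕₚ.+-monoˡ-≤ 8 (joinGraph-edges t r) ⟩
      4 * edgeCount (joinGraph t (t + r)) + 1 + 2 * t + 8
        ≤⟨ ℕₚ.+-monoˡ-≤ 8 (ℕₚ.+-monoˡ-≤ (2 * t) (ℕₚ.+-monoˡ-≤ 1 (ℕₚ.*-monoʳ-≤ 4 (largest (joinGraph t (t + r)) (joinGraph-free t (t + r)))))) ⟩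
      4 * ex + 1 + 2 * t + 8                           ≡⟨ arith ex t ⟩
      4 * (ex + 2) + 1 + 2 * t                         ∎
    where
    open ℕₚ.≤-Reasoning
    arith : ∀ ex t → 4 * ex + 1 + 2 * t + 8 ≡ 4 * (ex + 2) + 1 + 2 * t
    arith = solve-∀
  begin-t : ∀ t a s → suc t ≡ a + s → s ≤ 2 → suc t ≤ suc (a + 1)
  begin-t t a s eq s≤2 = ℕₚ.≤-trans (ℕₚ.≤-reflexive eq) (ℕₚ.≤-trans (ℕₚ.+-monoʳ-≤ a s≤2) (ℕₚ.≤-reflexive (ℕₚ.+-suc a 1)))
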